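{- Let $n\ge 2$ be an even integer and $m\ge 8$. Then the pebbling number of the Jahangir graph satisfies $$f(J_{n,m})=f_{2^{n/2+1}-1}(C_{n+2})+\alpha+1,$$ where $$\alpha=\begin{cases}\frac{m}{2}\big(f(C_n)+f(C_{n+2})-2\big)-f(C_{n+2})+1, & m \text{ even},\\[2pt] \frac{m-1}{2}\big(f(C_n)+f(C_{n+2})-2\big)+f(C_{n+1})-f(C_{n+2}), & m\text{ odd}.\end{cases}$$ In particular, $f(J_{2,m})=2m+10$ for $m\ge 8$.
   Context: The Jahangir graph $J_{n,m}$ ($m\ge3$) consists of the cycle $C_{nm}=v_0v_1\cdots v_{nm-1}v_0$ together with an extra vertex $u$ adjacent to $v_{ni}$ for $0\le i\le m-1$. A pebbling distribution assigns a nonnegative integer number of pebbles to each vertex. A pebbling move removes two pebbles from a vertex and places one pebble on an adjacent vertex. For a graph $G$ and integer $t\ge1$, the $t$-fold pebbling number $f_t(G)$ is the least $p$ such that from every distribution of $p$ pebbles on $G$ and for every vertex $w$, some sequence of pebbling moves results in at least $t$ pebbles on $w$; the pebbling number is $f(G)=f_1(G)$. $C_k$ is the cycle on $k$ vertices, with $f(C_{2k'})=2^{k'}$ and $f(C_{2k'+1})=2\lfloor 2^{k'+1}/3\rfloor+1$ (these formulas also used as the convention for $k<3$, e.g. $f(C_2)=2$). -}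

module Defs where

open import Data.Nat using (ℕ; zero; suc; _*_; _∸_; _≤_)
open import Data.Nat.DivMod using (_/_)
open import Data.Nat.Divisibility using (_∣?_)
open import Data.Nat.Properties using (≤-antisym)
open import Data.Integer as ℤ using (ℤ; +_)
open import Data.Fin using (Fin; zero; suc; toℕ)
open import Data.Vec using (Vec; lookup; sum; _[_]%=_)
open import Data.Product using (∃; ∃₂; _×_; _,_)
open import Data.Sum using (_⊎_; swap)
open import Data.Empty using (⊥)
open import Function using (_∘_)
open import Relation.Nullary using (¬_)
open import Relation.Nullary.Decidable using (does)
open import Data.Bool using (if_then_else_)
open import Relation.Binary.PropositionalEquality using (_≡_; _≢_; refl; sym)
open import Relation.Binary.Construct.Closure.ReflexiveTransitive using (Star)

record Graph : Set₁ where
  field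
    order   : ℕ
    Adj     : Fin order → Fin order → Set
    adj-sym : ∀ {a b} → Adj a b → Adj b a
    irrefl  : ∀ {a} → ¬ Adj a a

open Graph public

-- Next k i j : j = i + 1 modulo k.
Next : ∀ k → Fin k → Fin k → Set
Next k i j = (toℕ j ≡ suc (toℕ i)) ⊎ (suc (toℕ i) ≡ k × toℕ j ≡ 0)

CycleAdj : ∀ k → Fin k → Fin k → Set
CycleAdj k i j = i ≢ j × (Next k i j ⊎ Next k j i)

-- For k = 2 this is a single edge, whose pebbling number is 2; this agrees with
-- the convention f(C₂) = 2¹.  The condition i ≢ j matters only for k = 1.
cycle : ℕ → Graph
cycle k = record
  { order   = k
  ; Adj     = CycleAdj k
  ; adj-sym = λ (i≢j , e) → i≢j ∘ sym , swap e
  ; irrefl  = λ (i≢i , _) → i≢i refl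
  }

-- The vertex zero is the centre u; the vertex suc i is vᵢ.
JahangirAdj : ∀ n m → Fin (suc (n * m)) → Fin (suc (n * m)) → Set
JahangirAdj n m zero    zero    = ⊥
JahangirAdj n m zero    (suc j) = ∃ λ (i : Fin m) → toℕ j ≡ n * toℕ i
JahangirAdj n m (suc j) zero    = ∃ λ (i : Fin m) → toℕ j ≡ n * toℕ i
JahangirAdj n m (suc i) (suc j) = CycleAdj (n * m) i j

jahangir : ℕ → ℕ → Graph
jahangir n m = record
  { order   = suc (n * m)
  ; Adj     = JahangirAdj n m
  ; adj-sym = λ {a} {b} → J-sym a b
  ; irrefl  = λ {a} → J-irrefl a
  }
  where
  J-sym : ∀ a b → JahangirAdj n m a b → JahangirAdj n m b a
  J-sym zero    (suc _) e = e
  J-sym (suc _) zero    e = e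
  J-sym (suc _) (suc _) e = adj-sym (cycle (n * m)) e

  J-irrefl : ∀ a → ¬ JahangirAdj n m a a
  J-irrefl (suc _) e = irrefl (cycle (n * m)) e

Distribution : Graph → Set
Distribution G = Vec ℕ (order G)

Move : (G : Graph) → Distribution G → Distribution G → Set
Move G D D′ = ∃₂ λ a b →
  Adj G a b × 2 ≤ lookup D a × D′ ≡ (D [ a ]%= (_∸ 2)) [ b ]%= suc

Reachable : (G : Graph) → ℕ → Distribution G → Fin (order G) → Set
Reachable G t D w = ∃ λ D′ → Star (Move G) D D′ × t ≤ lookup D′ w

Suffices : Graph → ℕ → ℕ → Set
Suffices G t p = (D : Distribution G) → sum D ≡ p → ∀ w → Reachable G t D w

-- IsPebblingNumber G t p : p = f_t(G).
IsPebblingNumber : Graph → ℕ → ℕ → Set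
IsPebblingNumber G t p = Suffices G t p × (∀ q → Suffices G t q → p ≤ q)

IsPebblingNumber-unique : ∀ G t {p q} →
  IsPebblingNumber G t p → IsPebblingNumber G t q → p ≡ q
IsPebblingNumber-unique G t (sp , lp) (sq , lq) = ≤-antisym (lp _ sq) (lq _ sp)

-- The arguments f₀, f₁, f₂ stand for f(Cₙ), f(Cₙ₊₁), f(Cₙ₊₂).  The value is an
-- integer so that the subtractions are not truncated; both halvings are exact.
α : (m f₀ f₁ f₂ : ℕ) → ℤ
α m f₀ f₁ f₂ =
  if does (2 ∣? m)
  then + (m / 2) ℤ.* (+ f₀ ℤ.+ + f₂ ℤ.- + 2) ℤ.- + f₂ ℤ.+ + 1
  else + ((m ∸ 1) / 2) ℤ.* (+ f₀ ℤ.+ + f₂ ℤ.- + 2) ℤ.+ + f₁ ℤ.- + f₂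

{-# OPTIONS --safe #-}
-- Write n = 2k, d = 2ᵏ⁻¹, and call the n + 1 rim vertices between two consecutive spokes a sector;
-- together with the hub it is a cycle of length n + 2.
--
-- Cycles.  On a path cut into a left part with pebbles x on its last vertex and u elsewhere, and a
-- right part with y and w likewise, x + ⌊y/2⌋ + 2u ≥ 2ⁱa brings a pebbles to the left end, and
-- y + ⌊x/2⌋ + 2w ≥ 2ʲb brings b to the right end; the failure of both bounds the total.
--
-- Upper bound.  A sector with at least 2d pebbles can send one to one of its ends, one with more than
-- 2⌊4d/3⌋ pebbles to each of its ends (or one to the hub), and one with 4d pebbles can send one to the
-- hub.  Two pebbles meeting at a spoke yield one on the hub, so in a chain from which nothing reaches
-- the hub or the outer spokes, sectors of 2d − 1 = f(Cₙ) − 1 and 4d − 1 = f(Cₙ₊₂) − 1 pebbles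
-- essentially alternate, with one exceptional sector of f(Cₙ₊₁) − 1 pebbles if m is odd.  Every
-- pebble brought out of a larger chain costs at most 4d pebbles, and 4d pebbles on the cycle formed
-- by the target's sector and the hub suffice.
--
-- Lower bound.  The extremal distribution is such an alternating chain in which one sector not too
-- close to the target carries (4d)² − 1 pebbles.  For a sequence of moves, count the pebbles entering
-- and leaving each block (a sector with or without its ends).  Weights 2^(distance to the middle) give
-- 2·out ≤ in + 1 for the small blocks, so none of them makes a profit, and the big one yields 4d − 1
-- pebbles on the hub, one less than what the target needs.
module Submission where

-- The cost 4d per pebble does not come from the sharp threshold 2⌊4d/3⌋: there, serving a chosen
-- end may use 4d pebbles, so two sectors meeting at a spoke may spend 8d. From 3d pebbles on, an
-- end costs only 2d, or else the hub is reached for 4d. This coarser threshold is harmless while 4d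
-- pebbles of reserve lie in the chain, and so for every pebble brought out but the last; only the
-- last one uses the sharp threshold, and its cost no longer matters. If a blocked chain holds at
-- most B pebbles, the total is B + 1 + (4d - 1)4d.
--
-- In the lower bound the obstacle is at the two ends of the chain. A pebble on a spoke of the
-- target's sector is one step nearer to the target than the hub, so it is worth two on the hub, and
-- comparing the numbers of pebbles going out and in is too weak there. The outermost sector is
-- therefore treated together with its neighbour. Hence m ≥ 8: an outer pair at either end and,
-- between them, the big sector with a small one on each side make seven sectors; the target's is
-- the eighth.

open import Data.Bool using (Bool; true; false; not)
open import Data.Empty using (⊥; ⊥-elim)
open import Data.Fin using (Fin; zero; suc; toℕ; fromℕ<)
open import Data.Fin.Properties as Fin using (_≟_; toℕ-fromℕ<; toℕ<n; toℕ-injective)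
open import Data.Nat using (ℕ; zero; suc; _+_; _*_; _∸_; _^_; _⊓_; _≤_; _<_; _≤?_; _<?_; z≤n; s≤s; z<s; s<s; ⌊_/2⌋; NonZero; ∣_-_∣)
open import Data.Nat.DivMod using (_/_; _%_; _mod_; m%n<n; m≡m%n+[m/n]*n; [m+kn]%n≡m%n; [m+n]%n≡m%n; m<n⇒m%n≡m; n%n≡0; m%n*o≡m*o%[n*o]; %-congʳ; m*n/n≡m)
open import Data.Nat.Divisibility using (_∣_; _∣?_; divides; ∣m+n∣m⇒∣n; ∣1⇒≡1)
open import Data.Nat.Primality using (Prime; prime?; euclidsLemma)
open import Data.Nat.Properties as ℕ hiding (_≟_)
open import Data.Nat.Tactic.RingSolver using (solve-∀)
open import Data.Product using (Σ; ∃-syntax; _×_; _,_; proj₁; proj₂)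
open import Data.Sum using (_⊎_; inj₁; inj₂; [_,_]′)
open import Data.Unit using (⊤; tt)
open import Data.Vec using (Vec; []; _∷_; lookup; sum; _[_]%=_; replicate)
open import Data.Vec.Properties using (lookup∘updateAt; lookup∘updateAt′)
open import Function using (_∘_)
open import Relation.Binary.Construct.Closure.ReflexiveTransitive using (Star; ε; _◅_)
open import Relation.Binary.Definitions using (tri<; tri≈; tri>)
open import Relation.Binary.PropositionalEquality using (_≡_; _≢_; refl; sym; trans; cong; cong₂; subst; subst₂; module ≡-Reasoning)
open import Relation.Nullary using (¬_; Dec; yes; no; contradiction)
open import Relation.Nullary.Decidable using (dec-true; dec-false; from-yes)
open import Defs

-- Linear arithmetic

infixr 7 _⊠_
infixr 6 _⊞_

_⊞_ : ∀ {a b c d} → a ≤ b → c ≤ d → a + c ≤ b + d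
_⊞_ = +-mono-≤

_⊠_ : ∀ n {a b} → a ≤ b → n * a ≤ n * b
n ⊠ h = *-monoʳ-≤ n h

-- P ≤ Q is a sum of multiples of the hypotheses, and the equation is one for the ring solver.
linear : ∀ {a b P Q} s → P ≤ Q → a + Q + s ≡ b + P → a ≤ b
linear {a} {b} {P} {Q} s h e = +-cancelʳ-≤ Q a b (begin
  a + Q      ≤⟨ m≤m+n (a + Q) s ⟩
  a + Q + s  ≡⟨ e ⟩
  b + P      ≤⟨ +-monoʳ-≤ b h ⟩
  b + Q      ∎)
  where open ≤-Reasoning

linear-⊥ : ∀ {A : Set} {P Q} s → P ≤ Q → Q + suc s ≡ P → A
linear-⊥ {P = P} {Q} s h e = contradiction
  (≤-trans (≤-reflexive (trans (sym (+-suc Q s)) e)) h)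
  (<⇒≱ (s≤s (m≤m+n Q s)))

-- Finite sums

∑ : ℕ → (ℕ → ℕ) → ℕ
∑ zero    f = 0
∑ (suc n) f = f 0 + ∑ n (f ∘ suc)

∑-cong : ∀ n {f g : ℕ → ℕ} → (∀ l → l < n → f l ≡ g l) → ∑ n f ≡ ∑ n g
∑-cong zero    h = refl
∑-cong (suc n) h = cong₂ _+_ (h 0 z<s) (∑-cong n λ l l<n → h (suc l) (s<s l<n))

∑-zero : ∀ n {f : ℕ → ℕ} → (∀ l → l < n → f l ≡ 0) → ∑ n f ≡ 0
∑-zero zero    h = refl
∑-zero (suc n) h = cong₂ _+_ (h 0 z<s) (∑-zero n λ l l<n → h (suc l) (s<s l<n))

∑-distrib-+ : ∀ n (f g : ℕ → ℕ) → ∑ n (λ l → f l + g l) ≡ ∑ n f + ∑ n g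
∑-distrib-+ zero    f g = refl
∑-distrib-+ (suc n) f g = begin
  f 0 + g 0 + ∑ n (λ l → f (suc l) + g (suc l))  ≡⟨ cong (f 0 + g 0 +_) (∑-distrib-+ n (f ∘ suc) (g ∘ suc)) ⟩
  f 0 + g 0 + (∑ n (f ∘ suc) + ∑ n (g ∘ suc))    ≡⟨ interchange (f 0) (g 0) _ _ ⟩
  f 0 + ∑ n (f ∘ suc) + (g 0 + ∑ n (g ∘ suc))    ∎
  where
  open ≡-Reasoning
  interchange : ∀ a b c d → a + b + (c + d) ≡ a + c + (b + d)
  interchange = solve-∀

∑-split : ∀ m n (f : ℕ → ℕ) → ∑ (m + n) f ≡ ∑ m f + ∑ n (f ∘ (m +_))
∑-split zero    n f = refl
∑-split (suc m) n f = trans (cong (f 0 +_) (∑-split m n (f ∘ suc))) (sym (+-assoc (f 0) _ _))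

∑-last : ∀ n (f : ℕ → ℕ) → ∑ (suc n) f ≡ ∑ n f + f n
∑-last zero    f = +-identityʳ (f 0)
∑-last (suc n) f = trans (cong (f 0 +_) (∑-last n (f ∘ suc))) (sym (+-assoc (f 0) _ _))

∑-single : ∀ n (f : ℕ → ℕ) i → i < n → (∀ l → l < n → l ≢ i → f l ≡ 0) → ∑ n f ≡ f i
∑-single (suc n) f zero    _         h =
  trans (cong (f 0 +_) (∑-zero n λ l l<n → h (suc l) (s<s l<n) λ ())) (+-identityʳ (f 0))
∑-single (suc n) f (suc i) (s<s i<n) h = cong₂ _+_ (h 0 z<s λ ())
  (∑-single n (f ∘ suc) i i<n λ l l<n l≢i → h (suc l) (s<s l<n) (l≢i ∘ suc-injective))

∑-reverse : ∀ n (f : ℕ → ℕ) → ∑ (suc n) (λ l → f (n ∸ l)) ≡ ∑ (suc n) f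
∑-reverse zero    f = refl
∑-reverse (suc n) f = begin
  f (suc n) + ∑ (suc n) (λ l → f (n ∸ l))  ≡⟨ cong (f (suc n) +_) (∑-reverse n f) ⟩
  f (suc n) + ∑ (suc n) f                  ≡⟨ +-comm (f (suc n)) _ ⟩
  ∑ (suc n) f + f (suc n)                  ≡⟨ ∑-last (suc n) f ⟨
  ∑ (suc (suc n)) f                        ∎
  where open ≡-Reasoning

∑-rotate : ∀ n (f : ℕ → ℕ) → (∀ l → f (n + l) ≡ f l) → ∀ r → ∑ n (f ∘ (r +_)) ≡ ∑ n f
∑-rotate n f period zero    = refl
∑-rotate n f period (suc r) = begin
  ∑ n (λ l → f (suc (r + l)))  ≡⟨ ∑-rotate n (f ∘ suc) period′ r ⟩
  ∑ n (f ∘ suc)                ≡⟨ +-cancelˡ-≡ (f 0) _ _ shift ⟩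
  ∑ n f                        ∎
  where
  open ≡-Reasoning
  period′ : ∀ l → f (suc (n + l)) ≡ f (suc l)
  period′ l = trans (cong f (sym (+-suc n l))) (period (suc l))
  shift : f 0 + ∑ n (f ∘ suc) ≡ f 0 + ∑ n f
  shift = begin
    ∑ (suc n) f    ≡⟨ ∑-last n f ⟩
    ∑ n f + f n    ≡⟨ cong (∑ n f +_) (trans (cong f (sym (+-identityʳ n))) (period 0)) ⟩
    ∑ n f + f 0    ≡⟨ +-comm _ (f 0) ⟩
    f 0 + ∑ n f    ∎

-- The budget `s` is spent from index 0 upwards, so on a path the pebbles nearest to the left end
-- are kept. The cheap way of serving the left end of a sector depends on this order.
takeFirst : ℕ → (ℕ → ℕ) → ℕ → ℕ
takeFirst s c zero    = s ⊓ c 0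
takeFirst s c (suc l) = takeFirst (s ∸ c 0) (c ∘ suc) l

takeFirst-≤ : ∀ s c l → takeFirst s c l ≤ c l
takeFirst-≤ s c zero    = m⊓n≤n s (c 0)
takeFirst-≤ s c (suc l) = takeFirst-≤ (s ∸ c 0) (c ∘ suc) l

∑-takeFirst : ∀ n s c → ∑ n (takeFirst s c) ≡ s ⊓ ∑ n c
∑-takeFirst zero    s c = sym (⊓-zeroʳ s)
∑-takeFirst (suc n) s c = trans (cong (s ⊓ c 0 +_) (∑-takeFirst n (s ∸ c 0) (c ∘ suc))) (peel s (c 0) _)
  where
  peel : ∀ s a b → s ⊓ a + (s ∸ a) ⊓ b ≡ s ⊓ (a + b)
  peel zero    a       b = cong (_⊓ b) (0∸n≡0 a)
  peel (suc s) zero    b = refl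
  peel (suc s) (suc a) b = cong suc (peel s a b)

-- Neighbouring sectors share a vertex; cutting the contents off at n leaves it to the right one.
pad : ℕ → (ℕ → ℕ) → ℕ → ℕ
pad zero    c l       = 0
pad (suc n) c zero    = c 0
pad (suc n) c (suc l) = pad n (c ∘ suc) l

∑-pad : ∀ n c (w : ℕ → ℕ) → ∑ (suc n) (λ l → pad n c l * w l) ≡ ∑ n (λ l → c l * w l)
∑-pad zero    c w = refl
∑-pad (suc n) c w = cong (c 0 * w 0 +_) (∑-pad n (c ∘ suc) (w ∘ suc))

double-half : ∀ c → ⌊ c /2⌋ + ⌊ c /2⌋ ≤ c
double-half zero          = z≤n
double-half (suc zero)    = z≤n
double-half (suc (suc c)) rewrite +-suc ⌊ c /2⌋ ⌊ c /2⌋ = s≤s (s≤s (double-half c))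

half-double : ∀ c → c ≤ suc (⌊ c /2⌋ + ⌊ c /2⌋)
half-double zero          = z≤n
half-double (suc zero)    = s≤s z≤n
half-double (suc (suc c)) rewrite +-suc ⌊ c /2⌋ ⌊ c /2⌋ = s≤s (s≤s (half-double c))

-- Pebbling calculus

module Calculus (G : Graph) where

  V : Set
  V = Fin (order G)

  Pebbles : Set
  Pebbles = V → ℕ

  δ : V → Pebbles
  δ a v with a ≟ v
  ... | yes _ = 1
  ... | no  _ = 0

  δ-refl : ∀ a → δ a a ≡ 1
  δ-refl a with a ≟ a
  ... | yes _ = refl
  ... | no a≢a = contradiction refl a≢a

  δ-≢ : ∀ {a v} → a ≢ v → δ a v ≡ 0
  δ-≢ {a} {v} a≢v with a ≟ v
  ... | yes a≡v = contradiction a≡v a≢v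
  ... | no _    = refl

  infixl 6 _⊕_
  _⊕_ : Pebbles → Pebbles → Pebbles
  (D ⊕ E) v = D v + E v

  infix 7 _·_
  _·_ : ℕ → V → Pebbles
  (c · a) v = c * δ a v

  infix 4 _≼_
  _≼_ : Pebbles → Pebbles → Set
  D ≼ E = ∀ v → D v ≤ E v

  ≡⇒≼ : ∀ {D E : Pebbles} → (∀ v → D v ≡ E v) → D ≼ E
  ≡⇒≼ h v = ≤-reflexive (h v)

  infix 4 _⇝_
  -- Surplus pebbles are allowed at every stage, so distributions can be added and regrouped
  -- pointwise without function extensionality, and pebbles set aside never interfere (`frame`).
  data _⇝_ (D E : Pebbles) : Set where
    stop : E ≼ D → D ⇝ E
    step : ∀ {F} a b → Adj G a b → 2 · a ⊕ F ≼ D → 1 · b ⊕ F ⇝ E → D ⇝ E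

  weaken : ∀ {D D′ E} → D ≼ D′ → D ⇝ E → D′ ⇝ E
  weaken h (stop k)         = stop λ v → ≤-trans (k v) (h v)
  weaken h (step a b e k r) = step a b e (λ v → ≤-trans (k v) (h v)) r

  ⇝-trans : ∀ {D E F} → D ⇝ E → E ⇝ F → D ⇝ F
  ⇝-trans (stop k)         s = weaken k s
  ⇝-trans (step a b e k r) s = step a b e k (⇝-trans r s)

  frame : ∀ {D E} F → D ⇝ E → D ⊕ F ⇝ E ⊕ F
  frame F (stop k) = stop λ v → +-monoˡ-≤ (F v) (k v)
  frame {D} F (step {K} a b e k r) = step a b e
    (λ v → ≤-trans (≤-reflexive (sym (+-assoc ((2 · a) v) (K v) (F v)))) (+-monoˡ-≤ (F v) (k v)))
    (weaken (λ v → ≤-reflexive (+-assoc ((1 · b) v) (K v) (F v))) (frame F r))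

  both : ∀ {D D′ E E′} → D ⇝ D′ → E ⇝ E′ → D ⊕ E ⇝ D′ ⊕ E′
  both {D} {D′} {E} {E′} r s = ⇝-trans (frame E r)
    (weaken (λ v → ≤-reflexive (+-comm (E v) (D′ v)))
      (⇝-trans (frame D′ s) (stop λ v → ≤-reflexive (+-comm (D′ v) (E′ v)))))

  move-pairs : ∀ {a b} c → Adj G a b → (c + c) · a ⇝ c · b
  move-pairs zero e = stop λ v → z≤n
  move-pairs {a} {b} (suc c) e = step a b e
    (λ v → ≤-reflexive (eq₁ c (δ a v)))
    (weaken (λ v → ≤-reflexive (eq₂ c (δ a v) (δ b v)))
      (⇝-trans (frame (1 · b) (move-pairs c e)) (stop λ v → ≤-reflexive (eq₃ c (δ b v)))))
    where
    eq₁ : ∀ c x → 2 * x + (c + c) * x ≡ (suc c + suc c) * x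
    eq₁ = solve-∀
    eq₂ : ∀ c x y → (c + c) * x + 1 * y ≡ 1 * y + (c + c) * x
    eq₂ = solve-∀
    eq₃ : ∀ c y → suc c * y ≡ c * y + 1 * y
    eq₃ = solve-∀

  move-half : ∀ {a b} c → Adj G a b → c · a ⇝ ⌊ c /2⌋ · b
  move-half {a} c e =
    weaken (λ v → *-monoˡ-≤ (δ a v) (double-half c)) (move-pairs ⌊ c /2⌋ e)

  Move-mono : ∀ {D D′ E} → (∀ v → lookup D v ≤ lookup E v) → Move G D D′ →
    ∃[ E′ ] Move G E E′ × (∀ v → lookup D′ v ≤ lookup E′ v)
  Move-mono {D} {D′} {E} h (a , b , e , 2≤ , refl) =
    (E [ a ]%= (_∸ 2)) [ b ]%= suc , (a , b , e , ≤-trans 2≤ (h a) , refl) , update₂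
    where
    update₁ : ∀ v → lookup (D [ a ]%= (_∸ 2)) v ≤ lookup (E [ a ]%= (_∸ 2)) v
    update₁ v with v ≟ a
    ... | yes refl rewrite lookup∘updateAt a {f = _∸ 2} D | lookup∘updateAt a {f = _∸ 2} E = ∸-monoˡ-≤ 2 (h a)
    ... | no v≢a rewrite lookup∘updateAt′ v a {f = _∸ 2} v≢a D | lookup∘updateAt′ v a {f = _∸ 2} v≢a E = h v
    update₂ : ∀ v → lookup ((D [ a ]%= (_∸ 2)) [ b ]%= suc) v ≤ lookup ((E [ a ]%= (_∸ 2)) [ b ]%= suc) v
    update₂ v with v ≟ b
    ... | yes refl rewrite lookup∘updateAt b {f = suc} (D [ a ]%= (_∸ 2)) | lookup∘updateAt b {f = suc} (E [ a ]%= (_∸ 2)) = s≤s (update₁ b)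
    ... | no v≢b rewrite lookup∘updateAt′ v b {f = suc} v≢b (D [ a ]%= (_∸ 2)) | lookup∘updateAt′ v b {f = suc} v≢b (E [ a ]%= (_∸ 2)) = update₁ v

  Star-mono : ∀ {D D′ E} → (∀ v → lookup D v ≤ lookup E v) → Star (Move G) D D′ →
    ∃[ E′ ] Star (Move G) E E′ × (∀ v → lookup D′ v ≤ lookup E′ v)
  Star-mono h ε = _ , ε , h
  Star-mono h (m ◅ σ) with Move-mono h m
  ... | _ , m′ , h′ with Star-mono h′ σ
  ... | E′ , σ′ , h″ = E′ , m′ ◅ σ′ , h″

  -- The invariant is domination by the vector. The truncated subtraction at `a` is exact because
  -- the two spent pebbles are listed separately from `F`.
  ⇝-sound : ∀ {D E} → D ⇝ E → (X : Distribution G) → D ≼ lookup X →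
    ∃[ X′ ] Star (Move G) X X′ × E ≼ lookup X′
  ⇝-sound (stop k) X h = X , ε , λ v → ≤-trans (k v) (h v)
  ⇝-sound {D} (step {F} a b e k r) X h with ⇝-sound r X₁ ≼X₁
    where
    X₁ : Distribution G
    X₁ = (X [ a ]%= (_∸ 2)) [ b ]%= suc
    k′ : ∀ v → 2 * δ a v + F v ≤ lookup X v
    k′ v = ≤-trans (k v) (h v)
    ≼X₀ : ∀ v → F v ≤ lookup (X [ a ]%= (_∸ 2)) v
    ≼X₀ v with v ≟ a
    ... | yes refl rewrite lookup∘updateAt a {f = _∸ 2} X =
      m+n≤o⇒n≤o∸m 2 (subst (λ x → 2 * x + F a ≤ lookup X a) (δ-refl a) (k′ a))
      where
      m+n≤o⇒n≤o∸m : ∀ m {n o} → m + n ≤ o → n ≤ o ∸ m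
      m+n≤o⇒n≤o∸m m {n} {o} q = subst (_≤ o ∸ m) (m+n∸m≡n m n) (∸-monoˡ-≤ m q)
    ... | no v≢a rewrite lookup∘updateAt′ v a {f = _∸ 2} v≢a X = ≤-trans (m≤n+m (F v) (2 * δ a v)) (k′ v)
    ≼X₁ : ∀ v → 1 * δ b v + F v ≤ lookup X₁ v
    ≼X₁ v with v ≟ b
    ... | yes refl rewrite lookup∘updateAt b {f = suc} (X [ a ]%= (_∸ 2)) | δ-refl b = s≤s (≼X₀ b)
    ... | no v≢b rewrite lookup∘updateAt′ v b {f = suc} v≢b (X [ a ]%= (_∸ 2)) | δ-≢ (v≢b ∘ sym) = ≼X₀ v
  ... | X′ , σ , h′ = X′ , (a , b , e , 2≤ , refl) ◅ σ , h′
    where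
    2≤ : 2 ≤ lookup X a
    2≤ = ≤-trans (≤-trans (≤-reflexive (cong (2 *_) (sym (δ-refl a)))) (m≤m+n _ (F a))) (≤-trans (k a) (h a))

  reach : ∀ {D t w} (X : Distribution G) → D ≼ lookup X → D ⇝ t · w → Reachable G t X w
  reach {t = t} {w} X h r with ⇝-sound r X h
  ... | X′ , σ , h′ = X′ , σ ,
    ≤-trans (≤-reflexive (sym (trans (cong (t *_) (δ-refl w)) (*-identityʳ t)))) (h′ w)

  Suffices-suc : ∀ {t p} → Suffices G t p → Suffices G t (suc p)
  Suffices-suc {t} {p} S D s w with remove D s
    where
    remove : ∀ {n p} (D : Vec ℕ n) → sum D ≡ suc p →
      ∃[ E ] sum E ≡ p × (∀ v → lookup E v ≤ lookup D v)
    remove (suc x ∷ D) s = x ∷ D , suc-injective s , λ { zero → n≤1+n x ; (suc v) → ≤-refl }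
    remove (zero ∷ D) s with remove D s
    ... | E , e , h = zero ∷ E , e , λ { zero → z≤n ; (suc v) → h v }
  ... | E , e , h with S E e w
  ... | E′ , σ , t≤ with Star-mono h σ
  ... | D′ , σ′ , h′ = D′ , σ′ , ≤-trans t≤ (h′ w)

  -- Sufficiency passes to larger numbers, since a surplus pebble can be removed and the moves
  -- replayed; so a single bad distribution of `p` pebbles excludes every `q ≤ p`.
  minimal : ∀ {t p} → ¬ Suffices G t p → ∀ q → Suffices G t q → suc p ≤ q
  minimal {t} {p} ¬S q S with suc p ≤? q
  ... | yes p<q = p<q
  ... | no  p≮q = contradiction (subst (Suffices G t) (m∸n+n≡m (≤-pred (≰⇒> p≮q))) (grow (p ∸ q))) ¬S
    where
    grow : ∀ d → Suffices G t (d + q)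
    grow zero    = S
    grow (suc d) = Suffices-suc (grow d)

≤-halve : ∀ {a b} → 2 * a ≤ suc (2 * b) → a ≤ b
≤-halve {a} {b} h with a ≤? b
... | yes q = q
... | no ¬q = linear-⊥ 0 (h ⊞ 2 ⊠ ≰⇒> ¬q) (identity a b)
  where
  identity : ∀ a b → suc (2 * b) + 2 * a + 1 ≡ 2 * a + 2 * suc b
  identity = solve-∀

-- Moving pebbles along paths and closed walks

module Paths (G : Graph) where
  open Calculus G public

  spread : ℕ → (ℕ → V) → (ℕ → ℕ) → Pebbles
  spread n p c v = ∑ n λ l → c l * δ (p l) v

  -- Every pebble nearer to `p 0` than `p i` is worth at least two on `p i`. The proof works
  -- backwards from the demand: the `c 0` pebbles in place reduce it, and twice the remainder is
  -- demanded of the next vertex, so nothing is lost by rounding.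
  collectˡ : ∀ i p c z a → (∀ l → l < i → Adj G (p (suc l)) (p l)) →
    2 ^ i * a ≤ z + 2 * ∑ i c → spread i p c ⊕ z · p i ⇝ a · p 0
  collectˡ zero p c z a adj h = stop λ v → *-monoˡ-≤ (δ (p 0) v) (≤-trans (≤-reflexive (sym (+-identityʳ a))) (≤-trans h (≤-reflexive (+-identityʳ z))))
  collectˡ (suc i) p c z a adj h with a ≤? c 0
  ... | yes a≤c = stop λ v → ≤-trans (*-monoˡ-≤ (δ (p 0) v) a≤c) (≤-trans (m≤m+n _ _) (m≤m+n _ _))
  ... | no  a≰c = weaken (≡⇒≼ λ v → regroup (c 0 * δ (p 0) v) _ _)
      (⇝-trans (frame (c 0 · p 0) (⇝-trans
        (collectˡ i (p ∘ suc) (c ∘ suc) z (d + d) (λ l l<i → adj (suc l) (s<s l<i)) enough)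
        (move-pairs d (adj 0 z<s))))
      (stop (≡⇒≼ λ v → trans (cong (_* δ (p 0) v) (sym d+c)) (*-distribʳ-+ (δ (p 0) v) d (c 0)))))
    where
    d : ℕ
    d = a ∸ c 0
    d+c : d + c 0 ≡ a
    d+c = m∸n+n≡m (<⇒≤ (≰⇒> a≰c))
    regroup : ∀ x y z → y + z + x ≡ x + y + z
    regroup = solve-∀
    identity : ∀ P d c z S →
      P * (d + d) + (z + 2 * (c + S) + 2 * c * P) + 0 ≡ z + 2 * S + (2 * P * (d + c) + 2 * c * 1)
    identity = solve-∀
    enough : 2 ^ i * (d + d) ≤ z + 2 * ∑ i (c ∘ suc)
    enough = linear 0 (≤-trans (≤-reflexive (cong (2 * 2 ^ i *_) d+c)) h ⊞ (2 * c 0) ⊠ m^n>0 2 i)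
      (identity (2 ^ i) d (c 0) z _)

  -- Here pebbles are pushed forwards, and halving `z` strands at most one of them. The demand
  -- `2 ^ suc j * b` is even, so the inequality can still be halved.
  collectʳ : ∀ j p c z b → (∀ l → l < j → Adj G (p l) (p (suc l))) →
    2 ^ j * b ≤ z + 2 * ∑ j c → z · p 0 ⊕ spread j (p ∘ suc) c ⇝ b · p j
  collectʳ zero p c z b adj h = stop λ v → ≤-trans (*-monoˡ-≤ (δ (p 0) v) (≤-trans (≤-reflexive (sym (+-identityʳ b))) (≤-trans h (≤-reflexive (+-identityʳ z))))) (m≤m+n _ 0)
  collectʳ (suc j) p c z b adj h =
    ⇝-trans (frame (spread (suc j) (p ∘ suc) c) (move-half z (adj 0 z<s)))
      (weaken (≡⇒≼ λ v → regroup (c 0) ⌊ z /2⌋ (δ (p 1) v) _)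
        (collectʳ j (p ∘ suc) (c ∘ suc) (c 0 + ⌊ z /2⌋) b (λ l l<j → adj (suc l) (s<s l<j)) enough))
    where
    regroup : ∀ c h x S → (c + h) * x + S ≡ h * x + (c * x + S)
    regroup = solve-∀
    identity : ∀ P b z h c S → 2 * (P * b) + (z + 2 * (c + S) + suc (h + h)) + 2 * S
      ≡ suc (2 * (c + h + 2 * S)) + (2 * P * b + z)
    identity = solve-∀
    enough : 2 ^ j * b ≤ c 0 + ⌊ z /2⌋ + 2 * ∑ j (c ∘ suc)
    enough = ≤-halve (linear (2 * ∑ j (c ∘ suc)) (h ⊞ half-double z) (identity (2 ^ j) b z ⌊ z /2⌋ (c 0) _))

  -- The path is cut at the edge between positions `i` and `i + 1`. What lies on the far end of that
  -- edge is worth half as much on the near end.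
  push-left : ∀ i j p c a → (∀ l → l < i + suc j → Adj G (p l) (p (suc l))) →
    2 ^ i * a ≤ c (i + 0) + ⌊ c (i + 1) /2⌋ + 2 * ∑ i c → spread (i + suc (suc j)) p c ⇝ a · p 0
  push-left i j p c a adj enough = weaken covered
    (⇝-trans (frame (spread i p c ⊕ x · p (i + 0)) (move-half y back))
    (weaken (λ v → ≤-reflexive (regroup (∑ i _) x ⌊ y /2⌋ v))
    (collectˡ i p c (x + ⌊ y /2⌋) a (λ l l<i → adj-sym G (adj l (≤-trans l<i (m≤m+n i _)))) enough)))
    where
    x y : ℕ
    x = c (i + 0)
    y = c (i + 1)
    back : Adj G (p (i + 1)) (p (i + 0))
    back = adj-sym G (subst (λ s → Adj G (p (i + 0)) (p s)) (sym (+-suc i 0)) (adj (i + 0) (+-monoʳ-< i z<s)))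
    covered : y · p (i + 1) ⊕ (spread i p c ⊕ x · p (i + 0)) ≼ spread (i + suc (suc j)) p c
    covered v = ≤-trans (m≤m+n _ (∑ j λ l → c (i + suc (suc l)) * δ (p (i + suc (suc l))) v))
      (≤-reflexive (trans (shape (∑ i λ l → c l * δ (p l) v) (x * δ (p (i + 0)) v) (y * δ (p (i + 1)) v) _)
        (sym (∑-split i (suc (suc j)) λ l → c l * δ (p l) v))))
      where
      shape : ∀ u x y w → y + (u + x) + w ≡ u + (x + (y + w))
      shape = solve-∀
    regroup : ∀ u x h v → u + (x + h) * δ (p i) v ≡ h * δ (p (i + 0)) v + (u + x * δ (p (i + 0)) v)
    regroup u x h v rewrite +-identityʳ i = shape u x h (δ (p i) v)
      where
      shape : ∀ u x h d → u + (x + h) * d ≡ h * d + (u + x * d)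
      shape = solve-∀

  push-right : ∀ i j p c b → (∀ l → l < i + suc j → Adj G (p l) (p (suc l))) →
    2 ^ j * b ≤ c (i + 1) + ⌊ c (i + 0) /2⌋ + 2 * ∑ j (λ l → c (i + suc (suc l))) →
    spread (i + suc (suc j)) p c ⇝ b · p (i + suc j)
  push-right i j p c b adj enough =
    weaken (λ v → ≤-trans (m≤n+m _ (∑ i λ l → c l * δ (p l) v)) (≤-reflexive (sym (∑-split i (suc (suc j)) λ l → c l * δ (p l) v))))
    (⇝-trans (frame (y · p (i + 1) ⊕ spread j (λ l → p (i + suc (suc l))) (λ l → c (i + suc (suc l)))) (move-half x forth))
    (weaken (λ v → ≤-reflexive (shape ⌊ x /2⌋ y (δ (p (i + 1)) v) _))
    (collectʳ j (λ l → p (i + suc l)) (λ l → c (i + suc (suc l))) (y + ⌊ x /2⌋) b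
      (λ l l<j → subst (λ s → Adj G (p (i + suc l)) (p s)) (sym (+-suc i (suc l))) (adj (i + suc l) (+-monoʳ-< i (s<s l<j)))) enough)))
    where
    x y : ℕ
    x = c (i + 0)
    y = c (i + 1)
    forth : Adj G (p (i + 0)) (p (i + 1))
    forth = subst (λ s → Adj G (p (i + 0)) (p s)) (sym (+-suc i 0)) (adj (i + 0) (+-monoʳ-< i z<s))
    shape : ∀ h y d w → (y + h) * d + w ≡ h * d + (y * d + w)
    shape = solve-∀

  -- If both sufficient conditions of push-left and push-right fail, adding the two failures
  -- bounds three times the total.
  two-sided : ∀ i j p c a b → (∀ l → l < i + suc j → Adj G (p l) (p (suc l))) →
    2 * (2 ^ i * a + 2 ^ j * b) ≤ suc (3 * ∑ (i + suc (suc j)) c) →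
    (spread (i + suc (suc j)) p c ⇝ a · p 0) ⊎ (spread (i + suc (suc j)) p c ⇝ b · p (i + suc j))
  two-sided i j p c a b adj h
    with 2 ^ i * a ≤? c (i + 0) + ⌊ c (i + 1) /2⌋ + 2 * ∑ i c
       | 2 ^ j * b ≤? c (i + 1) + ⌊ c (i + 0) /2⌋ + 2 * ∑ j (λ l → c (i + suc (suc l)))
  ... | yes q  | _      = inj₁ (push-left i j p c a adj q)
  ... | no _   | yes q  = inj₂ (push-right i j p c b adj q)
  ... | no ¬q₁ | no ¬q₂ = linear-⊥ (∑ i c + ∑ j (λ l → c (i + suc (suc l))))
          (2 ⊠ ≰⇒> ¬q₁ ⊞ 2 ⊠ ≰⇒> ¬q₂ ⊞ ≤-trans h (≤-reflexive (cong (λ s → suc (3 * s)) (∑-split i (suc (suc j)) c)))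
            ⊞ half-double (c (i + 0)) ⊞ half-double (c (i + 1)))
          (identity (2 ^ i * a) (2 ^ j * b) (∑ i c) (c (i + 0)) (c (i + 1)) _ ⌊ c (i + 0) /2⌋ ⌊ c (i + 1) /2⌋)
    where
    identity : ∀ A B u x y w hx hy →
      2 * A + (2 * B + (suc (3 * (u + (x + (y + w)))) + (suc (hx + hx) + suc (hy + hy)))) + suc (u + w)
      ≡ 2 * suc (x + hy + 2 * u) + (2 * suc (y + hx + 2 * w) + (2 * (A + B) + (x + y)))
    identity = solve-∀

  -- The walk is cut open at the target: a round trip is a path of `K + 1` vertices with the target
  -- at both ends, so either alternative of `two-sided` is a success. The closing copy of the target
  -- is padded with 0, its pebbles being counted at the start.
  closed-walk : ∀ i j (h : ℕ → V) (c : ℕ → ℕ) → let K = i + suc j in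
    (∀ l → Adj G (h l) (h (suc l))) → (∀ l → h (K + l) ≡ h l) → (∀ l → c (K + l) ≡ c l) →
    ∀ t → 2 * (2 ^ i * t + 2 ^ j * t) ≤ suc (3 * ∑ K c) → ∀ r → spread K h c ⇝ t · h r
  closed-walk i j h c adj h-period c-period t enough r =
    weaken (λ v → ≤-reflexive (trans (sum-at v) (∑-rotate K (λ l → c l * δ (h l) v) (λ l → cong₂ (λ x y → x * δ y v) (c-period l) (h-period l)) r)))
    ([ (λ s → ⇝-trans s (stop (≡⇒≼ λ v → cong (λ x → t * δ (h x) v) (sym (+-identityʳ r)))))
     , (λ s → ⇝-trans s (stop (≡⇒≼ λ v → cong (λ x → t * δ x v) (sym (trans (cong h (+-comm r K)) (h-period r))))))
     ]′ (two-sided i j (h ∘ (r +_)) (pad K (c ∘ (r +_))) t t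
      (λ l _ → subst (λ x → Adj G (h (r + l)) (h x)) (sym (+-suc r l)) (adj (r + l)))
      (≤-trans enough (≤-reflexive (cong (λ x → suc (3 * x)) (sym total))))))
    where
    K : ℕ
    K = i + suc j
    reindex : ∀ (f : ℕ → ℕ) → ∑ (i + suc (suc j)) f ≡ ∑ (suc K) f
    reindex f = cong (λ x → ∑ x f) (+-suc i (suc j))
    sum-at : ∀ v → spread (i + suc (suc j)) (h ∘ (r +_)) (pad K (c ∘ (r +_))) v ≡ spread K (h ∘ (r +_)) (c ∘ (r +_)) v
    sum-at v = trans (reindex _) (∑-pad K (c ∘ (r +_)) (λ l → δ (h (r + l)) v))
    total : ∑ (i + suc (suc j)) (pad K (c ∘ (r +_))) ≡ ∑ K c
    total = begin
      ∑ (i + suc (suc j)) (pad K (c ∘ (r +_)))     ≡⟨ reindex _ ⟩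
      ∑ (suc K) (pad K (c ∘ (r +_)))               ≡⟨ ∑-cong (suc K) (λ l _ → sym (*-identityʳ (pad K (c ∘ (r +_)) l))) ⟩
      ∑ (suc K) (λ l → pad K (c ∘ (r +_)) l * 1)   ≡⟨ ∑-pad K (c ∘ (r +_)) (λ _ → 1) ⟩
      ∑ K (λ l → c (r + l) * 1)                    ≡⟨ ∑-cong K (λ l _ → *-identityʳ (c (r + l))) ⟩
      ∑ K (c ∘ (r +_))                             ≡⟨ ∑-rotate K c c-period r ⟩
      ∑ K c                                        ∎
      where open ≡-Reasoning

-- Cycle vertices as residues

toℕ-mod : ∀ l K .{{_ : NonZero K}} → toℕ (l mod K) ≡ l % K
toℕ-mod l K = toℕ-fromℕ< (m%n<n l K)

mod-toℕ : ∀ K .{{_ : NonZero K}} (i : Fin K) → toℕ i mod K ≡ i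
mod-toℕ K i = toℕ-injective (trans (toℕ-mod (toℕ i) K) (m<n⇒m%n≡m (toℕ<n i)))

mod-period : ∀ K .{{_ : NonZero K}} l → (K + l) mod K ≡ l mod K
mod-period K l = toℕ-injective (trans (toℕ-mod (K + l) K)
  (trans (trans (cong (_% K) (+-comm K l)) ([m+n]%n≡m%n l K)) (sym (toℕ-mod l K))))

suc-% : ∀ l K .{{_ : NonZero K}} → suc l % K ≡ suc (l % K) % K
suc-% l K = trans (cong (λ x → suc x % K) (m≡m%n+[m/n]*n l K)) ([m+kn]%n≡m%n (suc (l % K)) (l / K) K)

Next-mod : ∀ K .{{_ : NonZero K}} l → Next K (l mod K) (suc l mod K)
Next-mod K l with m≤n⇒m<n∨m≡n (m%n<n l K)
... | inj₁ lt = inj₁ (trans (toℕ-mod (suc l) K) (trans (suc-% l K) (trans (m<n⇒m%n≡m lt) (cong suc (sym (toℕ-mod l K))))))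
... | inj₂ eq = inj₂ (trans (cong suc (toℕ-mod l K)) eq , trans (toℕ-mod (suc l) K) (trans (suc-% l K) (trans (cong (_% K) eq) (n%n≡0 K))))

Next⇒≢ : ∀ {K i j} → 2 ≤ K → Next K i j → i ≢ j
Next⇒≢ 2≤K (inj₁ e) refl = contradiction (sym e) 1+n≢n
Next⇒≢ 2≤K (inj₂ (e , z)) refl = contradiction (trans (cong suc (sym z)) e) (λ { refl → contradiction 2≤K λ { (s≤s ()) } })

Next⇒CycleAdj : ∀ {K i j} → 2 ≤ K → Next K i j → CycleAdj K i j
Next⇒CycleAdj 2≤K e = Next⇒≢ 2≤K e , inj₁ e

nth : ∀ {n} → Vec ℕ n → ℕ → ℕ
nth []      l       = 0
nth (x ∷ D) zero    = x
nth (x ∷ D) (suc l) = nth D l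

lookup-nth : ∀ {n} (D : Vec ℕ n) i → lookup D i ≡ nth D (toℕ i)
lookup-nth (x ∷ D) zero    = refl
lookup-nth (x ∷ D) (suc i) = lookup-nth D i

sum-nth : ∀ {n} (D : Vec ℕ n) → sum D ≡ ∑ n (nth D)
sum-nth []      = refl
sum-nth (x ∷ D) = cong (x +_) (sum-nth D)

sum-mod : ∀ {K} .{{_ : NonZero K}} (D : Vec ℕ K) → ∑ K (λ l → lookup D (l mod K)) ≡ sum D
sum-mod {K} D = trans
  (∑-cong K λ l l<K → trans (lookup-nth D (l mod K)) (cong (nth D) (trans (toℕ-mod l K) (m<n⇒m%n≡m l<K))))
  (sym (sum-nth D))

∑-mod-single : ∀ K .{{_ : NonZero K}} (f : Fin K → ℕ) v → (∀ i → i ≢ v → f i ≡ 0) → ∑ K (λ l → f (l mod K)) ≡ f v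
∑-mod-single K f v h = trans
  (∑-single K _ (toℕ v) (toℕ<n v) λ l l<K l≢v → h (l mod K) λ e →
    l≢v (trans (sym (trans (toℕ-mod l K) (m<n⇒m%n≡m l<K))) (cong toℕ e)))
  (cong f (mod-toℕ K v))

-- For `i = suc j` the left side is `3 * (2 ^ i * t)`, which gives the even cycle; for `i = j` it is
-- `4 * 2 ^ j * t`, and the third in the formula for odd cycles comes from the factor 3 of
-- `two-sided`.
cycle-suffices : ∀ i j → 2 ≤ i + suc j → ∀ t p → 2 * (2 ^ i * t + 2 ^ j * t) ≤ suc (3 * p) →
  Suffices (cycle (i + suc j)) t p
cycle-suffices i j 2≤K t p enough D sum≡p w =
  reach D covered (subst (λ x → spread K h c ⇝ t · x) (mod-toℕ K w)
    (closed-walk i j h c (λ l → Next⇒CycleAdj 2≤K (Next-mod K l)) (mod-period K) (λ l → cong (lookup D) (mod-period K l)) t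
      (≤-trans enough (≤-reflexive (cong (λ x → suc (3 * x)) (sym (trans (sum-mod D) sum≡p))))) (toℕ w)))
  where
  open Paths (cycle (i + suc j))
  K : ℕ
  K = i + suc j
  instance
    K≢0 : NonZero K
    K≢0 = subst NonZero (sym (+-suc i j)) _
  h : ℕ → Fin K
  h l = l mod K
  c : ℕ → ℕ
  c l = lookup D (h l)
  covered : spread K h c ≼ lookup D
  covered v = ≤-reflexive (trans
    (∑-mod-single K (λ i → lookup D i * δ i v) v λ i i≢v → trans (cong (lookup D i *_) (δ-≢ i≢v)) (*-zeroʳ (lookup D i)))
    (trans (cong (lookup D v *_) (δ-refl v)) (*-identityʳ _)))

-- Weights

weigh : ∀ {n} → (Fin n → ℕ) → Vec ℕ n → ℕ
weigh ω []      = 0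
weigh ω (x ∷ D) = ω zero * x + weigh (ω ∘ suc) D

weigh-update : ∀ {n} (ω : Fin n → ℕ) D v f →
  weigh ω (D [ v ]%= f) + ω v * lookup D v ≡ weigh ω D + ω v * f (lookup D v)
weigh-update ω (x ∷ D) zero    f = shape (ω zero * f x) (weigh (ω ∘ suc) D) (ω zero * x)
  where
  shape : ∀ a b c → a + b + c ≡ c + b + a
  shape = solve-∀
weigh-update ω (x ∷ D) (suc v) f = trans (+-assoc (ω zero * x) _ _)
  (trans (cong (ω zero * x +_) (weigh-update (ω ∘ suc) D v f)) (sym (+-assoc (ω zero * x) _ _)))

weigh-stack : ∀ {n} (ω : Fin n → ℕ) D v a → weigh ω (D [ v ]%= (a +_)) ≡ weigh ω D + a * ω v
weigh-stack ω D v a = +-cancelʳ-≡ (ω v * lookup D v) _ _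
  (trans (weigh-update ω D v (a +_)) (shape (weigh ω D) (ω v) a (lookup D v)))
  where
  shape : ∀ W o a x → W + o * (a + x) ≡ W + a * o + o * x
  shape = solve-∀

weigh-zero : ∀ {n} (ω : Fin n → ℕ) → weigh ω (replicate n 0) ≡ 0
weigh-zero {zero}  ω = refl
weigh-zero {suc n} ω = trans (cong₂ _+_ (*-zeroʳ (ω zero)) (weigh-zero (ω ∘ suc))) refl

sum-weigh : ∀ {n} (D : Vec ℕ n) → sum D ≡ weigh (λ _ → 1) D
sum-weigh []      = refl
sum-weigh (x ∷ D) = cong₂ _+_ (sym (+-identityʳ x)) (sum-weigh D)

lookup-weigh : ∀ {n} (ω : Fin n → ℕ) D v → ω v * lookup D v ≤ weigh ω D
lookup-weigh ω (x ∷ D) zero    = m≤m+n _ _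
lookup-weigh ω (x ∷ D) (suc v) = ≤-trans (lookup-weigh (ω ∘ suc) D v) (m≤n+m _ _)

weigh-move : ∀ {n} (ω : Fin n → ℕ) D a b → 2 ≤ lookup D a →
  weigh ω ((D [ a ]%= (_∸ 2)) [ b ]%= suc) + 2 * ω a ≡ weigh ω D + ω b
weigh-move ω D a b 2≤ = +-cancelʳ-≡ (ω b * z + ω a * y) _ _ (begin
  weigh ω D₂ + 2 * ω a + (ω b * z + ω a * y)      ≡⟨ shape₁ (weigh ω D₂) (ω a) (ω b * z) y ⟩
  (weigh ω D₂ + ω b * z) + ω a * (2 + y)          ≡⟨ cong (_+ ω a * (2 + y)) (weigh-update ω D₁ b suc) ⟩
  weigh ω D₁ + ω b * suc z + ω a * (2 + y)        ≡⟨ cong (λ s → weigh ω D₁ + ω b * suc z + ω a * s) (m+[n∸m]≡n 2≤) ⟩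
  weigh ω D₁ + ω b * suc z + ω a * lookup D a     ≡⟨ shape₂ (weigh ω D₁) (ω b) z (ω a * lookup D a) ⟩
  (weigh ω D₁ + ω a * lookup D a) + ω b * suc z   ≡⟨ cong (_+ ω b * suc z) (weigh-update ω D a (_∸ 2)) ⟩
  weigh ω D + ω a * y + ω b * suc z               ≡⟨ shape₃ (weigh ω D) (ω a * y) (ω b) z ⟩
  weigh ω D + ω b + (ω b * z + ω a * y)           ∎)
  where
  open ≡-Reasoning
  D₁ = D [ a ]%= (_∸ 2)
  D₂ = D₁ [ b ]%= suc
  y = lookup D a ∸ 2
  z = lookup D₁ b
  shape₁ : ∀ W o B y → W + 2 * o + (B + o * y) ≡ W + B + o * (2 + y)
  shape₁ = solve-∀
  shape₂ : ∀ W b z A → W + b * suc z + A ≡ W + A + b * suc z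
  shape₂ = solve-∀
  shape₃ : ∀ W A b z → W + A + b * suc z ≡ W + b + (b * z + A)
  shape₃ = solve-∀

module Tally (G : Graph) where

  V : Set
  V = Fin (order G)

  tally : (V → V → ℕ) → ∀ {D D′} → Star (Move G) D D′ → ℕ
  tally κ ε                   = 0
  tally κ ((a , b , _) ◅ σ) = κ a b + tally κ σ

  tally-+ : ∀ κ₁ κ₂ {D D′} (σ : Star (Move G) D D′) →
    tally (λ a b → κ₁ a b + κ₂ a b) σ ≡ tally κ₁ σ + tally κ₂ σ
  tally-+ κ₁ κ₂ ε = refl
  tally-+ κ₁ κ₂ ((a , b , _) ◅ σ) = trans (cong (κ₁ a b + κ₂ a b +_) (tally-+ κ₁ κ₂ σ)) (shape (κ₁ a b) (κ₂ a b) _ _)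
    where
    shape : ∀ a b c d → a + b + (c + d) ≡ a + c + (b + d)
    shape = solve-∀

  tally-* : ∀ x κ {D D′} (σ : Star (Move G) D D′) → tally (λ a b → x * κ a b) σ ≡ x * tally κ σ
  tally-* x κ ε = sym (*-zeroʳ x)
  tally-* x κ ((a , b , _) ◅ σ) = trans (cong (x * κ a b +_) (tally-* x κ σ)) (sym (*-distribˡ-+ x (κ a b) _))

  tally-cong : ∀ {κ₁ κ₂} → (∀ a b → κ₁ a b ≡ κ₂ a b) → ∀ {D D′} (σ : Star (Move G) D D′) → tally κ₁ σ ≡ tally κ₂ σ
  tally-cong h ε                 = refl
  tally-cong h ((a , b , _) ◅ σ) = cong₂ _+_ (h a b) (tally-cong h σ)

  -- A potential argument: `κ⁻` records weight that a move certainly destroys and `κ⁺` weight that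
  -- it may create. All block inequalities of the lower bound are instances, with `κ⁻` and `κ⁺`
  -- concentrated on the boundary of the block.
  tally-bound : ∀ (ω : V → ℕ) κ⁻ κ⁺ → (∀ a b → Adj G a b → ω b + κ⁻ a b ≤ 2 * ω a + κ⁺ a b) →
    ∀ {D D′} (σ : Star (Move G) D D′) → weigh ω D′ + tally κ⁻ σ ≤ weigh ω D + tally κ⁺ σ
  tally-bound ω κ⁻ κ⁺ h ε = ≤-refl
  tally-bound ω κ⁻ κ⁺ h {D} {D′} ((a , b , e , 2≤ , refl) ◅ σ) =
    linear 0 (tally-bound ω κ⁻ κ⁺ h σ ⊞ h a b e ⊞ ≤-reflexive (weigh-move ω D a b 2≤))
      (identity (weigh ω D′) (tally κ⁻ σ) (weigh ω ((D [ a ]%= (_∸ 2)) [ b ]%= suc)) (tally κ⁺ σ) (ω b) (κ⁻ a b) (ω a) (κ⁺ a b) (weigh ω D))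
    where
    identity : ∀ W′ t⁻ W₁ t⁺ b k⁻ a k⁺ W →
      W′ + (k⁻ + t⁻) + (W₁ + t⁺ + (2 * a + k⁺ + (W + b))) + 0 ≡ W + (k⁺ + t⁺) + (W′ + t⁻ + (b + k⁻ + (W₁ + 2 * a)))
    identity = solve-∀

  weigh-decreases : ∀ (ω : V → ℕ) → (∀ a b → Adj G a b → ω b ≤ 2 * ω a) →
    ∀ {D D′} → Star (Move G) D D′ → weigh ω D′ ≤ weigh ω D
  weigh-decreases ω h ε = ≤-refl
  weigh-decreases ω h {D} ((a , b , e , 2≤ , refl) ◅ σ) = ≤-trans (weigh-decreases ω h σ)
    (+-cancelʳ-≤ (2 * ω a) _ _ (≤-trans (≤-reflexive (weigh-move ω D a b 2≤)) (+-monoʳ-≤ (weigh ω D) (h a b e))))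

-- Pebbling numbers of cycles

dist-suc : ∀ x k → ∣ suc x - k ∣ ≤ suc ∣ x - k ∣
dist-suc x       zero    = ≤-reflexive (cong suc (sym (∣-∣-identityʳ x)))
dist-suc zero    (suc k) = m≤n⇒m≤1+n (n≤1+n k)
dist-suc (suc x) (suc k) = dist-suc x k

dist-pred : ∀ x k → ∣ x - k ∣ ≤ suc ∣ suc x - k ∣
dist-pred x       zero    = ≤-trans (≤-reflexive (∣-∣-identityʳ x)) (m≤n⇒m≤1+n (n≤1+n x))
dist-pred zero    (suc k) = ≤-refl
dist-pred (suc x) (suc k) = dist-pred x k

pow-mono : ∀ {a b} → a ≤ b → 2 ^ a ≤ 2 ^ b
pow-mono = ^-monoʳ-≤ 2

-- All pebbles lie opposite to the target. With weights 2^(distance to that vertex) no move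
-- increases the total weight `p`, while `t` pebbles on the target would weigh `p + 1`.
evenCycle-insufficient : ∀ k t p → suc p ≡ t * 2 ^ suc k → ¬ Suffices (cycle (suc k + suc k)) t p
evenCycle-insufficient k t p p+1 S with S D total zero
  where
  k′ : ℕ
  k′ = suc k
  antipode : Fin (k′ + k′)
  antipode = fromℕ< (m<m+n k′ z<s)
  D : Vec ℕ (k′ + k′)
  D = replicate _ 0 [ antipode ]%= (p +_)
  total : sum D ≡ p
  total = trans (sum-weigh D) (trans (weigh-stack (λ _ → 1) (replicate _ 0) antipode p)
    (trans (cong (_+ p * 1) (weigh-zero {k′ + k′} (λ _ → 1))) (*-identityʳ p)))
... | D′ , σ , t≤ = <-irrefl refl (begin-strict
    p                               <⟨ n<1+n p ⟩
    suc p                           ≡⟨ trans p+1 (*-comm t _) ⟩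
    2 ^ k′ * t                      ≤⟨ *-monoʳ-≤ (2 ^ k′) t≤ ⟩
    ω zero * lookup D′ zero         ≤⟨ lookup-weigh ω D′ zero ⟩
    weigh ω D′                      ≤⟨ weigh-decreases ω adj σ ⟩
    weigh ω D                       ≡⟨ weigh-stack ω (replicate _ 0) antipode p ⟩
    weigh ω (replicate _ 0) + p * ω antipode  ≡⟨ cong₂ _+_ (weigh-zero ω) (cong (p *_) ω-antipode) ⟩
    p * 1                           ≡⟨ *-identityʳ p ⟩
    p                               ∎)
  where
  open ≤-Reasoning
  open Tally (cycle (suc k + suc k))
  k′ : ℕ
  k′ = suc k
  antipode : Fin (k′ + k′)
  antipode = fromℕ< (m<m+n k′ z<s)
  D : Vec ℕ (k′ + k′)
  D = replicate _ 0 [ antipode ]%= (p +_)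
  ω : Fin (k′ + k′) → ℕ
  ω i = 2 ^ ∣ toℕ i - k′ ∣
  ω-antipode : ω antipode ≡ 1
  ω-antipode = cong (2 ^_) (trans (cong (∣_- k′ ∣) (toℕ-fromℕ< (m<m+n k′ z<s))) (∣n-n∣≡0 k′))
  before-zero : ∀ {x} → suc x ≡ k′ + k′ → ∣ x - k′ ∣ ≡ k
  before-zero {x} e = trans (cong (∣_- k′ ∣) (trans (suc-injective e) (+-comm k k′))) (∣m+n-m∣≡n k′ k)
    where
    ∣m+n-m∣≡n : ∀ m n → ∣ m + n - m ∣ ≡ n
    ∣m+n-m∣≡n m n = trans (cong (λ s → ∣ m + n - s ∣) (sym (+-identityʳ m))) (trans (∣m+n-m+o∣≡∣n-o∣ m n 0) (∣-∣-identityʳ n))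
  adj : ∀ a b → CycleAdj (k′ + k′) a b → ω b ≤ 2 * ω a
  adj a b (_ , inj₁ (inj₁ e)) rewrite e = pow-mono (dist-suc (toℕ a) k′)
  adj a b (_ , inj₂ (inj₁ e)) rewrite e = pow-mono (dist-pred (toℕ b) k′)
  adj a b (_ , inj₁ (inj₂ (e , z))) rewrite z | before-zero e = ≤-refl
  adj a b (_ , inj₂ (inj₂ (e , z))) rewrite z | before-zero e = pow-mono (m≤n⇒m≤1+n (n≤1+n k))

-- For `k ≥ 1`, `suc (2 * third k)` is the pebbling number of the cycle on `k + suc k` vertices.
third : ℕ → ℕ
third k = 2 ^ suc k / 3

3∤2^ : ∀ k → ¬ 3 ∣ 2 ^ k
3∤2^ zero    (divides zero ())
3∤2^ zero    (divides (suc q) ())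
3∤2^ (suc k) d with euclidsLemma 2 (2 ^ k) prime3 d
  where
  prime3 : Prime 3
  prime3 = from-yes (prime? 3)
... | inj₁ (divides zero ())
... | inj₁ (divides (suc q) ())
... | inj₂ d′ = 3∤2^ k d′

-- Strict because 3 divides no power of 2; this keeps the weight of the bad distribution on an odd
-- cycle below `B`.
third< : ∀ k → 3 * third k < 2 ^ suc k
third< k = ≤∧≢⇒< (≤-trans (≤-reflexive (*-comm 3 (third k))) (≤-trans (m≤n+m (third k * 3) (2 ^ suc k % 3)) (≤-reflexive (sym (m≡m%n+[m/n]*n (2 ^ suc k) 3)))))
  λ e → 3∤2^ (suc k) (divides (third k) (trans (sym e) (*-comm 3 (third k))))

third> : ∀ k → 2 ^ suc k ≤ 2 + 3 * third k
third> k = ≤-trans (≤-reflexive (m≡m%n+[m/n]*n (2 ^ suc k) 3)) (≤-pred (m%n<n (2 ^ suc k) 3) ⊞ ≤-reflexive (*-comm (third k) 3))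

-- The stacks stand on the two vertices opposite to the target. Cutting the cycle at the target
-- leaves a path, with one weight doubling towards each of its ends. Neither grows as long as no
-- move enters the target, and entering it takes two pebbles of weight `B / 2` each, whereas both
-- weights start at `3 * μ * 2 ^ k₁`.
oddCycle-insufficient : ∀ k₁ → let k = suc k₁ in ¬ Suffices (cycle (suc (k + k))) 1 (2 * third k)
oddCycle-insufficient k₁ S = absurd (S D total zero)
  where
  k μ : ℕ
  k = suc k₁
  μ = third k
  v₁ v₂ : Fin (k + k)
  v₁ = fromℕ< {k₁} (≤-trans (n≤1+n k) (m<m+n k z<s))
  v₂ = fromℕ< {k} (m<m+n k z<s)
  D₁ D : Vec ℕ (suc (k + k))
  D₁ = replicate _ 0 [ suc v₁ ]%= (μ +_)
  D  = D₁ [ suc v₂ ]%= (μ +_)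
  weigh-D : ∀ ω → weigh ω D ≡ μ * ω (suc v₁) + μ * ω (suc v₂)
  weigh-D ω = trans (weigh-stack ω D₁ (suc v₂) μ) (cong (_+ μ * ω (suc v₂))
    (trans (weigh-stack ω (replicate _ 0) (suc v₁) μ) (cong (_+ μ * ω (suc v₁)) (weigh-zero ω))))
  total : sum D ≡ 2 * μ
  total = trans (sum-weigh D) (trans (weigh-D (λ _ → 1)) (shape μ))
    where
    shape : ∀ m → m * 1 + m * 1 ≡ 2 * m
    shape = solve-∀
  ωˡ ωʳ : Fin (suc (k + k)) → ℕ
  ωˡ zero    = 0
  ωˡ (suc i) = 2 ^ (k + k ∸ suc (toℕ i))
  ωʳ zero    = 0
  ωʳ (suc i) = 2 ^ toℕ i
  B : ℕ
  B = 2 ^ (k + k)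
  initial : μ * 2 ^ k + μ * 2 ^ k₁ < B
  initial = linear 0 (2 ^ k₁ ⊠ third< k) (trans (identity (2 ^ k₁) μ) (cong (_+ 2 ^ k₁ * suc (3 * μ)) (sym B≡))) ⊞′ m^n>0 2 k₁
    where
    B≡ : B ≡ 2 ^ k₁ * (2 * (2 * 2 ^ k₁))
    B≡ = trans (^-distribˡ-+-* 2 k k) (shape (2 ^ k₁))
      where
      shape : ∀ P → 2 * P * (2 * P) ≡ P * (2 * (2 * P))
      shape = solve-∀
    identity : ∀ P m → P + (m * (2 * P) + m * P) + P * (2 * (2 * P)) + 0 ≡ P * (2 * (2 * P)) + P * suc (3 * m)
    identity = solve-∀
    _⊞′_ : ∀ {P x B} → P + x ≤ B → 1 ≤ P → suc x ≤ B
    h ⊞′ 1≤P = ≤-trans (+-monoˡ-≤ _ 1≤P) h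
  initialˡ : weigh ωˡ D < B
  initialˡ = subst (_< B) (sym (trans (weigh-D ωˡ) (cong₂ (λ a b → μ * 2 ^ a + μ * 2 ^ b)
    (trans (cong (λ s → k + k ∸ suc s) (toℕ-fromℕ< (≤-trans (n≤1+n k) (m<m+n k z<s)))) (m+n∸m≡n k k))
    (trans (cong (λ s → k + k ∸ suc s) (toℕ-fromℕ< (m<m+n k z<s)))
      (trans (cong (_∸ k) (+-suc k₁ k₁)) (m+n∸m≡n k k₁)))))) initial
  initialʳ : weigh ωʳ D < B
  initialʳ = subst (_< B) (sym (trans (weigh-D ωʳ) (trans (cong₂ (λ a b → μ * 2 ^ a + μ * 2 ^ b)
    (toℕ-fromℕ< (≤-trans (n≤1+n k) (m<m+n k z<s))) (toℕ-fromℕ< (m<m+n k z<s))) (+-comm (μ * 2 ^ k₁) _)))) initial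

  Next-weightˡ : ∀ {i j : Fin (k + k)} → Next (suc (k + k)) (suc i) (suc j) ⊎ Next (suc (k + k)) (suc j) (suc i) → ωˡ (suc j) ≤ 2 * ωˡ (suc i)
  Next-weightˡ {i} {j} (inj₁ (inj₁ e)) rewrite suc-injective e = pow-mono (m≤n⇒m≤1+n (∸-monoʳ-≤ (k + k) (s≤s (n≤1+n (toℕ i)))))
  Next-weightˡ {i} {j} (inj₂ (inj₁ e)) rewrite suc-injective e = pow-mono (≤-trans (≤-reflexive (+-∸-assoc 1 {k + k} {suc (suc (toℕ j))} (subst (_< k + k) (suc-injective e) (toℕ<n i)))) ≤-refl)
  Next-weightʳ : ∀ {i j : Fin (k + k)} → Next (suc (k + k)) (suc i) (suc j) ⊎ Next (suc (k + k)) (suc j) (suc i) → ωʳ (suc j) ≤ 2 * ωʳ (suc i)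
  Next-weightʳ {i} {j} (inj₁ (inj₁ e)) rewrite suc-injective e = ≤-refl
  Next-weightʳ {i} {j} (inj₂ (inj₁ e)) rewrite suc-injective e = pow-mono (m≤n⇒m≤1+n (n≤1+n (toℕ j)))

  into-zero : ∀ {a : Fin (k + k)} → Next (suc (k + k)) (suc a) zero ⊎ Next (suc (k + k)) zero (suc a) →
    (2 * ωˡ (suc a) ≡ B) ⊎ (2 * ωʳ (suc a) ≡ B)
  into-zero (inj₁ (inj₂ (e , _))) = inj₂ (cong (2 ^_) (suc-injective e))
  into-zero (inj₂ (inj₁ e)) = inj₁ (cong (λ s → 2 * 2 ^ (k + k ∸ suc s)) (suc-injective e))

  heavy : ∀ ω (xs : Vec ℕ (suc (k + k))) v → 2 * ω v ≡ B → 2 ≤ lookup xs v → ¬ weigh ω xs < B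
  heavy ω xs v e 2≤ lt = <-irrefl refl (≤-trans lt (≤-trans (≤-reflexive (trans (sym e) (*-comm 2 (ω v))))
    (≤-trans (*-monoʳ-≤ (ω v) 2≤) (lookup-weigh ω xs v))))

  lighter : ∀ ω (xs : Vec ℕ (suc (k + k))) a b → ω b ≤ 2 * ω a → 2 ≤ lookup xs a → weigh ω xs < B →
    weigh ω ((xs [ a ]%= (_∸ 2)) [ b ]%= suc) < B
  lighter ω xs a b h 2≤ = ≤-<-trans (+-cancelʳ-≤ (2 * ω a) _ _ (≤-trans (≤-reflexive (weigh-move ω xs a b 2≤)) (+-monoʳ-≤ _ h)))

  stays-empty : ∀ {xs ys : Vec ℕ (k + k)} {y} → weigh ωˡ (0 ∷ xs) < B → weigh ωʳ (0 ∷ xs) < B →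
    Star (Move (cycle (suc (k + k)))) (0 ∷ xs) (y ∷ ys) → y ≡ 0
  stays-empty l r ε = refl
  stays-empty l r ((zero , b , _ , () , _) ◅ σ)
  stays-empty {xs} l r ((suc a , zero , (_ , e) , 2≤ , refl) ◅ σ) with into-zero e
  ... | inj₁ q = contradiction l (heavy ωˡ (0 ∷ xs) (suc a) q 2≤)
  ... | inj₂ q = contradiction r (heavy ωʳ (0 ∷ xs) (suc a) q 2≤)
  stays-empty {xs} l r ((suc a , suc b , (_ , e) , 2≤ , refl) ◅ σ) =
    stays-empty (lighter ωˡ (0 ∷ xs) (suc a) (suc b) (Next-weightˡ e) 2≤ l)
                (lighter ωʳ (0 ∷ xs) (suc a) (suc b) (Next-weightʳ e) 2≤ r) σ

  absurd : ¬ Reachable (cycle (suc (k + k))) 1 D zero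
  absurd (y ∷ ys , σ , 1≤y) = contradiction (stays-empty initialˡ initialʳ σ) λ { refl → contradiction 1≤y λ () }

evenCycle : ∀ k t → 1 ≤ t → IsPebblingNumber (cycle (suc k + suc k)) t (t * 2 ^ suc k)
evenCycle k t 1≤t = suffices , least
  where
  suffices : Suffices (cycle (suc k + suc k)) t (t * 2 ^ suc k)
  suffices = cycle-suffices (suc k) k (s≤s (≤-trans (s≤s z≤n) (m≤n+m _ k))) t _
    (≤-trans (≤-reflexive (identity (2 ^ k) t)) (n≤1+n _))
    where
    identity : ∀ P t → 2 * (2 * P * t + P * t) ≡ 3 * (t * (2 * P))
    identity = solve-∀
  least : ∀ q → Suffices (cycle (suc k + suc k)) t q → t * 2 ^ suc k ≤ q
  least q S with t * 2 ^ suc k in eq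
  ... | zero  = z≤n
  ... | suc p = Calculus.minimal (cycle (suc k + suc k)) (evenCycle-insufficient k t p (sym eq)) q S

oddCycle : ∀ k₁ → let k = suc k₁ in IsPebblingNumber (cycle (k + suc k)) 1 (suc (2 * third k))
oddCycle k₁ =
  cycle-suffices k k (s≤s (≤-trans (s≤s z≤n) (m≤n+m _ k₁))) 1 _ (linear 0 (2 ⊠ third> k) (identity (2 ^ k) (third k))) ,
  Calculus.minimal (cycle (k + suc k)) (subst (λ K → ¬ Suffices (cycle K) 1 (2 * third k)) (sym (+-suc k k)) (oddCycle-insufficient k₁))
  where
  k : ℕ
  k = suc k₁
  identity : ∀ P m → 2 * (P * 1 + P * 1) + 2 * (2 + 3 * m) + 0 ≡ suc (3 * suc (2 * m)) + 2 * (2 * P)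
  identity = solve-∀

-- An alternating chain loses nothing; a chain whose length has the wrong parity for alternation
-- contains a sector of intermediate size, which costs gap.
debt : ℕ → ℕ → Bool → ℕ
debt gap zero    true  = 0
debt gap zero    false = gap
debt gap (suc r) b     = debt gap r (not b)

debt≤gap : ∀ gap r b → debt gap r b ≤ gap
debt≤gap gap zero    true  = z≤n
debt≤gap gap zero    false = ≤-refl
debt≤gap gap (suc r) b     = debt≤gap gap r (not b)

-- Deliveries from a single sector

module Sectors (G : Graph) (hub : Paths.V G) (k₁ : ℕ) where
  open Paths G

  k n d : ℕ
  k = suc k₁
  n = k + k
  d = 2 ^ k₁

  record Sector (p : ℕ → V) : Set where
    field
      along  : ∀ l → l < n → Adj G (p l) (p (suc l))
      first  : Adj G (p 0) hub
      last   : Adj G (p n) hub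
  open Sector

  amount : (ℕ → ℕ) → ℕ
  amount = ∑ (suc n)

  -- The spent pebbles are part of the data, because the others must stay available for later
  -- deliveries.
  record Send (κ : ℕ) (p : ℕ → V) (c : ℕ → ℕ) (w : V) : Set where
    constructor send
    field
      used    : ℕ → ℕ
      used≤   : ∀ l → l < suc n → used l ≤ c l
      cost    : amount used ≤ κ
      arrives : spread (suc n) p used ⇝ 1 · w

  Send-mono : ∀ {κ κ′ p c w} → κ ≤ κ′ → Send κ p c w → Send κ′ p c w
  Send-mono κ≤κ′ (send c₁ c₁≤c small r) = send c₁ c₁≤c (≤-trans small κ≤κ′) r

  rev : ℕ → ℕ
  rev l = n ∸ l

  rev-< : ∀ l → rev l < suc n
  rev-< l = s≤s (m∸n≤m n l)

  Sector-reverse : ∀ {p} → Sector p → Sector (p ∘ rev)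
  Sector-reverse {p} S .along l l<n = adj-sym G (subst (λ x → Adj G (p (rev (suc l))) (p x)) (sym (+-∸-assoc 1 l<n))
    (along S (rev (suc l)) (s≤s (m∸n≤m _ l))))
  Sector-reverse S .first = last S
  Sector-reverse {p} S .last = subst (λ x → Adj G (p x) hub) (sym (n∸n≡0 n)) (first S)

  Send-reverse : ∀ {κ p c w} → Send κ (p ∘ rev) (c ∘ rev) w → Send κ p c w
  Send-reverse {κ} {p} {c} {w} (send c₁ c₁≤c small r) = send (c₁ ∘ rev) c₁∘rev≤c (≤-trans (≤-reflexive (∑-reverse n c₁)) small)
    (weaken (≡⇒≼ λ v → trans (sym (∑-reverse n λ l → c₁ l * δ (p (rev l)) v))
      (∑-cong (suc n) λ l l<sn → cong (λ x → c₁ (rev l) * δ (p x) v) (m∸[m∸n]≡n (≤-pred l<sn)))) r)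
    where
    c₁∘rev≤c : ∀ l → l < suc n → c₁ (rev l) ≤ c l
    c₁∘rev≤c l l<sn = ≤-trans (c₁≤c (rev l) (rev-< l)) (≤-reflexive (cong c (m∸[m∸n]≡n (≤-pred l<sn))))

  take-amount : ∀ {s c} → s ≤ amount c → amount (takeFirst s c) ≡ s
  take-amount {s} {c} h = trans (∑-takeFirst (suc n) s c) (m≤n⇒m⊓n≡m h)

  two-ended : ∀ i j → i + suc j ≡ n → ∀ {p} → Sector p → ∀ c a b →
    2 * (2 ^ i * a + 2 ^ j * b) ≤ suc (3 * amount c) →
    (spread (suc n) p c ⇝ a · p 0) ⊎ (spread (suc n) p c ⇝ b · p n)
  two-ended i j eq {p} S c a b h
    with two-sided i j p c a b (λ l l<n → along S l (subst (l <_) eq l<n))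
           (≤-trans h (≤-reflexive (cong (λ x → suc (3 * ∑ x c)) (sym eq′))))
    where
    eq′ : i + suc (suc j) ≡ suc n
    eq′ = trans (+-suc i (suc j)) (cong suc eq)
  ... | r rewrite trans (+-suc i (suc j)) (cong suc eq) | eq = r

  to-hub : ∀ {a D} → Adj G a hub → D ⇝ 2 · a → D ⇝ 1 · hub
  to-hub e r = ⇝-trans r (move-pairs 1 e)

  -- Either alternative will do, since both ends are adjacent to the hub and two pebbles on one of
  -- them become one on the hub.
  send-hub : ∀ {p c} → Sector p → 4 * d ≤ amount c → Send (4 * d) p c hub
  send-hub {p} {c} S h = send (takeFirst (4 * d) c) (λ l _ → takeFirst-≤ (4 * d) c l) (≤-reflexive (take-amount {c = c} h))
    ([ to-hub (first S) , to-hub (last S) ]′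
      (two-ended k k₁ refl S (takeFirst (4 * d) c) 2 2
        (≤-trans (≤-reflexive (identity d)) (≤-trans (n≤1+n _) (≤-reflexive (cong (λ x → suc (3 * x)) (sym (take-amount {c = c} h))))))))
    where
    identity : ∀ d → 2 * (2 * d * 2 + d * 2) ≡ 3 * (4 * d)
    identity = solve-∀

  send-either : ∀ {p c} → Sector p → 2 * d ≤ amount c → Send (2 * d) p c (p 0) ⊎ Send (2 * d) p c (p n)
  send-either {p} {c} S h
    with two-ended k k₁ refl S (takeFirst (2 * d) c) 1 1
      (≤-trans (≤-reflexive (identity d)) (≤-trans (n≤1+n _) (≤-reflexive (cong (λ x → suc (3 * x)) (sym (take-amount {c = c} h))))))
    where
    identity : ∀ d → 2 * (2 * d * 1 + d * 1) ≡ 3 * (2 * d)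
    identity = solve-∀
  ... | inj₁ r = inj₁ (send (takeFirst (2 * d) c) (λ l _ → takeFirst-≤ (2 * d) c l) (≤-reflexive (take-amount {c = c} h)) r)
  ... | inj₂ r = inj₂ (send (takeFirst (2 * d) c) (λ l _ → takeFirst-≤ (2 * d) c l) (≤-reflexive (take-amount {c = c} h)) r)

  -- The demands are one pebble on the left end and two on the right end, where they make one on the
  -- hub. Cut at the middle, both cost `2 * d` in `two-ended`, and `8 * d ≤ suc (3 * amount c)` is
  -- the origin of the threshold.
  send-left-or-hub : ∀ {p c} → Sector p → 2 * third k < amount c → amount c ≤ 4 * d →
    Send (4 * d) p c (p 0) ⊎ Send (4 * d) p c hub
  send-left-or-hub {p} {c} S h small
    with two-ended k k₁ refl S c 1 2 (linear 0 (2 ⊠ third> k ⊞ 3 ⊠ h) (identity d (third k) (amount c)))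
    where
    identity : ∀ d m a → 2 * (2 * d * 1 + d * 2) + (2 * (2 + 3 * m) + 3 * a) + 0 ≡ suc (3 * a) + (2 * (2 * (2 * d)) + 3 * suc (2 * m))
    identity = solve-∀
  ... | inj₁ r = inj₁ (send c (λ l _ → ≤-refl) small r)
  ... | inj₂ r = inj₂ (send c (λ l _ → ≤-refl) small (to-hub (last S) r))

  -- Only the pebbles on p 0, …, p k are tried for the left end, which keeps the cost below 2d.
  send-left-or-hub-cheaply : ∀ {p c} → Sector p → 3 * d ≤ amount c → amount c ≤ 4 * d →
    Send (2 * d) p c (p 0) ⊎ Send (4 * d) p c hub
  send-left-or-hub-cheaply {p} {c} S h small with 2 * d ≤? c (k + 0) + 2 * ∑ k c
  ... | yes q = inj₁ (send c₁ (λ l _ → takeFirst-≤ (2 * d) c l)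
      (≤-reflexive (take-amount {c = c} (≤-trans (*-monoˡ-≤ d {2} {3} (s≤s (s≤s z≤n))) h)))
      (weaken covered (collectˡ k p c₁ (c₁ k) 1 (λ l l<k → adj-sym G (along S l (≤-trans l<k (m≤m+n k k)))) enough)))
    where
    c₁ : ℕ → ℕ
    c₁ = takeFirst (2 * d) c
    prefix : ∑ (suc k) c₁ ≡ 2 * d ⊓ ∑ (suc k) c
    prefix = ∑-takeFirst (suc k) (2 * d) c
    -- Either the `2 * d` pebbles kept all lie on `p 0`, ..., `p k`, where each is worth at least
    -- one on `p k`, or nothing on these vertices was discarded.
    min-sum : ∀ D u x → D ≤ x + 2 * u → D ≤ D ⊓ (u + x) + D ⊓ u
    min-sum D u x g with D ≤? u + x
    ... | yes D≤ = ≤-trans (≤-reflexive (sym (m≤n⇒m⊓n≡m D≤))) (m≤m+n _ _)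
    ... | no  D≰ = ≤-trans g (≤-reflexive (trans (shape x u) (sym (cong₂ _+_ (m≥n⇒m⊓n≡n (<⇒≤ (≰⇒> D≰))) (m≥n⇒m⊓n≡n (≤-trans (m≤m+n u x) (<⇒≤ (≰⇒> D≰))))))))
      where
      shape : ∀ x u → x + 2 * u ≡ u + x + u
      shape = solve-∀
    enough : 2 ^ k * 1 ≤ c₁ k + 2 * ∑ k c₁
    enough = begin
      2 ^ k * 1                                      ≡⟨ *-identityʳ (2 ^ k) ⟩
      2 * d                                          ≤⟨ min-sum (2 * d) (∑ k c) (c k) (subst (λ x → 2 * d ≤ c x + 2 * ∑ k c) (+-identityʳ k) q) ⟩
      2 * d ⊓ (∑ k c + c k) + 2 * d ⊓ ∑ k c          ≡⟨ cong (λ x → 2 * d ⊓ x + 2 * d ⊓ ∑ k c) (sym (∑-last k c)) ⟩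
      2 * d ⊓ ∑ (suc k) c + 2 * d ⊓ ∑ k c            ≡⟨ cong₂ _+_ (sym prefix) (sym (∑-takeFirst k (2 * d) c)) ⟩
      ∑ (suc k) c₁ + ∑ k c₁                          ≡⟨ cong (_+ ∑ k c₁) (∑-last k c₁) ⟩
      ∑ k c₁ + c₁ k + ∑ k c₁                         ≡⟨ shape (∑ k c₁) (c₁ k) ⟩
      c₁ k + 2 * ∑ k c₁                              ∎
      where
      open ≤-Reasoning
      shape : ∀ u x → u + x + u ≡ x + 2 * u
      shape = solve-∀
    covered : spread k p c₁ ⊕ c₁ k · p k ≼ spread (suc n) p c₁
    covered v = ≤-trans (≤-reflexive (sym (∑-last k f))) (≤-trans (m≤m+n _ (∑ k (λ l → f (suc k + l)))) (≤-reflexive (sym (∑-split (suc k) k f))))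
      where
      f : ℕ → ℕ
      f l = c₁ l * δ (p l) v
  ... | no ¬q = inj₂ (send c (λ l _ → ≤-refl) small (to-hub (last S)
      (subst (λ x → spread x p c ⇝ 2 · p n) (+-suc k k) (push-right k k₁ p c 2 (along S) enough))))
    where
    u x y w hx : ℕ
    u = ∑ k c
    x = c (k + 0)
    y = c (k + 1)
    w = ∑ k₁ (λ l → c (k + suc (suc l)))
    hx = ⌊ x /2⌋
    h′ : 3 * d ≤ u + (x + (y + w))
    h′ = ≤-trans h (≤-reflexive (trans (cong (λ s → ∑ s c) (sym (+-suc k k))) (∑-split k (suc (suc k₁)) c)))
    identity : ∀ d u x y w hx → 2 * (d * 2) + (2 * (u + (x + (y + w))) + (2 * d + suc (hx + hx))) + suc (2 * w)
      ≡ suc (2 * (y + hx + 2 * w)) + (2 * (3 * d) + (suc (x + 2 * u) + x))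
    identity = solve-∀
    -- As `x + 2 * u < 2 * d`, doubling the total of at least `3 * d` leaves
    -- `2 * (y + w) + x > 4 * d`; this fixes the threshold `3 * d`.
    enough : 2 ^ k₁ * 2 ≤ y + hx + 2 * w
    enough = ≤-halve (linear (suc (2 * w)) (2 ⊠ h′ ⊞ ≰⇒> ¬q ⊞ half-double x) (identity d u x y w hx))

  send-right-or-hub : ∀ {p c} → Sector p → 2 * third k < amount c → amount c ≤ 4 * d →
    Send (4 * d) p c (p n) ⊎ Send (4 * d) p c hub
  send-right-or-hub {p} {c} S h small =
    [ inj₁ ∘ Send-reverse {p = p} , inj₂ ∘ Send-reverse {p = p} ]′ (send-left-or-hub {p ∘ rev} {c ∘ rev} (Sector-reverse S)
      (≤-trans h (≤-reflexive (sym (∑-reverse n c)))) (≤-trans (≤-reflexive (∑-reverse n c)) small))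

  send-right-or-hub-cheaply : ∀ {p c} → Sector p → 3 * d ≤ amount c → amount c ≤ 4 * d →
    Send (2 * d) p c (p n) ⊎ Send (4 * d) p c hub
  send-right-or-hub-cheaply {p} {c} S h small =
    [ inj₁ ∘ Send-reverse {p = p} , inj₂ ∘ Send-reverse {p = p} ]′ (send-left-or-hub-cheaply {p ∘ rev} {c ∘ rev} (Sector-reverse S)
      (≤-trans h (≤-reflexive (sym (∑-reverse n c)))) (≤-trans (≤-reflexive (∑-reverse n c)) small))

  -- `M` is the amount from which both ends, or else the hub, can be served. Reaching the hub may
  -- cost `2 * κ`, as much as two neighbours sending one pebble each to their common spoke.
  data Class (κ M : ℕ) (p : ℕ → V) (c : ℕ → ℕ) : Set where
    none     : amount c < 2 * d → Class κ M p c
    to-left  : amount c < M → Send κ p c (p 0) → Class κ M p c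
    to-right : amount c < M → Send κ p c (p n) → Class κ M p c
    to-both  : amount c < 4 * d → Send κ p c (p 0) → Send κ p c (p n) → Class κ M p c
    to-centre : Send (2 * κ) p c hub → Class κ M p c

  classify : ∀ κ M → 2 * d ≤ κ →
    (∀ {p c} → Sector p → M ≤ amount c → amount c ≤ 4 * d → Send κ p c (p 0) ⊎ Send (4 * d) p c hub) →
    (∀ {p c} → Sector p → M ≤ amount c → amount c ≤ 4 * d → Send κ p c (p n) ⊎ Send (4 * d) p c hub) →
    ∀ {p} → Sector p → ∀ c → Class κ M p c
  classify κ M 2d≤κ left right {p} S c = decide (amount c <? 2 * d) (amount c <? M) (amount c <? 4 * d)
    where
    centre : Send (4 * d) p c hub → Class κ M p c
    centre s = to-centre (Send-mono (≤-trans (≤-reflexive (*-assoc 2 2 d)) (*-monoʳ-≤ 2 2d≤κ)) s)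
    decide : Dec (amount c < 2 * d) → Dec (amount c < M) → Dec (amount c < 4 * d) → Class κ M p c
    decide (yes a<2d) _ _ = none a<2d
    decide (no _) _ (no a≮4d) = centre (send-hub S (≮⇒≥ a≮4d))
    decide (no a≮2d) (yes a<M) (yes a<4d) =
      [ to-left a<M ∘ Send-mono 2d≤κ , to-right a<M ∘ Send-mono 2d≤κ ]′ (send-either S (≮⇒≥ a≮2d))
    decide (no _) (no a≮M) (yes a<4d) with left S (≮⇒≥ a≮M) (<⇒≤ a<4d) | right S (≮⇒≥ a≮M) (<⇒≤ a<4d)
    ... | inj₂ s | _      = centre s
    ... | inj₁ _ | inj₂ s = centre s
    ... | inj₁ s | inj₁ t = to-both a<4d s t

  classify-cheap : ∀ {p} → Sector p → ∀ c → Class (2 * d) (3 * d) p c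
  classify-cheap = classify (2 * d) (3 * d) ≤-refl send-left-or-hub-cheaply send-right-or-hub-cheaply

  classify-exact : ∀ {p} → Sector p → ∀ c → Class (4 * d) (suc (2 * third k)) p c
  classify-exact = classify (4 * d) (suc (2 * third k)) (*-monoˡ-≤ d {2} {4} (s≤s (s≤s z≤n))) send-left-or-hub send-right-or-hub

  -- Chains of consecutive sectors

  Content : Set
  Content = ℕ → ℕ → ℕ

  chain : ℕ → (ℕ → V) → Content → Pebbles
  chain zero    g c v = 0
  chain (suc r) g c v = spread (suc n) g (c 0) v + chain r (g ∘ (n +_)) (c ∘ suc) v

  size : ℕ → Content → ℕ
  size r c = ∑ r (amount ∘ c)

  record Rim (g : ℕ → V) : Set where
    field
      next  : ∀ l → Adj G (g l) (g (suc l))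
      spoke : ∀ j → Adj G (g (j * n)) hub
  open Rim

  Rim-shift : ∀ {g} → Rim g → Rim (g ∘ (n +_))
  Rim-shift {g} R .next l = subst (λ x → Adj G (g (n + l)) (g x)) (sym (+-suc n l)) (next R (n + l))
  Rim-shift R .spoke j = spoke R (suc j)

  Rim⇒Sector : ∀ {g} → Rim g → Sector g
  Rim⇒Sector R .along l _ = next R l
  Rim⇒Sector R .first = spoke R 0
  Rim⇒Sector {g} R .last = subst (λ x → Adj G (g x) hub) (+-identityʳ n) (spoke R 1)

  -- `X` is the set of acceptable goals. It will be the vertex set of the cycle through the target,
  -- so that the hub and both ends of the chain count equally.
  record Advance (X : V → Set) (κ r : ℕ) (g : ℕ → V) (c : Content) : Set where
    constructor advancing
    field
      used    : Content
      used≤   : ∀ j l → j < r → l < suc n → used j l ≤ c j l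
      cost    : size r used ≤ 2 * κ
      goal    : V
      goal∈   : X goal
      arrives : chain r g used ⇝ 1 · goal

  infixr 5 _∷ᶜ_
  _∷ᶜ_ : (ℕ → ℕ) → Content → Content
  (f ∷ᶜ c) zero    = f
  (f ∷ᶜ c) (suc j) = c j

  empty : Content
  empty _ _ = 0

  size-empty : ∀ r → size r empty ≡ 0
  size-empty r = ∑-zero r λ j _ → ∑-zero (suc n) λ l _ → refl

  module _ (X : V → Set) (X-hub : X hub) (κ : ℕ) where

    advance-tail : ∀ {r g c} → Advance X κ r (g ∘ (n +_)) (c ∘ suc) → Advance X κ (suc r) g c
    advance-tail {r} (advancing c₁ c₁≤c small x Xx s) = advancing ((λ _ → 0) ∷ᶜ c₁)
      (λ { zero l _ _ → z≤n ; (suc j) l (s<s j<r) l<n → c₁≤c j l j<r l<n })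
      (≤-trans (≤-reflexive (cong (_+ size r c₁) (∑-zero (suc n) λ l _ → refl))) small)
      x Xx (weaken (λ v → m≤n+m _ _) s)

    advance-head : ∀ {r g c x} → X x → Send (2 * κ) g (c 0) x → Advance X κ (suc r) g c
    advance-head {r} {x = x} Xx (send f f≤c small s) = advancing (f ∷ᶜ empty)
      (λ { zero l _ l<n → f≤c l l<n ; (suc j) l _ _ → z≤n })
      (≤-trans (≤-reflexive (trans (cong (amount f +_) (size-empty r)) (+-identityʳ _))) small)
      x Xx (weaken (λ v → m≤m+n _ _) s)

    κ≤2κ : κ ≤ 2 * κ
    κ≤2κ = m≤m+n κ _

    advance-join : ∀ {r g c} → Rim g → Send κ g (c 0) (g n) → Send κ (g ∘ (n +_)) (c 1) (g (n + 0)) →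
      Advance X κ (suc (suc r)) g c
    advance-join {r} {g} R (send f f≤c small s) (send f′ f′≤c small′ s′) = advancing (f ∷ᶜ f′ ∷ᶜ empty)
      (λ { zero l _ l<n → f≤c l l<n ; (suc zero) l _ l<n → f′≤c l l<n ; (suc (suc j)) l _ _ → z≤n })
      (≤-trans (≤-reflexive (cong (λ x → amount f + (amount f′ + x)) (size-empty r))) (small ⊞ small′ ⊞ z≤n))
      hub X-hub
      (weaken (λ v → +-monoʳ-≤ (spread (suc n) g f v) (m≤m+n _ _))
        (⇝-trans (both s s′) (⇝-trans (stop (≡⇒≼ two)) (move-pairs 1 (spoke R 1)))))
      where
      two : ∀ v → 2 * δ (g (n + 0)) v ≡ 1 * δ (g n) v + 1 * δ (g (n + 0)) v
      two v rewrite +-identityʳ n = shape (δ (g n) v)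
        where
        shape : ∀ x → 2 * x ≡ 1 * x + 1 * x
        shape = solve-∀

    module _ (M gap : ℕ) (M+gap : M + gap ≡ 3 * d) (gap≤d : gap ≤ d)
             (class : ∀ {p} → Sector p → ∀ c → Class κ M p c) where

      Ready : ℕ → (ℕ → V) → Content → Set
      Ready zero    g c = ⊤
      Ready (suc r) g c = Send κ g (c 0) (g 0)

      -- In the last case one more pebble on the left end g 0 of the chain would suffice.
      data Outcome (r : ℕ) (g : ℕ → V) (c : Content) : Set where
        advance : Advance X κ r g c → Outcome r g c
        idle    : size r c + r + debt gap r false + d ≤ 3 * d * r → Outcome r g c
        ready   : size r c + r + debt gap r true ≤ 3 * d * r → Ready r g c → Outcome r g c

      join : ∀ r {g c} → Rim g → X (g (suc r * n)) → Send κ g (c 0) (g n) → Ready r (g ∘ (n +_)) (c ∘ suc) →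
        Advance X κ (suc r) g c
      join zero    {g} {c} R Xend s _ = advance-head {c = c} (subst (λ x → X (g x)) (+-identityʳ n) Xend) (Send-mono κ≤2κ s)
      join (suc r) {g} {c} R Xend s t = advance-join {c = c} R s t

      -- The chain grows at its left end. With one added per sector, alternating sectors count 2d
      -- and 4d, on average 3d. The extremal idle chain begins and ends with a small sector, hence
      -- the extra `d`, and `gap` is what the bound `M` is short of the average. A sector that can
      -- send right, beside a ready chain, completes a pair at their common spoke.
      outcome : ∀ r {g} → Rim g → X (g (r * n)) → ∀ c → Outcome r g c
      outcome zero R Xend c = ready z≤n tt
      outcome (suc r) {g} R Xend c with class (Rim⇒Sector R) (c 0) | outcome r (Rim-shift R) Xend (c ∘ suc)
      ... | _ | advance A = advance (advance-tail {c = c} A)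
      ... | to-centre s | _ = advance (advance-head {c = c} X-hub s)
      -- A small sector beside an idle chain falls short of alternation by another `d`, and
      -- `gap ≤ d` lets this cover the change of the debt.
      ... | none a< | idle b = idle (linear (debt gap r false) (a< ⊞ b ⊞ debt≤gap gap r true ⊞ gap≤d)
            (identity (amount (c 0)) (size r (c ∘ suc)) r (debt gap r false) (debt gap r true) d gap))
        where
        identity : ∀ a S r D D′ d e → a + S + suc r + D′ + d + (2 * d + (3 * d * r + (e + d))) + D
          ≡ 3 * d * suc r + (suc a + (S + r + D + d + (D′ + e)))
        identity = solve-∀
      ... | none a< | ready b _ = idle (linear 0 (a< ⊞ b)
            (identity (amount (c 0)) (size r (c ∘ suc)) r (debt gap r true) d))
        where
        identity : ∀ a S r D d → a + S + suc r + D + d + (2 * d + 3 * d * r) + 0 ≡ 3 * d * suc r + (suc a + (S + r + D))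
        identity = solve-∀
      ... | to-left a< s | idle b = ready (linear (gap + d) (a< ⊞ b ⊞ ≤-reflexive M+gap)
            (identity (amount (c 0)) (size r (c ∘ suc)) r (debt gap r false) d M gap)) s
        where
        identity : ∀ a S r D d M e → a + S + suc r + D + (M + (3 * d * r + 3 * d)) + (e + d) ≡ 3 * d * suc r + (suc a + (S + r + D + d + (M + e)))
        identity = solve-∀
      ... | to-left a< s | ready b _ = ready (linear (debt gap r true) (a< ⊞ b ⊞ debt≤gap gap r false ⊞ ≤-reflexive M+gap)
            (identity (amount (c 0)) (size r (c ∘ suc)) r (debt gap r true) (debt gap r false) d M gap)) s
        where
        identity : ∀ a S r D D′ d M e → a + S + suc r + D′ + (M + (3 * d * r + (e + 3 * d))) + D ≡ 3 * d * suc r + (suc a + (S + r + D + (D′ + (M + e))))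
        identity = solve-∀
      ... | to-right a< s | idle b = idle (linear (debt gap r false) (a< ⊞ b ⊞ debt≤gap gap r true ⊞ ≤-reflexive M+gap)
            (identity (amount (c 0)) (size r (c ∘ suc)) r (debt gap r false) (debt gap r true) d M gap))
        where
        identity : ∀ a S r D D′ d M e → a + S + suc r + D′ + d + (M + (3 * d * r + (e + 3 * d))) + D ≡ 3 * d * suc r + (suc a + (S + r + D + d + (D′ + (M + e))))
        identity = solve-∀
      ... | to-both a< s _ | idle b = ready (linear 0 (a< ⊞ b)
            (identity (amount (c 0)) (size r (c ∘ suc)) r (debt gap r false) d)) s
        where
        identity : ∀ a S r D d → a + S + suc r + D + (4 * d + 3 * d * r) + 0 ≡ 3 * d * suc r + (suc a + (S + r + D + d))
        identity = solve-∀
      ... | to-right _ s  | ready _ t = advance (join r {c = c} R Xend s t)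
      ... | to-both _ _ s | ready _ t = advance (join r {c = c} R Xend s t)

      -- When the whole chain is ready, the pebble for its left end is itself a success, as that end
      -- lies in `X`. Only an idle chain has to be excluded by its size.
      chain-advance : ∀ r {g} → Rim g → X (g 0) → X (g (suc r * n)) → ∀ c →
        3 * d * suc r < size (suc r) c + suc r + debt gap (suc r) false + d → Advance X κ (suc r) g c
      chain-advance r {g} R Xstart Xend c big with outcome (suc r) R Xend c
      ... | advance A = A
      ... | idle b    = contradiction b (<⇒≱ big)
      ... | ready _ s = advance-head {c = c} Xstart (Send-mono κ≤2κ s)

-- Gathering pebbles on the cycle through the target

opaque

  indicator : ℕ → ℕ → ℕ
  indicator i l with i ℕ.≟ l
  ... | yes _ = 1
  ... | no  _ = 0

  indicator-refl : ∀ i → indicator i i ≡ 1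
  indicator-refl i with i ℕ.≟ i
  ... | yes _  = refl
  ... | no i≢i = contradiction refl i≢i

  indicator-≢ : ∀ {i l} → i ≢ l → indicator i l ≡ 0
  indicator-≢ {i} {l} i≢l with i ℕ.≟ l
  ... | yes i≡l = contradiction i≡l i≢l
  ... | no _    = refl

∑-indicator : ∀ n i (w : ℕ → ℕ) → i < n → ∑ n (λ l → indicator i l * w l) ≡ w i
∑-indicator n i w i<n = trans
  (∑-single n _ i i<n λ l _ l≢i → cong (_* w l) (indicator-≢ (l≢i ∘ sym)))
  (trans (cong (_* w i) (indicator-refl i)) (+-identityʳ (w i)))

module ClosedChain (G : Graph) (hub : Paths.V G) (k₁ R : ℕ) (g : ℕ → Paths.V G) where
  open Paths G
  open Sectors G hub k₁
  open Rim

  K r : ℕ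
  K = suc k + suc k
  r = suc R

  K≡ : K ≡ suc (suc n)
  K≡ = cong suc (+-suc k k)

  -- The sector number r, which closes the chain of the sectors 0, …, r − 1, forms together
  -- with the hub a cycle of length K = n + 2.
  home : ℕ → V
  home l with l ≤? n
  ... | yes _ = g (r * n + l)
  ... | no  _ = hub

  home-≤ : ∀ {l} → l ≤ n → home l ≡ g (r * n + l)
  home-≤ {l} h with l ≤? n
  ... | yes _ = refl
  ... | no ¬h = contradiction h ¬h

  home-> : ∀ {l} → n < l → home l ≡ hub
  home-> {l} h with l ≤? n
  ... | yes h′ = contradiction h′ (<⇒≱ h)
  ... | no _   = refl

  Home : V → Set
  Home x = ∃[ i ] i < K × home i ≡ x

  split-amount : ∀ (c c₁ : Content) s → (∀ j l → j < s → l < suc n → c₁ j l ≤ c j l) →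
    size s c ≡ size s c₁ + size s (λ j l → c j l ∸ c₁ j l)
  split-amount c c₁ s h = trans
    (∑-cong s λ j j<s → trans (∑-cong (suc n) λ l l<n → sym (m+[n∸m]≡n (h j l j<s l<n))) (∑-distrib-+ (suc n) (c₁ j) (λ l → c j l ∸ c₁ j l)))
    (∑-distrib-+ s (amount ∘ c₁) (λ j → amount (λ l → c j l ∸ c₁ j l)))

  split-chain : ∀ s p (c c₁ : Content) → (∀ j l → j < s → l < suc n → c₁ j l ≤ c j l) →
    ∀ v → chain s p c v ≡ chain s p c₁ v + chain s p (λ j l → c j l ∸ c₁ j l) v
  split-chain zero    p c c₁ h v = refl
  split-chain (suc s) p c c₁ h v = trans
    (cong₂ _+_ (trans (∑-cong (suc n) λ l l<n → trans (cong (_* δ (p l) v) (sym (m+[n∸m]≡n (h 0 l z<s l<n)))) (*-distribʳ-+ (δ (p l) v) (c₁ 0 l) (c 0 l ∸ c₁ 0 l)))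
                 (∑-distrib-+ (suc n) (λ l → c₁ 0 l * δ (p l) v) (λ l → (c 0 l ∸ c₁ 0 l) * δ (p l) v)))
               (split-chain s (p ∘ (n +_)) (c ∘ suc) (c₁ ∘ suc) (λ j l j<s → h (suc j) l (s<s j<s)) v))
    (shape (spread (suc n) p (c₁ 0) v) (spread (suc n) p (λ l → c 0 l ∸ c₁ 0 l) v) (chain s (p ∘ (n +_)) (c₁ ∘ suc) v) _)
    where
    shape : ∀ a b c d → a + b + (c + d) ≡ a + c + (b + d)
    shape = solve-∀

  module _ (rim : Rim g) (closed : g (r * n + n) ≡ g 0) where

    home-step : ∀ i j → Next K i j → Adj G (home (toℕ i)) (home (toℕ j))
    home-step i j (inj₁ e) with toℕ i <? n
    ... | yes i<n rewrite e | home-≤ (<⇒≤ i<n) | home-≤ i<n | +-suc (r * n) (toℕ i) = next rim (r * n + toℕ i)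
    ... | no  i≮n with m≤n⇒m<n∨m≡n (≮⇒≥ i≮n)
    ...   | inj₁ n<i = contradiction (subst (_< K) e (toℕ<n j)) (≤⇒≯ (≤-trans (≤-reflexive K≡) (s≤s n<i)))
    ...   | inj₂ n≡i rewrite e | sym n≡i | home-≤ {n} ≤-refl | home-> {suc n} ≤-refl =
      subst (λ x → Adj G x hub) (sym closed) (spoke rim 0)
    home-step i j (inj₂ (e , z))
      rewrite z | suc-injective (trans e K≡) | home-> {suc n} ≤-refl | home-≤ {0} z≤n | +-identityʳ (r * n) =
      adj-sym G (spoke rim r)

    home-reach : ∀ e w → Home w → 4 * d ≤ ∑ K e → spread K home e ⇝ 1 · w
    home-reach e w (i , i<K , home≡w) enough =
      weaken (≡⇒≼ λ v → ∑-cong K λ l l<K → cong (λ x → e x * δ (home x) v) (at l l<K))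
      (⇝-trans (closed-walk (suc k) k (home ∘ toℕ ∘ (_mod K)) (e ∘ toℕ ∘ (_mod K))
          (λ l → home-step (l mod K) (suc l mod K) (Next-mod K l))
          (λ l → cong (home ∘ toℕ) (mod-period K l)) (λ l → cong (e ∘ toℕ) (mod-period K l)) 1
          (linear 1 (3 ⊠ enough) (trans (identity d (∑ K e)) (cong (λ x → suc (3 * x) + 3 * (4 * d)) (∑-cong K λ l l<K → cong e (sym (at l l<K)))))) i)
        (stop (≡⇒≼ λ v → cong (λ x → 1 * δ x v) (sym (trans (cong home (at i i<K)) home≡w)))))
      where
      at : ∀ l → l < K → toℕ (l mod K) ≡ l
      at l l<K = trans (toℕ-mod l K) (m<n⇒m%n≡m l<K)
      identity : ∀ d S → 2 * (2 * (2 * d) * 1 + 2 * d * 1) + 3 * S + 1 ≡ suc (3 * S) + 3 * (4 * d)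
      identity = solve-∀

    Home-hub : Home hub
    Home-hub = suc n , ≤-reflexive (sym K≡) , home-> ≤-refl

    Home-start : Home (g 0)
    Home-start = n , subst (n <_) (sym K≡) (n≤1+n (suc n)) , trans (home-≤ ≤-refl) closed

    Home-end : Home (g (r * n))
    Home-end = 0 , z<s , trans (home-≤ z≤n) (cong g (+-identityʳ (r * n)))

    arrive : ∀ e {x} → Home x → ∃[ e′ ] ∑ K e′ ≡ suc (∑ K e) × (∀ v → spread K home e′ v ≡ δ x v + spread K home e v)
    arrive e (i , i<K , refl) = (λ l → indicator i l + e l) ,
      trans (∑-distrib-+ K (indicator i) e) (cong (_+ ∑ K e)
        (trans (∑-cong K λ l _ → sym (*-identityʳ (indicator i l))) (∑-indicator K i (λ _ → 1) i<K))) ,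
      λ v → trans (∑-cong K λ l _ → *-distribʳ-+ (δ (home l) v) (indicator i l) (e l))
        (trans (∑-distrib-+ K (λ l → indicator i l * δ (home l) v) (λ l → e l * δ (home l) v)) (cong (_+ spread K home e v) (∑-indicator K i (λ l → δ (home l) v) i<K)))

    module _ (B : ℕ)
      (one-step : ∀ c → B < size r c → Advance Home (4 * d) r g c)
      (cheap-step : ∀ c → B + 4 * d < size r c → Advance Home (2 * d) r g c) where

      -- What the chain must hold while `t` pebbles are still to be brought. Every delivery but the
      -- last takes at most `4 * d`; after the last one nothing has to remain, whence the trivial
      -- case 0.
      Stock : ℕ → Content → Set
      Stock zero    c = ⊤
      Stock (suc t) c = suc B + t * (4 * d) ≤ size r c

      bring : ∀ t c e w → Home w → Stock t c → 4 * d ≤ t + ∑ K e → chain r g c ⊕ spread K home e ⇝ 1 · w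
      bring zero c e w Hw _ enough = weaken (λ v → m≤n+m _ (chain r g c v)) (home-reach e w Hw enough)
      bring (suc t) c e w Hw stock enough = continue (step-for t stock)
        where
        StepFor : ℕ → Set
        StepFor t = ∃[ κ ] Σ (Advance Home κ r g c) λ A → Stock t (λ j l → c j l ∸ Advance.used A j l)
        step-for : ∀ t → Stock (suc t) c → StepFor t
        -- The last delivery uses the sharp classification, and its cost of up to `8 * d` does not
        -- matter.
        step-for zero    st = 4 * d , one-step c (≤-trans (≤-reflexive (sym (+-identityʳ (suc B)))) st) , tt
        step-for (suc t) st = 2 * d , A ,
          linear 0 (st ⊞ Advance.cost A ⊞ ≤-reflexive (split-amount c (Advance.used A) r (Advance.used≤ A)))
            (identity B t d (size r c) (size r (Advance.used A)) _)
          where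
          A : Advance Home (2 * d) r g c
          A = cheap-step c (≤-trans (s≤s (+-monoʳ-≤ B (m≤m+n (4 * d) (t * (4 * d))))) st)
          identity : ∀ B t d S S₁ S₂ →
            suc B + t * (4 * d) + (S + (2 * (2 * d) + (S₁ + S₂))) + 0 ≡ S₂ + (suc B + suc t * (4 * d) + (S₁ + S))
          identity = solve-∀
        continue : StepFor t → chain r g c ⊕ spread K home e ⇝ 1 · w
        continue (_ , advancing c₁ c₁≤c _ x Hx s , stock′) with arrive e Hx
        ... | e′ , ∑e′ , e′-spread =
          weaken (≡⇒≼ λ v → trans (sym (+-assoc (chain r g c₁ v) (chain r g c₂ v) (spread K home e v)))
                                (cong (_+ spread K home e v) (sym (split-chain r g c c₁ c₁≤c v))))
          (⇝-trans (frame (chain r g c₂ ⊕ spread K home e) s)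
          (weaken (≡⇒≼ λ v → trans (cong (chain r g c₂ v +_) (e′-spread v)) (shape (δ x v) (chain r g c₂ v) (spread K home e v)))
            (bring t c₂ e′ w Hw stock′ (≤-trans enough (≤-reflexive (trans (sym (+-suc t _)) (cong (t +_) (sym ∑e′))))))))
          where
          c₂ : Content
          c₂ j l = c j l ∸ c₁ j l
          shape : ∀ x b y → b + (x + y) ≡ 1 * x + (b + y)
          shape = solve-∀

      -- The hypothesis asks for B + 1 + (4d − 1)4d pebbles; the subtraction is moved to the right.
      gather : ∀ c e w → Home w → suc B + (4 * d) * (4 * d) ≤ size r c + ∑ K e + 4 * d →
        chain r g c ⊕ spread K home e ⇝ 1 · w
      gather c e w Hw enough with 4 * d ≤? ∑ K e
      ... | yes q = bring 0 c e w Hw tt q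
      ... | no ¬q = bring (suc t) c e w Hw stock (≤-reflexive (sym t+))
        where
        t : ℕ
        t = 4 * d ∸ suc (∑ K e)
        t+ : suc t + ∑ K e ≡ 4 * d
        t+ = trans (sym (+-suc t (∑ K e))) (m∸n+n≡m (≰⇒> ¬q))
        -- A pebble already on the cycle saves a delivery of `4 * d` pebbles, so an empty cycle is
        -- the worst case.
        s≤sY : ∑ K e ≤ ∑ K e * (4 * d)
        s≤sY = ≤-trans (≤-reflexive (sym (*-identityʳ (∑ K e)))) (*-monoʳ-≤ (∑ K e) (≤-trans (m^n>0 2 k₁) (m≤m+n d _)))
        identity : ∀ B t s Y S → suc B + t * Y + (S + s + Y + s * Y) + 0 ≡ S + (suc B + (suc t + s) * Y + s)
        identity = solve-∀
        stock : suc B + t * (4 * d) ≤ size r c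
        stock = linear 0
          (≤-trans (≤-reflexive (cong (λ x → suc B + x * (4 * d)) t+)) enough ⊞ s≤sY)
          (identity B t (∑ K e) (4 * d) (size r c))

-- Upper bound for the Jahangir graph

module JahangirUpper (k₁ R : ℕ) where

  k n d r m N : ℕ
  k = suc k₁
  n = k + k
  d = 2 ^ k₁
  r = suc R
  m = suc r
  N = n * m

  J : Graph
  J = jahangir n m

  open Paths J
  open Sectors J zero k₁ hiding (k; n; d)

  2≤N : 2 ≤ N
  2≤N = *-mono-≤ {2} {n} {1} {m} (s≤s (≤-trans (s≤s z≤n) (m≤n+m k k₁))) (s≤s z≤n)

  ring : ℕ → V
  ring l = suc (l mod N)

  ring-period : ∀ l → ring (N + l) ≡ ring l
  ring-period l = cong suc (mod-period N l)

  rim-at : ℕ → ℕ → V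
  rim-at b l = ring (b * n + l)

  ring-rim : ∀ b → Rim (rim-at b)
  ring-rim b .Rim.next l = subst (λ x → CycleAdj N ((b * n + l) mod N) (x mod N)) (sym (+-suc (b * n) l))
    (Next⇒CycleAdj 2≤N (Next-mod N (b * n + l)))
  ring-rim b .Rim.spoke j = (b + j) mod m , (begin
    toℕ ((b * n + j * n) mod N)   ≡⟨ toℕ-mod (b * n + j * n) N ⟩
    (b * n + j * n) % N           ≡⟨ cong (_% N) (sym (*-distribʳ-+ n b j)) ⟩
    ((b + j) * n) % (n * m)       ≡⟨ %-congʳ {m = n * m} {n = m * n} {o = (b + j) * n} (*-comm n m) ⟩
    ((b + j) * n) % (m * n)       ≡⟨ m%n*o≡m*o%[n*o] (b + j) m n ⟨
    (b + j) % m * n               ≡⟨ *-comm _ n ⟩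
    n * ((b + j) % m)             ≡⟨ cong (n *_) (toℕ-mod (b + j) m) ⟨
    n * toℕ ((b + j) mod m)       ∎)
    where open ≡-Reasoning

  r*n+n : ∀ b l → b * n + (r * n + n + l) ≡ N + (b * n + l)
  r*n+n b l = shape n r b l
    where
    shape : ∀ n r b l → b * n + (r * n + n + l) ≡ n * suc r + (b * n + l)
    shape = solve-∀

  ring-closed : ∀ b → rim-at b (r * n + n) ≡ rim-at b 0
  ring-closed b = trans (cong ring (trans (cong (b * n +_) (sym (+-identityʳ _))) (r*n+n b 0))) (ring-period (b * n + 0))

  module Gather (b : ℕ) = ClosedChain J zero k₁ R (rim-at b)

  home-at : ∀ w → ∃[ b ] Gather.Home b w
  home-at zero    = 0 , Gather.Home-hub 0 (ring-rim 0) (ring-closed 0)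
  -- The chain starts one sector after the target's, so the sector that closes it after `r` others
  -- is the target's own.
  home-at (suc i) = suc q , l , l<K , trans (Gather.home-≤ (suc q) (<⇒≤ l<n)) (trans (cong ring index) (trans (ring-period (toℕ i)) (cong suc (mod-toℕ N i))))
    where
    q l : ℕ
    q = toℕ i / n
    l = toℕ i % n
    l<n : l < n
    l<n = m%n<n (toℕ i) n
    l<K : l < suc k + suc k
    l<K = <-≤-trans l<n (+-mono-≤ (n≤1+n k) (n≤1+n k))
    shape : ∀ n r q l → suc q * n + (r * n + l) ≡ n * suc r + (l + q * n)
    shape = solve-∀
    index : suc q * n + (r * n + l) ≡ N + toℕ i
    index = trans (shape n r q l) (cong (N +_) (sym (m≡m%n+[m/n]*n (toℕ i) n)))

  module _ (D : Distribution J) where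

    contents : (ℕ → V) → Content
    contents g zero    = pad n (lookup D ∘ g)
    contents g (suc j) = contents (g ∘ (n +_)) j

    chain-contents : ∀ s g v → chain s g (contents g) v ≡ ∑ (s * n) (λ l → lookup D (g l) * δ (g l) v)
    chain-contents zero    g v = refl
    chain-contents (suc s) g v = trans
      (cong₂ _+_ (∑-pad n (lookup D ∘ g) (λ l → δ (g l) v)) (chain-contents s (g ∘ (n +_)) v))
      (sym (∑-split n (s * n) (λ l → lookup D (g l) * δ (g l) v)))

    size-contents : ∀ s g → size s (contents g) ≡ ∑ (s * n) (lookup D ∘ g)
    size-contents zero    g = refl
    size-contents (suc s) g = trans
      (cong₂ _+_ (trans (∑-cong (suc n) λ l _ → sym (*-identityʳ (pad n (lookup D ∘ g) l)))
                   (trans (∑-pad n (lookup D ∘ g) (λ _ → 1)) (∑-cong n λ l _ → *-identityʳ (lookup D (g l)))))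
                 (size-contents s (g ∘ (n +_))))
      (sym (∑-split n (s * n) (lookup D ∘ g)))

    module _ (b : ℕ) where
      open Gather b using (home; home-≤; home->; K≡)

      g : ℕ → V
      g = rim-at b

      home-content : ℕ → ℕ
      home-content l with l <? n | l ≤? n
      ... | yes _ | _     = lookup D (g (r * n + l))
      -- Position `n` is the spoke `g 0`, whose pebbles already belong to the first sector of the
      -- chain.
      ... | no _  | yes _ = 0
      ... | no _  | no _  = lookup D zero

      home-content-< : ∀ {l} → l < n → home-content l ≡ lookup D (g (r * n + l))
      home-content-< {l} h with l <? n | l ≤? n
      ... | yes _ | _ = refl
      ... | no ¬h | _ = contradiction h ¬h

      home-content-n : home-content n ≡ 0
      home-content-n with n <? n | n ≤? n
      ... | yes h | _     = contradiction h (<-irrefl refl)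
      ... | no _  | yes _ = refl
      ... | no _  | no ¬h = contradiction ≤-refl ¬h

      home-content-hub : home-content (suc n) ≡ lookup D zero
      home-content-hub with suc n <? n | suc n ≤? n
      ... | yes h | _     = contradiction h (<-asym (n<1+n n))
      ... | no _  | yes h = contradiction h (<⇒≱ ≤-refl)
      ... | no _  | no _  = refl

      home-sum : ∀ (f : V → ℕ) →
        ∑ (suc k + suc k) (λ l → home-content l * f (home l)) ≡ ∑ n (λ l → lookup D (g (r * n + l)) * f (g (r * n + l))) + lookup D zero * f zero
      home-sum f = begin
        ∑ (suc k + suc k) F                     ≡⟨ cong (λ x → ∑ x F) K≡ ⟩
        ∑ (suc (suc n)) F                       ≡⟨ ∑-last (suc n) F ⟩
        ∑ (suc n) F + F (suc n)                 ≡⟨ cong₂ _+_ (∑-last n F) (cong₂ _*_ home-content-hub (cong f (home-> {suc n} ≤-refl))) ⟩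
        ∑ n F + F n + lookup D zero * f zero    ≡⟨ cong (_+ lookup D zero * f zero) (trans (cong (∑ n F +_) (cong (_* f (home n)) home-content-n)) (+-identityʳ (∑ n F))) ⟩
        ∑ n F + lookup D zero * f zero          ≡⟨ cong (_+ lookup D zero * f zero) (∑-cong n λ l l<n → cong₂ _*_ (home-content-< l<n) (cong f (home-≤ (<⇒≤ l<n)))) ⟩
        ∑ n (λ l → lookup D (g (r * n + l)) * f (g (r * n + l))) + lookup D zero * f zero ∎
        where
        open ≡-Reasoning
        F : ℕ → ℕ
        F l = home-content l * f (home l)

      around : ∀ (f : V → ℕ) → ∑ (r * n) (f ∘ g) + ∑ n (λ l → f (g (r * n + l))) ≡ ∑ N (f ∘ ring)
      around f = begin
        ∑ (r * n) (f ∘ g) + ∑ n (λ l → f (g (r * n + l)))  ≡⟨ ∑-split (r * n) n (f ∘ g) ⟨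
        ∑ (r * n + n) (f ∘ g)                              ≡⟨ cong (λ x → ∑ x (f ∘ g)) (trans (+-comm (r * n) n) (*-comm m n)) ⟩
        ∑ N (f ∘ ring ∘ (b * n +_))                        ≡⟨ ∑-rotate N (f ∘ ring) (λ l → cong f (ring-period l)) (b * n) ⟩
        ∑ N (f ∘ ring)                                     ∎
        where open ≡-Reasoning

      sum-ring : ∑ N (lookup D ∘ ring) + lookup D zero ≡ sum D
      sum-ring = sum-cons D
        where
        sum-cons : ∀ (D : Vec ℕ (suc N)) → ∑ N (lookup D ∘ ring) + lookup D zero ≡ sum D
        sum-cons (x ∷ D) = trans (cong (_+ x) (sum-mod D)) (+-comm (sum D) x)

      total : size r (contents g) + ∑ (suc k + suc k) home-content ≡ sum D
      total = begin
        size r (contents g) + ∑ (suc k + suc k) home-content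
          ≡⟨ cong₂ _+_ (size-contents r g) (trans (∑-cong (suc k + suc k) λ l _ → sym (*-identityʳ (home-content l))) (home-sum (λ _ → 1))) ⟩
        ∑ (r * n) (lookup D ∘ g) + (∑ n (λ l → lookup D (g (r * n + l)) * 1) + lookup D zero * 1)
          ≡⟨ cong (∑ (r * n) (lookup D ∘ g) +_) (cong₂ _+_ (∑-cong n λ l _ → *-identityʳ (lookup D (g (r * n + l)))) (*-identityʳ (lookup D zero))) ⟩
        ∑ (r * n) (lookup D ∘ g) + (∑ n (λ l → lookup D (g (r * n + l))) + lookup D zero)
          ≡⟨ +-assoc (∑ (r * n) (lookup D ∘ g)) _ _ ⟨
        ∑ (r * n) (lookup D ∘ g) + ∑ n (λ l → lookup D (g (r * n + l))) + lookup D zero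
          ≡⟨ cong (_+ lookup D zero) (around (lookup D)) ⟩
        ∑ N (lookup D ∘ ring) + lookup D zero
          ≡⟨ sum-ring ⟩
        sum D ∎
        where open ≡-Reasoning

      covered : chain r g (contents g) ⊕ spread (suc k + suc k) home home-content ≼ lookup D
      covered v = ≤-reflexive (begin
        chain r g (contents g) v + spread (suc k + suc k) home home-content v
          ≡⟨ cong₂ _+_ (chain-contents r g v) (home-sum (λ x → δ x v)) ⟩
        ∑ (r * n) (F ∘ g) + (∑ n (λ l → F (g (r * n + l))) + F zero)
          ≡⟨ +-assoc (∑ (r * n) (F ∘ g)) _ _ ⟨
        ∑ (r * n) (F ∘ g) + ∑ n (λ l → F (g (r * n + l))) + F zero
          ≡⟨ cong (_+ F zero) (around F) ⟩
        ∑ N (F ∘ ring) + F zero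
          ≡⟨ single v ⟩
        lookup D v ∎)
        where
        open ≡-Reasoning
        F : V → ℕ
        F x = lookup D x * δ x v
        absent : ∀ {x v : V} → x ≢ v → lookup D x * δ x v ≡ 0
        absent {x} x≢v = trans (cong (lookup D x *_) (δ-≢ x≢v)) (*-zeroʳ (lookup D x))
        present : ∀ v → lookup D v * δ v v ≡ lookup D v
        present v = trans (cong (lookup D v *_) (δ-refl v)) (*-identityʳ (lookup D v))
        single : ∀ v → ∑ N (λ l → lookup D (ring l) * δ (ring l) v) + lookup D zero * δ zero v ≡ lookup D v
        single zero    = cong₂ _+_ (∑-zero N {λ l → lookup D (ring l) * δ (ring l) zero} λ l _ → absent {ring l} {zero} λ ()) (present zero)
        single (suc i) = trans (cong₂ _+_
          (trans (∑-mod-single N (λ x → lookup D (suc x) * δ (suc x) (suc i)) i λ x x≢i → absent (x≢i ∘ Fin.suc-injective)) (present (suc i)))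
          (absent {zero} {suc i} λ ())) (+-identityʳ _)

  gap : ℕ
  gap = 3 * d ∸ suc (2 * third k)

  1≤d : 1 ≤ d
  1≤d = m^n>0 2 k₁

  M≤3d : suc (2 * third k) ≤ 3 * d
  M≤3d = *-cancelˡ-≤ 3 (linear 0 (2 ⊠ third< k ⊞ 1≤d) (identity d (third k)))
    where
    identity : ∀ d t → 3 * suc (2 * t) + (2 * (2 * (2 * d)) + d) + 0 ≡ 3 * (3 * d) + (2 * suc (3 * t) + 1)
    identity = solve-∀

  gap+ : suc (2 * third k) + gap ≡ 3 * d
  gap+ = m+[n∸m]≡n M≤3d

  gap≤d : gap ≤ d
  gap≤d = m≤n+o⇒m∸n≤o (3 * d) (suc (2 * third k)) (*-cancelˡ-≤ 3 (linear 1 (2 ⊠ third> k ⊞ 2 ⊠ 1≤d) (identity d (third k))))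
    where
    identity : ∀ d t → 3 * (3 * d) + (2 * (2 + 3 * t) + 2 * d) + 1 ≡ 3 * (suc (2 * t) + d) + (2 * (2 * (2 * d)) + 2 * 1)
    identity = solve-∀

  -- A blocked chain holds at most `B` pebbles by the sharp classification and at most `B + 4 * d`
  -- by the coarse one; these are the two inequalities.
  suffices : ∀ B p → 3 * d * r ≤ B + r + debt gap r false + d → 3 * d * r ≤ B + 4 * d + r + d →
    p + 4 * d ≡ suc B + 4 * d * (4 * d) → Suffices J 1 p
  suffices B p exact cheap p≡ D sum≡p w with home-at w
  ... | b , Hw = reach D (covered D b)
      (Gather.gather b (ring-rim b) (ring-closed b) B one-step cheap-step (contents D (g D b)) (home-content D b) w Hw
        (≤-reflexive (trans (sym p≡) (cong (_+ 4 * d) (sym (trans (total D b) sum≡p))))))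
    where
    open Gather b using (Home; Home-hub; Home-start; Home-end)
    R-hub : Home zero
    R-hub = Home-hub (ring-rim b) (ring-closed b)
    R-start : Home (rim-at b 0)
    R-start = Home-start (ring-rim b) (ring-closed b)
    R-end : Home (rim-at b (r * n))
    R-end = Home-end (ring-rim b) (ring-closed b)
    one-step : ∀ c → B < size r c → Advance Home (4 * d) r (rim-at b) c
    one-step c B< = chain-advance Home R-hub (4 * d) (suc (2 * third k)) gap gap+ gap≤d classify-exact R (ring-rim b) R-start R-end c
      (≤-<-trans exact (+-monoˡ-< d (+-monoˡ-< _ (+-monoˡ-< r B<))))
    cheap-step : ∀ c → B + 4 * d < size r c → Advance Home (2 * d) r (rim-at b) c
    cheap-step c B< = chain-advance Home R-hub (2 * d) (3 * d) 0 (+-identityʳ (3 * d)) z≤n classify-cheap R (ring-rim b) R-start R-end c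
      (≤-<-trans cheap (+-monoˡ-< d (<-≤-trans (+-monoˡ-< r B<) (m≤m+n _ _))))

-- Lower bound: weights on intervals of the rim

opaque

  within : ℕ → ℕ → ℕ → ℕ
  within b e p with b <? p | p ≤? e
  ... | yes _ | yes _ = 1
  ... | _     | _     = 0

  within-in : ∀ {b e p} → b < p → p ≤ e → within b e p ≡ 1
  within-in {b} {e} {p} b<p p≤e with b <? p | p ≤? e
  ... | yes _ | yes _ = refl
  ... | yes _ | no ¬h = contradiction p≤e ¬h
  ... | no ¬h | _     = contradiction b<p ¬h

  within-below : ∀ {b e p} → p ≤ b → within b e p ≡ 0
  within-below {b} {e} {p} p≤b with b <? p | p ≤? e
  ... | yes h | _ = contradiction p≤b (<⇒≱ h)
  ... | no _  | _ = refl

  within-above : ∀ {b e p} → e < p → within b e p ≡ 0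
  within-above {b} {e} {p} e<p with b <? p | p ≤? e
  ... | _     | yes h = contradiction h (<⇒≱ e<p)
  ... | yes _ | no _  = refl
  ... | no _  | no _  = refl

within-split : ∀ {b e} → b ≤ e → ∀ p → within 0 e p ≡ within 0 b p + within b e p
within-split {b} {e} b≤e p = cases (0 <? p) (p ≤? b) (p ≤? e)
  where
  cases : Dec (0 < p) → Dec (p ≤ b) → Dec (p ≤ e) → within 0 e p ≡ within 0 b p + within b e p
  cases (no ¬0<p) _ _ = trans (within-below (≮⇒≥ ¬0<p))
    (sym (cong₂ _+_ (within-below {0} {b} (≮⇒≥ ¬0<p)) (within-below {b} {e} (≤-trans (≮⇒≥ ¬0<p) z≤n))))
  cases (yes 0<p) (yes p≤b) _ = trans (within-in 0<p (≤-trans p≤b b≤e))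
    (sym (cong₂ _+_ (within-in 0<p p≤b) (within-below {b} {e} p≤b)))
  cases (yes 0<p) (no p≰b) (yes p≤e) = trans (within-in 0<p p≤e)
    (sym (cong₂ _+_ (within-above {0} {b} (≰⇒> p≰b)) (within-in (≰⇒> p≰b) p≤e)))
  cases (yes 0<p) (no p≰b) (no p≰e) = trans (within-above {0} {e} (≰⇒> p≰e))
    (sym (cong₂ _+_ (within-above {0} {b} (≰⇒> p≰b)) (within-above {b} {e} (≰⇒> p≰e))))

opaque

  hit : ℕ → ℕ → ℕ → ℕ → ℕ
  hit i p j q = indicator i p * indicator j q

  hit-0ˡ : ∀ {i p j q} → i ≢ p → hit i p j q ≡ 0
  hit-0ˡ {j = j} {q} h = cong (_* indicator j q) (indicator-≢ h)

  hit-0ʳ : ∀ {i p j q} → j ≢ q → hit i p j q ≡ 0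
  hit-0ʳ {i} {p} h = trans (cong (indicator i p *_) (indicator-≢ h)) (*-zeroʳ (indicator i p))

  hit-1 : ∀ {i j} → hit i i j j ≡ 1
  hit-1 {i} {j} = cong₂ _*_ (indicator-refl i) (indicator-refl j)

opaque

  -- For `c ≤ c′` at most one of the differences is nonzero, and this is 2^(distance to the interval
  -- from `c` to `c′`). Equal arguments describe a sector with one stack, consecutive ones the
  -- intermediate sector with two.
  peak : ℕ → ℕ → ℕ → ℕ
  peak c c′ p = 2 ^ ((c ∸ p) + (p ∸ c′))

  peak-up : ∀ c c′ p → peak c c′ (suc p) ≤ 2 * peak c c′ p
  peak-up c c′ p = pow-mono (≤-trans (+-mono-≤ (∸-monoʳ-≤ c (n≤1+n p)) (suc-∸ p c′)) (≤-reflexive (+-suc (c ∸ p) (p ∸ c′))))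
    where
    suc-∸ : ∀ p c → suc p ∸ c ≤ suc (p ∸ c)
    suc-∸ p zero = ≤-refl
    suc-∸ zero (suc c) = ≤-trans (≤-reflexive (0∸n≡0 c)) z≤n
    suc-∸ (suc p) (suc c) = suc-∸ p c

  peak-down : ∀ c c′ p → peak c c′ p ≤ 2 * peak c c′ (suc p)
  peak-down c c′ p = pow-mono (+-mono-≤ (∸-suc c p) (∸-monoˡ-≤ c′ (n≤1+n p)))
    where
    ∸-suc : ∀ c p → c ∸ p ≤ suc (c ∸ suc p)
    ∸-suc zero p = ≤-trans (≤-reflexive (0∸n≡0 p)) z≤n
    ∸-suc (suc c) zero = ≤-refl
    ∸-suc (suc c) (suc p) = ∸-suc c p

  peak-left : ∀ {c c′ p} a → p ≤ c′ → c ≡ p + a → peak c c′ p ≡ 2 ^ a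
  peak-left {c} {c′} {p} a p≤c′ c≡ = cong (2 ^_) (trans (cong₂ _+_ (trans (cong (_∸ p) c≡) (m+n∸m≡n p a)) (m≤n⇒m∸n≡0 p≤c′)) (+-identityʳ a))

  peak-right : ∀ {c c′ p} a → c ≤ p → p ≡ c′ + a → peak c c′ p ≡ 2 ^ a
  peak-right {c} {c′} {p} a c≤p p≡ = cong (2 ^_) (cong₂ _+_ (m≤n⇒m∸n≡0 c≤p) (trans (cong (_∸ c′) p≡) (m+n∸m≡n c′ a)))

module JahangirLower (k₁ r : ℕ) where

  k n n₁ m N : ℕ
  k  = suc k₁
  n₁ = k₁ + k
  n  = k + k
  m  = suc r
  N  = n * m

  J : Graph
  J = jahangir n m

  open Tally J

  lift : ℕ → (ℕ → ℕ) → V → ℕ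
  lift x F zero    = x
  lift x F (suc i) = F (toℕ i)

  edge : ℕ → ℕ → V → V → ℕ
  edge p q (suc i) (suc j) = hit p (toℕ i) q (toℕ j)
  edge p q _       _       = 0

  toHub fromHub : ℕ → ℕ → V → V → ℕ
  toHub b e (suc i) zero = within b e (toℕ i)
  toHub b e _       _    = 0
  fromHub b e zero (suc j) = within b e (toℕ j)
  fromHub b e _    _       = 0

  module Block (b e : ℕ) (b<e : b < e) (e<N : suc e < N) (φ : ℕ → ℕ) (ψin ψout : ℕ)
    (up : ∀ p → φ (suc p) ≤ 2 * φ p) (down : ∀ p → φ p ≤ 2 * φ (suc p))
    (hub-in : ∀ i → b < n * i → n * i ≤ e → φ (n * i) ≤ ψin)
    (hub-out : ∀ i → b < n * i → n * i ≤ e → ψout ≤ 2 * φ (n * i)) where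

    weight : V → ℕ
    weight = lift 0 (λ p → within b e p * φ p)

    -- Leaving through an end destroys two pebbles of the weight of that end, and entering creates
    -- one: hence the coefficients `2 * φ` and `φ`. On the spokes, `ψout` and `ψin` play these roles
    -- for moves to and from the hub.
    κ⁻ κ⁺ : V → V → ℕ
    κ⁻ x y = 2 * φ (suc b) * edge (suc b) b x y + 2 * φ e * edge e (suc e) x y + ψout * toHub b e x y
    κ⁺ x y = φ (suc b) * edge b (suc b) x y + φ e * edge (suc e) e x y + ψin * fromHub b e x y

    -- The parameters stand for values of indicators, so that `transfer` can replace them by 0 and 1
    -- in each local case.
    record Ineq (φp φq w w′ α₁ α₂ β₁ β₂ : ℕ) : Set where
      constructor ineq
      field
        holds : w′ * φq + (2 * φ (suc b) * α₁ + 2 * φ e * α₂ + ψout * 0) ≤ 2 * (w * φp) + (φ (suc b) * β₁ + φ e * β₂ + ψin * 0)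
    open Ineq

    Local : ℕ → ℕ → Set
    Local p q = Ineq (φ p) (φ q) (within b e p) (within b e q)
      (hit (suc b) p b q) (hit e p (suc e) q)
      (hit b p (suc b) q) (hit (suc e) p e q)

    transfer : ∀ {φp φq w w′ α₁ α₂ β₁ β₂ v v′ γ₁ γ₂ η₁ η₂} → w ≡ v → w′ ≡ v′ → α₁ ≡ γ₁ → α₂ ≡ γ₂ → β₁ ≡ η₁ → β₂ ≡ η₂ →
      Ineq φp φq v v′ γ₁ γ₂ η₁ η₂ → Ineq φp φq w w′ α₁ α₂ β₁ β₂
    transfer refl refl refl refl refl refl h = h

    outside : ∀ {p q} → within b e q ≡ 0 → hit (suc b) p b q ≡ 0 → hit e p (suc e) q ≡ 0 → Local p q
    outside {p} {q} h₁ h₂ h₃ = transfer refl h₁ h₂ h₃ refl refl (ineq (≤-trans (≤-reflexive (identity (φ q) (φ (suc b)) (φ e) ψout)) z≤n))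
      where
      identity : ∀ x a b c → 0 * x + (2 * a * 0 + 2 * b * 0 + c * 0) ≡ 0
      identity = solve-∀

    inside : ∀ {p q} → within b e p ≡ 1 → within b e q ≡ 1 → φ q ≤ 2 * φ p →
      hit (suc b) p b q ≡ 0 → hit e p (suc e) q ≡ 0 → Local p q
    inside {p} {q} h₁ h₂ h h₃ h₄ = transfer h₁ h₂ h₃ h₄ refl refl
      (ineq (≤-trans (linear 0 h (identity (φ p) (φ q) (φ (suc b)) (φ e) ψout)) (m≤m+n (2 * (1 * φ p)) _)))
      where
      identity : ∀ x y a b c → 1 * y + (2 * a * 0 + 2 * b * 0 + c * 0) + 2 * x + 0 ≡ 2 * (1 * x) + y
      identity = solve-∀

    enter-left : Local b (suc b)
    enter-left = transfer refl (within-in ≤-refl b<e) (hit-0ˡ 1+n≢n) (hit-0ˡ (>⇒≢ b<e)) hit-1 refl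
      (ineq (linear _ z≤n (identity (φ (suc b)) (φ e) ψout ψin (2 * (within b e b * φ b)) _)))
      where
      identity : ∀ a b c i W β → 1 * a + (2 * a * 0 + 2 * b * 0 + c * 0) + 0 + (W + b * β) ≡ W + (a * 1 + b * β + i * 0) + 0
      identity = solve-∀

    leave-left : Local (suc b) b
    leave-left = transfer (within-in ≤-refl b<e) (within-below ≤-refl) hit-1 (hit-0ʳ (>⇒≢ (s≤s (<⇒≤ b<e)))) refl refl
      (ineq (linear _ z≤n (identity (φ b) (φ (suc b)) (φ e) ψout ψin _ _)))
      where
      identity : ∀ x a b c i β₁ β₂ → 0 * x + (2 * a * 1 + 2 * b * 0 + c * 0) + 0 + (a * β₁ + b * β₂) ≡ 2 * (1 * a) + (a * β₁ + b * β₂ + i * 0) + 0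
      identity = solve-∀

    leave-right : Local e (suc e)
    leave-right = transfer (within-in b<e ≤-refl) (within-above ≤-refl) (hit-0ʳ (<⇒≢ (m<n⇒m<1+n b<e))) hit-1 refl refl
      (ineq (linear _ z≤n (identity (φ (suc e)) (φ (suc b)) (φ e) ψout ψin _ _)))
      where
      identity : ∀ x a b c i β₁ β₂ → 0 * x + (2 * a * 0 + 2 * b * 1 + c * 0) + 0 + (a * β₁ + b * β₂) ≡ 2 * (1 * b) + (a * β₁ + b * β₂ + i * 0) + 0
      identity = solve-∀

    enter-right : Local (suc e) e
    enter-right = transfer refl (within-in b<e ≤-refl) (hit-0ʳ (<⇒≢ b<e)) (hit-0ʳ 1+n≢n) refl hit-1
      (ineq (linear _ z≤n (identity (φ (suc b)) (φ e) ψout ψin (2 * (within b e (suc e) * φ (suc e))) _)))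
      where
      identity : ∀ a b c i W β → 1 * b + (2 * a * 0 + 2 * b * 0 + c * 0) + 0 + (W + a * β) ≡ W + (a * β + b * 1 + i * 0) + 0
      identity = solve-∀

    local-up : ∀ p → Local p (suc p)
    local-up p with <-cmp p b | <-cmp p e
    ... | tri≈ _ refl _ | _ = enter-left
    ... | tri< p<b _ _ | _ = outside (within-below p<b) (hit-0ˡ (>⇒≢ (m<n⇒m<1+n p<b))) (hit-0ˡ (>⇒≢ (<-trans p<b b<e)))
    ... | tri> _ _ b<p | tri< p<e _ _ = inside (within-in b<p (<⇒≤ p<e)) (within-in (m<n⇒m<1+n b<p) p<e) (up p)
            (hit-0ʳ (<⇒≢ (m<n⇒m<1+n b<p))) (hit-0ˡ (>⇒≢ p<e))
    ... | tri> _ _ b<p | tri≈ _ refl _ = leave-right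
    ... | tri> _ _ b<p | tri> _ _ e<p = outside (within-above (m<n⇒m<1+n e<p)) (hit-0ʳ (<⇒≢ (m<n⇒m<1+n b<p))) (hit-0ˡ (<⇒≢ e<p))

    local-down : ∀ p → Local (suc p) p
    local-down p with <-cmp p b | <-cmp p e
    ... | tri≈ _ refl _ | _ = leave-left
    ... | tri< p<b _ _ | _ = outside (within-below (<⇒≤ p<b)) (hit-0ʳ (>⇒≢ p<b)) (hit-0ʳ (>⇒≢ (<-trans p<b (m<n⇒m<1+n b<e))))
    ... | tri> _ _ b<p | tri< p<e _ _ = inside (within-in (m<n⇒m<1+n b<p) p<e) (within-in b<p (<⇒≤ p<e)) (down p)
            (hit-0ʳ (<⇒≢ b<p)) (hit-0ʳ (>⇒≢ (m<n⇒m<1+n p<e)))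
    ... | tri> _ _ b<p | tri≈ _ refl _ = enter-right
    ... | tri> _ _ b<p | tri> _ _ e<p = outside (within-above e<p) (hit-0ʳ (<⇒≢ b<p)) (hit-0ˡ (<⇒≢ (m<n⇒m<1+n e<p)))

    local-wrap : ∀ {p} → suc p ≡ N → Local p 0 × Local 0 p
    local-wrap {p} refl =
      outside (within-below z≤n) (hit-0ˡ (<⇒≢ (≤-<-trans b<e (≤-pred e<N)))) (hit-0ˡ (<⇒≢ (≤-pred e<N))) ,
      outside (within-above (≤-pred e<N)) (hit-0ˡ 1+n≢0) (hit-0ˡ (>⇒≢ (≤-<-trans z≤n b<e)))

    from-hub : ∀ p i → p ≡ n * i → within b e p * φ p ≤ ψin * within b e p
    from-hub p i refl with b <? p | p ≤? e
    ... | yes b<p | yes p≤e rewrite within-in b<p p≤e =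
      ≤-trans (≤-reflexive (*-identityˡ _)) (≤-trans (hub-in i b<p p≤e) (≤-reflexive (sym (*-identityʳ ψin))))
    ... | yes _   | no p≰e  rewrite within-above {b} (≰⇒> p≰e) = z≤n
    ... | no b≮p  | _       rewrite within-below {b} {e} (≮⇒≥ b≮p) = z≤n

    to-hub : ∀ p i → p ≡ n * i → ψout * within b e p ≤ 2 * (within b e p * φ p)
    to-hub p i refl with b <? p | p ≤? e
    ... | yes b<p | yes p≤e rewrite within-in b<p p≤e =
      ≤-trans (≤-reflexive (*-identityʳ ψout)) (≤-trans (hub-out i b<p p≤e) (≤-reflexive (cong (2 *_) (sym (*-identityˡ (φ p))))))
    ... | yes _   | no p≰e  rewrite within-above {b} (≰⇒> p≰e) = ≤-reflexive (*-zeroʳ ψout)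
    ... | no b≮p  | _       rewrite within-below {b} {e} (≮⇒≥ b≮p) = ≤-reflexive (*-zeroʳ ψout)

    adjacent : ∀ x y → Adj J x y → weight y + κ⁻ x y ≤ 2 * weight x + κ⁺ x y
    adjacent zero (suc j) (i , eq) = linear 0 (from-hub (toℕ j) (toℕ i) eq)
        (identity (within b e (toℕ j) * φ (toℕ j)) (φ (suc b)) (φ e) ψout (ψin * within b e (toℕ j)))
      where
      identity : ∀ w a b c x → w + (2 * a * 0 + 2 * b * 0 + c * 0) + x + 0 ≡ 2 * 0 + (a * 0 + b * 0 + x) + w
      identity = solve-∀
    adjacent (suc j) zero (i , eq) = linear 0 (to-hub (toℕ j) (toℕ i) eq)
        (identity (within b e (toℕ j) * φ (toℕ j)) (φ (suc b)) (φ e) ψin (ψout * within b e (toℕ j)))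
      where
      identity : ∀ w a b c x → 0 + (2 * a * 0 + 2 * b * 0 + x) + 2 * w + 0 ≡ 2 * w + (a * 0 + b * 0 + c * 0) + x
      identity = solve-∀
    adjacent (suc i) (suc j) (_ , inj₁ (inj₁ q)) rewrite q = holds (local-up (toℕ i))
    adjacent (suc i) (suc j) (_ , inj₂ (inj₁ q)) rewrite q = holds (local-down (toℕ j))
    adjacent (suc i) (suc j) (_ , inj₁ (inj₂ (q , z))) rewrite z = holds (proj₁ (local-wrap q))
    adjacent (suc i) (suc j) (_ , inj₂ (inj₂ (q , z))) rewrite z = holds (proj₂ (local-wrap q))

  module Counts {D D′ : Distribution J} (σ : Star (Move J) D D′) where

    →at ←at : ℕ → ℕ
    →at p = tally (edge p (suc p)) σ
    ←at p = tally (edge (suc p) p) σ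

    ↑hub ↓hub : ℕ → ℕ → ℕ
    ↑hub b e = tally (toHub b e) σ
    ↓hub b e = tally (fromHub b e) σ

    ↑hub-split : ∀ {b e} → b ≤ e → ↑hub 0 e ≡ ↑hub 0 b + ↑hub b e
    ↑hub-split {b} {e} b≤e = trans (tally-cong pointwise σ) (tally-+ (toHub 0 b) (toHub b e) σ)
      where
      pointwise : ∀ x y → toHub 0 e x y ≡ toHub 0 b x y + toHub b e x y
      pointwise zero    zero    = refl
      pointwise zero    (suc _) = refl
      pointwise (suc i) zero    = within-split b≤e (toℕ i)
      pointwise (suc _) (suc _) = refl

    ↓hub-split : ∀ {b e} → b ≤ e → ↓hub 0 e ≡ ↓hub 0 b + ↓hub b e
    ↓hub-split {b} {e} b≤e = trans (tally-cong pointwise σ) (tally-+ (fromHub 0 b) (fromHub b e) σ)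
      where
      pointwise : ∀ x y → fromHub 0 e x y ≡ fromHub 0 b x y + fromHub b e x y
      pointwise zero    zero    = refl
      pointwise zero    (suc j) = within-split b≤e (toℕ j)
      pointwise (suc _) zero    = refl
      pointwise (suc _) (suc _) = refl

    tally-3 : ∀ x y z κ₁ κ₂ κ₃ →
      tally (λ a b → x * κ₁ a b + y * κ₂ a b + z * κ₃ a b) σ ≡ x * tally κ₁ σ + y * tally κ₂ σ + z * tally κ₃ σ
    tally-3 x y z κ₁ κ₂ κ₃ = trans (tally-+ (λ a b → x * κ₁ a b + y * κ₂ a b) (λ a b → z * κ₃ a b) σ)
      (cong₂ _+_ (trans (tally-+ (λ a b → x * κ₁ a b) (λ a b → y * κ₂ a b) σ) (cong₂ _+_ (tally-* x κ₁ σ) (tally-* y κ₂ σ))) (tally-* z κ₃ σ))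

    block : ∀ b e → b < e → suc e < N → ∀ c c′ ψin ψout →
      (∀ i → b < n * i → n * i ≤ e → peak c c′ (n * i) ≤ ψin) →
      (∀ i → b < n * i → n * i ≤ e → ψout ≤ 2 * peak c c′ (n * i)) →
      ∀ {W} → weigh (lift 0 (λ p → within b e p * peak c c′ p)) D ≤ W →
      2 * peak c c′ (suc b) * ←at b + 2 * peak c c′ e * →at e + ψout * ↑hub b e ≤
      W + (peak c c′ (suc b) * →at b + peak c c′ e * ←at e + ψin * ↓hub b e)
    block b e b<e e<N c c′ ψin ψout hub-in hub-out {W} W≤ = begin
      2 * φ (suc b) * ←at b + 2 * φ e * →at e + ψout * ↑hub b e  ≡⟨ tally-3 (2 * φ (suc b)) (2 * φ e) ψout _ _ _ ⟨
      tally κ⁻ σ                                                 ≤⟨ m≤n+m _ _ ⟩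
      weigh weight D′ + tally κ⁻ σ                               ≤⟨ tally-bound weight κ⁻ κ⁺ adjacent σ ⟩
      weigh weight D + tally κ⁺ σ                                ≤⟨ +-mono-≤ W≤ (≤-reflexive (tally-3 (φ (suc b)) (φ e) ψin _ _ _)) ⟩
      W + (φ (suc b) * →at b + φ e * ←at e + ψin * ↓hub b e)     ∎
      where
      open ≤-Reasoning
      φ : ℕ → ℕ
      φ = peak c c′
      open Block b e b<e e<N φ ψin ψout (peak-up c c′) (peak-down c c′) hub-in hub-out

    module _ (z : ℕ) (1≤z : 1 ≤ z) (z+1 : suc z ≡ r * n) where

      -- On the cycle through the target, at `r * n + k`, this is 2 to the power `suc k` minus the
      -- distance to the target: 2 on the two spokes and, through `lift 1`, 1 on the hub. It is 0 on
      -- the rest of the chain, so only traffic across the boundary counts.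
      w₀ : ℕ → ℕ
      w₀ zero = 2
      w₀ (suc p) with suc p ≤? z
      ... | yes _ = 0
      ... | no  _ = 2 ^ (suc k ∸ ∣ suc p - (r * n + k) ∣)

      w₀-in : ∀ {p} → 0 < p → p ≤ z → w₀ p ≡ 0
      w₀-in {suc p} _ p≤z with suc p ≤? z
      ... | yes _ = refl
      ... | no ¬h = contradiction p≤z ¬h

      w₀-out : ∀ {p} → z < p → w₀ p ≡ 2 ^ (suc k ∸ ∣ p - (r * n + k) ∣)
      w₀-out {suc p} z<p with suc p ≤? z
      ... | yes h = contradiction h (<⇒≱ z<p)
      ... | no _  = refl

      w₀-pos : ∀ {p} → z < p → 1 ≤ w₀ p
      w₀-pos {p} z<p = ≤-trans (m^n>0 2 (suc k ∸ ∣ p - (r * n + k) ∣)) (≤-reflexive (sym (w₀-out z<p)))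

      w₀-end : w₀ (suc z) ≡ 2
      w₀-end = trans (w₀-out ≤-refl) (cong (2 ^_) (trans (cong (suc k ∸_)
        (trans (cong (λ x → ∣ x - (r * n + k) ∣) (trans z+1 (sym (+-identityʳ (r * n))))) (∣m+n-m+o∣≡∣n-o∣ (r * n) 0 k))) (m+n∸n≡m 1 k)))

      κ₀⁻ κ₀⁺ : V → V → ℕ
      κ₀⁻ x y = 4 * edge 0 1 x y + 4 * edge (suc z) z x y + 2 * fromHub 0 z x y
      κ₀⁺ x y = 2 * edge 1 0 x y + 2 * edge z (suc z) x y + 1 * toHub 0 z x y

      record Ineq₀ (w w′ α₁ α₂ β₁ β₂ : ℕ) : Set where
        constructor ineq
        field
          holds : w′ + (4 * α₁ + 4 * α₂ + 2 * 0) ≤ 2 * w + (2 * β₁ + 2 * β₂ + 1 * 0)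
      open Ineq₀

      Local₀ : ℕ → ℕ → Set
      Local₀ p q = Ineq₀ (w₀ p) (w₀ q) (hit 0 p 1 q) (hit (suc z) p z q) (hit 1 p 0 q) (hit z p (suc z) q)

      transfer₀ : ∀ {w w′ α₁ α₂ β₁ β₂ v v′ γ₁ γ₂ η₁ η₂} → w ≡ v → w′ ≡ v′ → α₁ ≡ γ₁ → α₂ ≡ γ₂ → β₁ ≡ η₁ → β₂ ≡ η₂ →
        Ineq₀ v v′ γ₁ γ₂ η₁ η₂ → Ineq₀ w w′ α₁ α₂ β₁ β₂
      transfer₀ refl refl refl refl refl refl h = h

      plain : ∀ {p q} → w₀ q ≤ 2 * w₀ p → hit 0 p 1 q ≡ 0 → hit (suc z) p z q ≡ 0 → Local₀ p q
      plain {p} {q} h h₁ h₂ = transfer₀ refl refl h₁ h₂ refl refl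
        (ineq (≤-trans (≤-reflexive (+-identityʳ (w₀ q))) (≤-trans h (m≤m+n _ _))))

      2* : ∀ {x y} → x ≤ suc y → 2 ^ (suc k ∸ y) ≤ 2 * 2 ^ (suc k ∸ x)
      2* {x} {y} h = pow-mono (≤-trans (∸-bound (suc k) y) (s≤s (∸-monoʳ-≤ (suc k) h)))
        where
        ∸-bound : ∀ a y → a ∸ y ≤ suc (a ∸ suc y)
        ∸-bound zero y = ≤-trans (≤-reflexive (0∸n≡0 y)) z≤n
        ∸-bound (suc a) zero = ≤-refl
        ∸-bound (suc a) (suc y) = ∸-bound a y

      home-up : ∀ p → Local₀ p (suc p)
      home-up zero = transfer₀ refl (w₀-in ≤-refl 1≤z) hit-1 (hit-0ˡ 1+n≢0) refl refl (ineq (s≤s (s≤s (s≤s (s≤s z≤n)))))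
      home-up p@(suc p′) with <-cmp p z
      ... | tri< p<z _ _ = plain (≤-trans (≤-reflexive (w₀-in z<s p<z)) z≤n) (hit-0ˡ λ ()) (hit-0ˡ (>⇒≢ (m<n⇒m<1+n p<z)))
      ... | tri≈ _ refl _ = transfer₀ (w₀-in z<s ≤-refl) w₀-end (hit-0ˡ λ ()) (hit-0ˡ 1+n≢n) refl hit-1
            (ineq (≤-trans (m≤n+m 2 (2 * hit 1 z 0 (suc z))) (m≤m+n _ 0)))
      ... | tri> _ _ z<p = plain (≤-trans (≤-reflexive (w₀-out (m<n⇒m<1+n z<p))) (≤-trans (2* (dist-pred p (r * n + k))) (≤-reflexive (cong (2 *_) (sym (w₀-out z<p))))))
            (hit-0ˡ λ ()) (hit-0ʳ (<⇒≢ (m<n⇒m<1+n z<p)))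

      home-down : ∀ p → Local₀ (suc p) p
      home-down zero = transfer₀ refl refl (hit-0ˡ λ ()) (hit-0ʳ (>⇒≢ 1≤z)) hit-1 refl
        (ineq (≤-trans (m≤m+n 2 (2 * hit z 1 (suc z) 0 + 1 * 0)) (≤-trans (≤-reflexive (sym (+-assoc 2 (2 * hit z 1 (suc z) 0) (1 * 0)))) (m≤n+m _ (2 * w₀ 1)))))
      home-down p@(suc p′) with <-cmp p z
      ... | tri< p<z _ _ = plain (≤-trans (≤-reflexive (w₀-in z<s (<⇒≤ p<z))) z≤n) (hit-0ˡ λ ()) (hit-0ʳ (>⇒≢ p<z))
      ... | tri≈ _ refl _ = transfer₀ w₀-end (w₀-in z<s ≤-refl) (hit-0ˡ λ ()) hit-1 refl refl (ineq (m≤m+n 4 _))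
      ... | tri> _ _ z<p = plain (≤-trans (≤-reflexive (w₀-out z<p)) (≤-trans (2* (dist-suc p (r * n + k))) (≤-reflexive (cong (2 *_) (sym (w₀-out (m<n⇒m<1+n z<p)))))))
            (hit-0ˡ λ ()) (hit-0ʳ (<⇒≢ z<p))

      last-position : ∀ {p} → suc p ≡ N → p ≡ r * n + k + k₁
      last-position {p} e = suc-injective (trans e (shape k₁ r))
        where
        shape : ∀ k₁ r → (suc k₁ + suc k₁) * suc r ≡ suc (r * (suc k₁ + suc k₁) + suc k₁ + k₁)
        shape = solve-∀

      z<last : ∀ {p} → suc p ≡ N → z < p
      z<last {p} e = ≤-trans (≤-reflexive z+1) (≤-trans (≤-trans (m≤m+n (r * n) k) (m≤m+n _ k₁)) (≤-reflexive (sym (last-position e))))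

      w₀-last : ∀ {p} → suc p ≡ N → w₀ p ≡ 4
      w₀-last {p} e = trans (w₀-out (z<last e)) (cong (2 ^_) (trans (cong (suc k ∸_) distance) (m+n∸n≡m 2 k₁)))
        where
        distance : ∣ p - (r * n + k) ∣ ≡ k₁
        distance = trans (cong₂ ∣_-_∣ (last-position e) (sym (+-identityʳ (r * n + k)))) (trans (∣m+n-m+o∣≡∣n-o∣ (r * n + k) k₁ 0) (∣-∣-identityʳ k₁))

      home-wrap : ∀ {p} → suc p ≡ N → Local₀ p 0 × Local₀ 0 p
      home-wrap {p} e =
        plain (*-monoʳ-≤ 2 (w₀-pos (z<last e))) (hit-0ʳ λ ()) (hit-0ʳ (>⇒≢ 1≤z)) ,
        plain (≤-reflexive (w₀-last e)) (hit-0ʳ (<⇒≢ (≤-<-trans 1≤z (z<last e)))) (hit-0ˡ λ ())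

      home-from-hub : ∀ p i → i < m → p ≡ n * i → w₀ p + 2 * within 0 z p ≤ 2
      home-from-hub zero i _ _ = ≤-reflexive (cong (λ x → 2 + 2 * x) (within-below {0} {z} z≤n))
      home-from-hub p@(suc p′) i i<m eq = cases (p ≤? z)
        where
        p≤ : p ≤ suc z
        p≤ = ≤-trans (≤-reflexive eq) (≤-trans (*-monoʳ-≤ n (≤-pred i<m)) (≤-reflexive (trans (*-comm n r) (sym z+1))))
        cases : Dec (p ≤ z) → w₀ p + 2 * within 0 z p ≤ 2
        cases (yes p≤z) = ≤-reflexive (cong₂ (λ x y → x + 2 * y) (w₀-in {p} z<s p≤z) (within-in {0} {z} {p} z<s p≤z))
        cases (no  p≰z) = ≤-reflexive (cong₂ (λ x y → x + 2 * y)
          (trans (cong w₀ (≤-antisym p≤ (≰⇒> p≰z))) w₀-end) (within-above {0} {z} {p} (≰⇒> p≰z)))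

      home-to-hub : ∀ p → 1 ≤ 2 * w₀ p + within 0 z p
      home-to-hub zero = s≤s z≤n
      home-to-hub p@(suc p′) = cases (p ≤? z)
        where
        cases : Dec (p ≤ z) → 1 ≤ 2 * w₀ p + within 0 z p
        cases (yes p≤z) = ≤-trans (≤-reflexive (sym (within-in {0} {z} {p} z<s p≤z))) (m≤n+m _ (2 * w₀ p))
        cases (no  p≰z) = ≤-trans (w₀-pos (≰⇒> p≰z)) (≤-trans (m≤m+n (w₀ p) _) (m≤m+n (2 * w₀ p) _))

      home-adjacent : ∀ x y → Adj J x y → lift 1 w₀ y + κ₀⁻ x y ≤ 2 * lift 1 w₀ x + κ₀⁺ x y
      home-adjacent zero (suc j) (i , eq) = home-from-hub (toℕ j) (toℕ i) (toℕ<n i) eq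
      home-adjacent (suc j) zero (i , eq) = ≤-trans (home-to-hub (toℕ j)) (≤-reflexive (cong (2 * w₀ (toℕ j) +_) (sym (*-identityˡ (within 0 z (toℕ j))))))
      home-adjacent (suc i) (suc j) (_ , inj₁ (inj₁ q)) rewrite q = holds (home-up (toℕ i))
      home-adjacent (suc i) (suc j) (_ , inj₂ (inj₁ q)) rewrite q = holds (home-down (toℕ j))
      home-adjacent (suc i) (suc j) (_ , inj₁ (inj₂ (q , s))) rewrite s = holds (proj₁ (home-wrap q))
      home-adjacent (suc i) (suc j) (_ , inj₂ (inj₂ (q , s))) rewrite s = holds (proj₂ (home-wrap q))

      -- One pebble on the target weighs `2 ^ suc k`. As the region starts empty, all this weight
      -- has to come in, 2 per pebble at a spoke and 1 per pebble on the hub, while a move outwards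
      -- loses twice as much.
      home-block : ∀ v → toℕ v ≡ suc (r * n + k) → 1 ≤ lookup D′ v → weigh (lift 1 w₀) D ≡ 0 →
        2 ^ suc k + (4 * →at 0 + 4 * ←at z + 2 * ↓hub 0 z) ≤ 2 * ←at 0 + 2 * →at z + 1 * ↑hub 0 z
      home-block (suc i) v≡ 1≤ W≡0 = begin
        2 ^ suc k + (4 * →at 0 + 4 * ←at z + 2 * ↓hub 0 z)  ≡⟨ cong₂ _+_ (sym (trans (w₀-out z<i) (cong (2 ^_) (trans (cong (suc k ∸_) (trans (cong (∣_- r * n + k ∣) (suc-injective v≡)) (∣n-n∣≡0 (r * n + k)))) refl)))) (sym (tally-3 4 4 2 _ _ _)) ⟩
        w₀ (toℕ i) + tally κ₀⁻ σ                       ≤⟨ +-monoˡ-≤ (tally κ₀⁻ σ) (≤-trans (≤-reflexive (sym (*-identityʳ (w₀ (toℕ i))))) (≤-trans (*-monoʳ-≤ (w₀ (toℕ i)) 1≤) (lookup-weigh (lift 1 w₀) D′ (suc i)))) ⟩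
        weigh (lift 1 w₀) D′ + tally κ₀⁻ σ             ≤⟨ tally-bound (lift 1 w₀) κ₀⁻ κ₀⁺ home-adjacent σ ⟩
        weigh (lift 1 w₀) D + tally κ₀⁺ σ              ≡⟨ cong₂ _+_ W≡0 (tally-3 2 2 1 _ _ _) ⟩
        2 * ←at 0 + 2 * →at z + 1 * ↑hub 0 z           ∎
        where
        open ≤-Reasoning
        z<i : z < toℕ i
        z<i = ≤-trans (≤-reflexive z+1) (≤-trans (m≤m+n (r * n) k) (≤-reflexive (sym (suc-injective v≡))))

  -- The x pebbles at y are for the second middle vertex of the intermediate sector (odd m only).
  module Stacks (A : ℕ → ℕ) (x y : ℕ) (y<N : y < N) where

    at : ℕ → V
    at p = suc (p mod N)

    pile : ℕ → Distribution J
    pile zero    = replicate _ 0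
    pile (suc j) = pile j [ at (j * n + k) ]%= (A j +_)

    stacks : Distribution J
    stacks = pile r [ at y ]%= (x +_)

    middle<N : ∀ {j} → j < r → j * n + k < N
    middle<N {j} j<r = ≤-trans (+-monoʳ-< (j * n) (m<m+n k z<s)) (≤-trans (≤-reflexive (+-comm (j * n) n)) (≤-trans (*-monoˡ-≤ n (m<n⇒m<1+n j<r)) (≤-reflexive (*-comm m n))))

    lift-at : ∀ u F {p} → p < N → lift u F (at p) ≡ F p
    lift-at u F {p} p<N = cong F (trans (toℕ-mod p N) (m<n⇒m%n≡m p<N))

    weigh-pile : ∀ u F s → s ≤ r → weigh (lift u F) (pile s) ≡ ∑ s (λ j → A j * F (j * n + k))
    weigh-pile u F zero    _   = weigh-zero (lift u F)
    weigh-pile u F (suc s) s≤r = trans (weigh-stack (lift u F) (pile s) (at (s * n + k)) (A s))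
      (trans (cong₂ _+_ (weigh-pile u F s (<⇒≤ s≤r)) (cong (A s *_) (lift-at u F (middle<N s≤r))))
        (sym (∑-last s (λ j → A j * F (j * n + k)))))

    weigh-stacks : ∀ u F → weigh (lift u F) stacks ≡ ∑ r (λ j → A j * F (j * n + k)) + x * F y
    weigh-stacks u F = trans (weigh-stack (lift u F) (pile r) (at y) x)
      (cong₂ _+_ (weigh-pile u F r ≤-refl) (cong (x *_) (lift-at u F y<N)))

    sum-stacks : sum stacks ≡ ∑ r A + x
    sum-stacks = trans (sum-weigh stacks) (trans (weigh-cong stacks) (trans (weigh-stacks 1 (λ _ → 1))
      (cong₂ _+_ (∑-cong r λ j _ → *-identityʳ (A j)) (*-identityʳ x))))
      where
      weigh-cong : ∀ (D : Vec ℕ (suc N)) → weigh (λ _ → 1) D ≡ weigh (lift 1 (λ _ → 1)) D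
      weigh-cong (_ ∷ D) = refl

-- Counting arguments

-- The pebble missing from `2 * w` makes the weight inequality strict: `2 * out < inn + 2`.
full-block : ∀ w {A} out inn → suc A ≡ 2 * w → 2 * w * out ≤ A + w * inn → 2 * out ≤ suc inn
full-block w {A} out inn A≡ h with 2 * out ≤? suc inn
... | yes q = q
... | no ¬q = linear-⊥ 0 (h ⊞ w ⊠ ≰⇒> ¬q ⊞ ≤-reflexive A≡) (identity w A out inn)
  where
  identity : ∀ w A o i → A + w * i + (w * (2 * o) + 2 * w) + 1 ≡ 2 * w * o + (w * suc (suc i) + suc A)
  identity = solve-∀

-- The same computation with `suc V` times the weight: left to itself, the block releases at most
-- `V` pebbles.
big-block : ∀ w {A} V out inn → suc A ≡ 2 * w * suc V → 2 * w * out ≤ A + w * inn → out ≤ inn + V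
big-block w {A} V out inn A≡ h with out ≤? inn + V
... | yes q = q
... | no ¬q = linear-⊥ (w * inn) (h ⊞ (2 * w) ⊠ ≰⇒> ¬q ⊞ ≤-reflexive A≡) (identity w A V out inn)
  where
  identity : ∀ w A V o i → A + w * i + (2 * w * o + 2 * w * suc V) + suc (w * i) ≡ 2 * w * o + (2 * w * suc (i + V) + suc A)
  identity = solve-∀

passes : ∀ {out inn} → 2 * out ≤ suc inn → out ≤ inn
passes {out} {inn} h with out ≤? inn
... | yes q = q
... | no ¬q = linear-⊥ inn (h ⊞ 2 ⊠ ≰⇒> ¬q) (identity out inn)
  where
  identity : ∀ o i → suc i + 2 * o + suc i ≡ 2 * o + 2 * suc i
  identity = solve-∀

-- An outermost sector of 2ᵏ − 1 pebbles next to one of 2ᵏ⁺¹ − 1 pebbles: although a pebble z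
-- arriving at the target's sector is worth two pebbles on the hub, the group gains nothing.
outer-group : ∀ z R₀ R₁ L₁ R₂ L₂ T₁ S₁ T₂ S₂ →
  2 * (z + R₁ + T₁) ≤ suc (R₀ + L₁ + S₁) → 2 * (L₁ + R₂ + T₂) ≤ suc (R₁ + L₂ + S₂) →
  ¬ (1 ≤ L₁ × R₁ + S₂ ≡ 0 × L₂ ≤ 1) →
  2 * z + R₂ + (T₁ + T₂) ≤ 4 * R₀ + L₂ + 2 * (S₁ + S₂)
outer-group z R₀ R₁ L₁ R₂ L₂ T₁ S₁ T₂ S₂ h₁ h₂ dir with 2 * z + R₂ + (T₁ + T₂) ≤? 4 * R₀ + L₂ + 2 * (S₁ + S₂)
... | yes q = q
-- Failure of the bound forces a single pattern: the larger sector sends a pebble outwards although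
-- nothing enters it from the outer sector or the hub and at most one pebble from its other side. A
-- one-sided weight excludes this, which is `dir`.
... | no ¬q = contradiction (1≤L₁ , none (R₁ + S₂) tight , ≤-trans (m≤m+n L₂ _) small) dir
  where
  small : L₂ + (6 * R₀ + 2 * S₁ + 2 * T₁ + 3 * (R₁ + S₂)) ≤ 1
  small = linear 0 (2 ⊠ ≰⇒> ¬q ⊞ 2 ⊠ h₁ ⊞ h₂) (identity z R₀ R₁ L₁ R₂ L₂ T₁ S₁ T₂ S₂)
    where
    identity : ∀ z R₀ R₁ L₁ R₂ L₂ T₁ S₁ T₂ S₂ →
      L₂ + (6 * R₀ + 2 * S₁ + 2 * T₁ + 3 * (R₁ + S₂)) + (2 * (2 * z + R₂ + (T₁ + T₂)) + (2 * suc (R₀ + L₁ + S₁) + suc (R₁ + L₂ + S₂))) + 0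
      ≡ 1 + (2 * suc (4 * R₀ + L₂ + 2 * (S₁ + S₂)) + (2 * (2 * (z + R₁ + T₁)) + 2 * (L₁ + R₂ + T₂)))
    identity = solve-∀
  tight : 3 * (R₁ + S₂) ≤ 1
  tight = ≤-trans (≤-trans (m≤n+m (3 * (R₁ + S₂)) (6 * R₀ + 2 * S₁ + 2 * T₁)) (m≤n+m _ L₂)) small
  none : ∀ a → 3 * a ≤ 1 → a ≡ 0
  none zero    _ = refl
  none (suc a) h = linear-⊥ (1 + 3 * a) h (identity′ a)
    where
    identity′ : ∀ a → 1 + suc (1 + 3 * a) ≡ 3 * suc a
    identity′ = solve-∀
  1≤L₁ : 1 ≤ L₁
  1≤L₁ = decide (1 ≤? L₁)
    where
    identity : ∀ z R₀ R₁ L₁ R₂ L₂ T₁ S₁ T₂ S₂ →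
      2 * (2 * z + R₂ + (T₁ + T₂)) + (4 * (R₀ + L₁ + S₁) + (suc (R₁ + L₂ + S₂) + 2 * 1))
        + suc (4 * R₀ + L₂ + 3 * R₁ + 2 * T₁ + 3 * S₂)
      ≡ 2 * suc (4 * R₀ + L₂ + 2 * (S₁ + S₂)) + (4 * (z + R₁ + T₁) + (2 * (L₁ + R₂ + T₂) + 2 * suc L₁))
    identity = solve-∀
    decide : Dec (1 ≤ L₁) → 1 ≤ L₁
    decide (yes p) = p
    decide (no ¬p) = linear-⊥ (4 * R₀ + L₂ + 3 * R₁ + 2 * T₁ + 3 * S₂)
      (2 ⊠ ≰⇒> ¬q ⊞ 4 ⊠ passes {z + R₁ + T₁} h₁ ⊞ h₂ ⊞ 2 ⊠ ≰⇒> ¬p) (identity z R₀ R₁ L₁ R₂ L₂ T₁ S₁ T₂ S₂)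

-- The intermediate sector, with μ = ⌊2ᵏ⁺¹/3⌋ pebbles on each of its two middle vertices; l and
-- l′ are the pebbles leaving it to the left and to the right (or to the hub).
middle-block : ∀ d μ l l′ inn → 1 ≤ d → 3 * μ < 4 * d → 2 * d * (l + l′) ≤ 2 * μ + d * inn →
  (inn ≡ 0 → 2 * (2 * (d * d)) * l ≤ 3 * μ * d) → (inn ≡ 0 → 2 * (2 * (d * d)) * l′ ≤ 3 * μ * d) → l + l′ ≤ inn
-- The symmetric bound is `out < inn / 2 + 4 / 3`. It settles `inn ≥ 1` but would let one pebble
-- escape when none enters; weights growing towards one end exclude each direction separately.
middle-block d μ l l′ zero 1≤d μ< h left right = ≤-reflexive (cong₂ _+_ (blocked l (left refl)) (blocked l′ (right refl)))
  where
  blocked : ∀ l → 2 * (2 * (d * d)) * l ≤ 3 * μ * d → l ≡ 0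
  blocked zero    _ = refl
  blocked (suc l) g = linear-⊥ (4 * (d * d) * l) (g ⊞ d ⊠ μ< ⊞ 1≤d) (identity d μ l)
    where
    identity : ∀ d μ l → 3 * μ * d + (d * (4 * d) + d) + suc (4 * (d * d) * l) ≡ 2 * (2 * (d * d)) * suc l + (d * suc (3 * μ) + 1)
    identity = solve-∀
middle-block d μ l l′ (suc zero) _ μ< h _ _ with l + l′ ≤? 1
... | yes q = q
... | no ¬q = linear-⊥ (1 + d) (3 ⊠ h ⊞ (6 * d) ⊠ ≰⇒> ¬q ⊞ 2 ⊠ μ<) (identity d μ (l + l′))
  where
  identity : ∀ d μ o → 3 * (2 * μ + d * 1) + (6 * d * o + 2 * (4 * d)) + suc (1 + d) ≡ 3 * (2 * d * o) + (6 * d * 2 + 2 * suc (3 * μ))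
  identity = solve-∀
middle-block d μ l l′ (suc (suc i)) _ μ< h _ _ with l + l′ ≤? suc (suc i)
... | yes q = q
... | no ¬q = linear-⊥ (1 + 4 * d + 3 * d * i) (3 ⊠ h ⊞ (6 * d) ⊠ ≰⇒> ¬q ⊞ 2 ⊠ μ<) (identity d μ (l + l′) i)
  where
  identity : ∀ d μ o i → 3 * (2 * μ + d * suc (suc i)) + (6 * d * o + 2 * (4 * d)) + suc (1 + 4 * d + 3 * d * i)
    ≡ 3 * (2 * d * o) + (6 * d * suc (suc (suc i)) + 2 * suc (3 * μ))
  identity = solve-∀

-- Blocks of the extremal distribution

module Blocks (k₁ r : ℕ) (A : ℕ → ℕ) (x y : ℕ) (y<N : y < JahangirLower.N k₁ r) where
  open JahangirLower k₁ r
  open Stacks A x y y<N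

  d : ℕ
  d = 2 ^ k₁

  2≤n : 2 ≤ n
  2≤n = s≤s (≤-trans (s≤s z≤n) (m≤n+m k k₁))

  inner-end : ∀ {e} → e ≤ r * n → suc e < N
  inner-end {e} h = ≤-trans (s≤s (s≤s h)) (≤-trans (+-monoˡ-≤ (r * n) 2≤n) (≤-reflexive (*-comm m n)))

  sector-end : ∀ {j} → j < r → n + j * n ≤ r * n
  sector-end j<r = *-monoˡ-≤ n j<r

  between : ∀ {i j} → j * n < n * i → n * i ≤ n + j * n → n * i ≡ n + j * n
  between {i} {j} lo hi = trans (*-comm n i) (cong (_* n) (≤-antisym
    (*-cancelʳ-≤ i (suc j) n (≤-trans (≤-reflexive (*-comm i n)) hi))
    (*-cancelʳ-< n j i (≤-trans lo (≤-reflexive (*-comm n i))))))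

  weigh-sector : ∀ b e (φ : ℕ → ℕ) j → j < r → j * n ≤ suc b → e ≤ n + j * n → b < j * n + k → j * n + k ≤ e →
    weigh (lift 0 (λ p → within b e p * φ p)) stacks ≡ A j * φ (j * n + k) + x * (within b e y * φ y)
  weigh-sector b e φ j j<r b≥ e≤ b< ≤e = trans (weigh-stacks 0 F)
    (cong (_+ x * F y) (trans (∑-single r (λ i → A i * F (i * n + k)) j j<r elsewhere)
      (cong (A j *_) (trans (cong (_* φ (j * n + k)) (within-in b< ≤e)) (*-identityˡ (φ (j * n + k)))))))
    where
    F : ℕ → ℕ
    F p = within b e p * φ p
    absent : ∀ i → within b e (i * n + k) ≡ 0 → A i * F (i * n + k) ≡ 0
    absent i h = trans (cong (λ w → A i * (w * φ (i * n + k))) h) (*-zeroʳ (A i))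
    elsewhere : ∀ i → i < r → i ≢ j → A i * F (i * n + k) ≡ 0
    elsewhere i _ i≢j with <-cmp i j
    ... | tri≈ _ i≡j _ = contradiction i≡j i≢j
    ... | tri< i<j _ _ = absent i (within-below {b} {e} (≤-pred (≤-trans (+-monoʳ-< (i * n) (m<m+n k z<s))
            (≤-trans (≤-reflexive (+-comm (i * n) n)) (≤-trans (*-monoˡ-≤ n i<j) b≥)))))
    ... | tri> _ _ j<i = absent i (within-above {b} {e} (≤-<-trans e≤ (≤-<-trans (*-monoˡ-≤ n j<i) (m<m+n (i * n) z<s))))

  Clear : ℕ → ℕ → Set
  Clear b e = x ≡ 0 ⊎ (y ≤ b ⊎ e < y)

  clear : ∀ {b e} → Clear b e → ∀ w → x * (within b e y * w) ≡ 0
  clear {b} {e} (inj₁ x≡0) w = cong (_* (within b e y * w)) x≡0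
  clear {b} {e} (inj₂ h) w = trans (cong (λ v → x * (v * w)) ([ within-below {b} {e} , within-above {b} {e} ]′ h)) (*-zeroʳ x)

  module Play {D′ : Distribution J} (σ : Star (Move J) stacks D′) where
    open Counts σ

    Out In : ℕ → ℕ → ℕ
    Out b e = ←at b + →at e + ↑hub b e
    In  b e = →at b + ←at e + ↓hub b e

    collect : ∀ w b e A → 2 * w * ←at b + 2 * w * →at e + 2 * w * ↑hub b e ≤ A + (w * →at b + w * ←at e + w * ↓hub b e) →
      2 * w * Out b e ≤ A + w * In b e
    collect w b e A = subst₂ _≤_ (sym (shape (2 * w) _ _ _)) (cong (A +_) (sym (shape w _ _ _)))
      where
      shape : ∀ w a b c → w * (a + b + c) ≡ w * a + w * b + w * c
      shape = solve-∀

    low-block : ∀ j → j < r → Clear (j * n) (n₁ + j * n) →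
      2 * d * Out (j * n) (n₁ + j * n) ≤ A j + d * In (j * n) (n₁ + j * n)
    low-block j j<r free = collect d b e (A j) (subst₂ Shape p₁ p₂
        -- A small sector is taken without its ends and so contains no spoke. The hub coefficients
        -- `d` and `2 * d` are free and chosen to fit `collect`.
        (block b e b<e (inner-end (≤-trans (n≤1+n e) (sector-end j<r))) c c d (2 * d) (λ i lo hi → ⊥-elim (no-spoke i lo hi)) (λ i lo hi → ⊥-elim (no-spoke i lo hi)) W≤))
      where
      b e c : ℕ
      b = j * n
      e = n₁ + j * n
      c = j * n + k
      Shape : ℕ → ℕ → Set
      Shape φ₁ φ₂ = 2 * φ₁ * ←at b + 2 * φ₂ * →at e + 2 * d * ↑hub b e ≤ A j + (φ₁ * →at b + φ₂ * ←at e + d * ↓hub b e)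
      b<e : b < e
      b<e = m<n+m b (≤-trans z<s (m≤n+m k k₁))
      c≤e : c ≤ e
      c≤e = ≤-trans (≤-reflexive (+-comm (j * n) k)) (+-monoˡ-≤ (j * n) (m≤n+m k k₁))
      b<c : b < c
      b<c = m<m+n b z<s
      p₁ : peak c c (suc b) ≡ d
      p₁ = peak-left k₁ b<c (+-suc (j * n) k₁)
      p₂ : peak c c e ≡ d
      p₂ = peak-right k₁ c≤e (shape k₁ k (j * n))
        where
        shape : ∀ a b c → a + b + c ≡ c + b + a
        shape = solve-∀
      no-spoke : ∀ i → b < n * i → n * i ≤ e → ⊥
      no-spoke i lo hi = <-irrefl (between {i} {j} lo (≤-trans hi (n≤1+n e))) (s≤s hi)
      W≤ : weigh (lift 0 (λ p → within b e p * peak c c p)) stacks ≤ A j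
      W≤ = ≤-reflexive (trans (weigh-sector b e (peak c c) j j<r (n≤1+n b) (n≤1+n e) b<c c≤e)
        (trans (cong₂ _+_ (trans (cong (A j *_) (peak-left {c} {c} {c} 0 ≤-refl (sym (+-identityʳ c)))) (*-identityʳ (A j))) (clear free (peak c c y))) (+-identityʳ (A j))))

    -- A larger sector is taken with its ends, both of them spokes of weight `2 * d`. Taking
    -- alternate sectors with and without ends puts each spoke between them into exactly one block.
    high-block : ∀ j → suc j < r → Clear (n₁ + j * n) (n + suc j * n) →
      2 * (2 * d) * Out (n₁ + j * n) (n + suc j * n) ≤ A (suc j) + 2 * d * In (n₁ + j * n) (n + suc j * n)
    high-block j j<r free = collect (2 * d) b e (A (suc j)) (subst₂ Shape p₁ p₂
        (block b e b<e (inner-end (sector-end j<r)) c c (2 * d) (2 * (2 * d))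
          (λ i lo hi → ≤-reflexive (at-spoke i lo hi)) (λ i lo hi → ≤-reflexive (cong (2 *_) (sym (at-spoke i lo hi)))) W≤))
      where
      b e c : ℕ
      b = n₁ + j * n
      e = n + suc j * n
      c = suc j * n + k
      Shape : ℕ → ℕ → Set
      Shape φ₁ φ₂ = 2 * φ₁ * ←at b + 2 * φ₂ * →at e + 2 * (2 * d) * ↑hub b e ≤ A (suc j) + (φ₁ * →at b + φ₂ * ←at e + 2 * d * ↓hub b e)
      b<e : b < e
      b<e = m≤n+m (suc j * n) n
      c≤e : c ≤ e
      c≤e = ≤-trans (≤-reflexive (+-comm (suc j * n) k)) (+-monoˡ-≤ (suc j * n) (m≤m+n k k))
      b<c : b < c
      b<c = m≤m+n (suc j * n) k
      p₁ : peak c c (suc b) ≡ 2 * d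
      p₁ = peak-left k b<c refl
      p₂ : peak c c e ≡ 2 * d
      p₂ = peak-right k c≤e (shape k (suc j * n))
        where
        shape : ∀ a c → a + a + c ≡ c + a + a
        shape = solve-∀
      at-spoke : ∀ i → b < n * i → n * i ≤ e → peak c c (n * i) ≡ 2 * d
      at-spoke i lo hi with m≤n⇒m<n∨m≡n lo
      ... | inj₁ lt = trans (cong (peak c c) (between {i} {suc j} lt hi)) p₂
      ... | inj₂ eq = trans (cong (peak c c) (sym eq)) p₁
      W≤ : weigh (lift 0 (λ p → within b e p * peak c c p)) stacks ≤ A (suc j)
      W≤ = ≤-reflexive (trans (weigh-sector b e (peak c c) (suc j) j<r ≤-refl ≤-refl b<c c≤e)
        (trans (cong₂ _+_ (trans (cong (A (suc j) *_) (peak-left {c} {c} {c} 0 ≤-refl (sym (+-identityʳ c)))) (*-identityʳ (A (suc j)))) (clear free (peak c c y))) (+-identityʳ (A (suc j)))))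

    -- Weights doubling all the way to one end of the interval b + 1, …, e.
    directed-left : ∀ b e a → b < e → e ≤ r * n → e ≡ suc b + a → ∀ {W} →
      weigh (lift 0 (λ p → within b e p * peak e e p)) stacks ≤ W →
      2 * 2 ^ a * ←at b ≤ W + (2 ^ a * (→at b + ↓hub b e) + ←at e)
    directed-left b e a b<e e≤ e≡ {W} W≤ = linear (2 * →at e) (subst₂ Shape p₁ p₂
        (block b e b<e (inner-end e≤) e e (2 ^ a) 0 (λ i lo hi → bound lo hi) (λ _ _ _ → z≤n) W≤))
        (identity (2 ^ a) W (←at b) (→at e) (→at b) (←at e) (↓hub b e) (↑hub b e))
      where
      Shape : ℕ → ℕ → Set
      Shape φ₁ φ₂ = 2 * φ₁ * ←at b + 2 * φ₂ * →at e + 0 * ↑hub b e ≤ W + (φ₁ * →at b + φ₂ * ←at e + 2 ^ a * ↓hub b e)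
      p₁ : peak e e (suc b) ≡ 2 ^ a
      p₁ = peak-left a b<e e≡
      p₂ : peak e e e ≡ 1
      p₂ = peak-left 0 ≤-refl (sym (+-identityʳ e))
      bound : ∀ {p} → b < p → p ≤ e → peak e e p ≤ 2 ^ a
      bound {p} lo hi = ≤-trans (≤-reflexive (peak-left (e ∸ p) hi (sym (m+[n∸m]≡n hi))))
        (pow-mono (≤-trans (∸-monoʳ-≤ e lo) (≤-reflexive (trans (cong (_∸ suc b) e≡) (m+n∸m≡n (suc b) a)))))
      identity : ∀ P W l r r′ l′ s t → 2 * P * l + (W + (P * r′ + 1 * l′ + P * s)) + 2 * r
        ≡ W + (P * (r′ + s) + l′) + (2 * P * l + 2 * 1 * r + 0 * t)
      identity = solve-∀

    -- The mirror image, with moves to the hub counted by `ψ`: in the intermediate sector the spoke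
    -- at the right end is an exit to the hub as well.
    directed-right : ∀ b e a ψ → b < e → e ≤ r * n → e ≡ suc b + a →
      (∀ i → b < n * i → n * i ≤ e → ψ ≤ 2 * peak (suc b) (suc b) (n * i)) → ∀ {W} →
      weigh (lift 0 (λ p → within b e p * peak (suc b) (suc b) p)) stacks ≤ W →
      2 * 2 ^ a * →at e + ψ * ↑hub b e ≤ W + (2 ^ a * (←at e + ↓hub b e) + →at b)
    directed-right b e a ψ b<e e≤ e≡ hub-out {W} W≤ = linear (2 * ←at b) (subst₂ Shape p₁ p₂
        (block b e b<e (inner-end e≤) (suc b) (suc b) (2 ^ a) ψ (λ i lo hi → bound lo hi) hub-out W≤))
        (identity (2 ^ a) W (←at b) (→at e) (→at b) (←at e) (↓hub b e) (ψ * ↑hub b e))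
      where
      Shape : ℕ → ℕ → Set
      Shape φ₁ φ₂ = 2 * φ₁ * ←at b + 2 * φ₂ * →at e + ψ * ↑hub b e ≤ W + (φ₁ * →at b + φ₂ * ←at e + 2 ^ a * ↓hub b e)
      p₁ : peak (suc b) (suc b) (suc b) ≡ 1
      p₁ = peak-left 0 ≤-refl (sym (+-identityʳ (suc b)))
      p₂ : peak (suc b) (suc b) e ≡ 2 ^ a
      p₂ = peak-right a b<e e≡
      bound : ∀ {p} → b < p → p ≤ e → peak (suc b) (suc b) p ≤ 2 ^ a
      bound {p} lo hi = ≤-trans (≤-reflexive (peak-right (p ∸ suc b) lo (sym (m+[n∸m]≡n lo))))
        (pow-mono (≤-trans (∸-monoˡ-≤ (suc b) hi) (≤-reflexive (trans (cong (_∸ suc b) e≡) (m+n∸m≡n (suc b) a)))))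
      identity : ∀ P W l r r′ l′ s t → 2 * P * r + t + (W + (1 * r′ + P * l′ + P * s)) + 2 * l
        ≡ W + (P * (l′ + s) + r′) + (2 * 1 * l + 2 * P * r + t)
      identity = solve-∀

    P : ℕ
    P = 2 ^ n

    P≡ : P ≡ 2 * d * (2 * d)
    P≡ = ^-distribˡ-+-* 2 k k

    -- The stack of `4 * d − 1` pebbles weighs `2 * P − 2 * d`, and one pebble entering at the light
    -- end adds only 1, which is less than `2 * d`. This provides the premise `dir` of
    -- `outer-group`.
    full-directed : ∀ {a o i i′} → suc a ≡ 2 * (2 * d) → 2 * P * o ≤ a * (2 * d) + (P * i + i′) → ¬ (1 ≤ o × i ≡ 0 × i′ ≤ 1)
    full-directed {a} {o} {i} {i′} a≡ h (1≤o , refl , i′≤1) =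
      linear-⊥ 0 ((2 * P) ⊠ 1≤o ⊞ h ⊞ i′≤1 ⊞ (2 * d) ⊠ ≤-reflexive a≡ ⊞ 2 ⊠ ≤-reflexive (sym P≡) ⊞ 2 ⊠ m^n>0 2 k₁)
        (identity P d a o i′)
      where
      identity : ∀ P d a o i → 2 * P * o + (a * (2 * d) + (P * 0 + i) + (1 + (2 * d * (2 * (2 * d)) + (2 * P + 2 * d)))) + 1
        ≡ 2 * P * 1 + (2 * P * o + (i + (2 * d * suc a + (2 * (2 * d * (2 * d)) + 2 * 1))))
      identity = solve-∀

    high-left : ∀ j → suc j < r → Clear (n₁ + j * n) (n + suc j * n) → suc (A (suc j)) ≡ 2 * (2 * d) →
      ¬ (1 ≤ ←at (n₁ + j * n) × →at (n₁ + j * n) + ↓hub (n₁ + j * n) (n + suc j * n) ≡ 0 × ←at (n + suc j * n) ≤ 1)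
    high-left j j<r free A≡ = full-directed A≡ (directed-left b e n (m≤n+m (suc j * n) n) (sector-end j<r) (+-comm n (suc j * n)) W≤)
      where
      b e c : ℕ
      b = n₁ + j * n
      e = n + suc j * n
      c = suc j * n + k
      c≤e : c ≤ e
      c≤e = ≤-trans (≤-reflexive (+-comm (suc j * n) k)) (+-monoˡ-≤ (suc j * n) (m≤m+n k k))
      shape : ∀ a c → a + a + c ≡ c + a + a
      shape = solve-∀
      W≤ : weigh (lift 0 (λ p → within b e p * peak e e p)) stacks ≤ A (suc j) * (2 * d)
      W≤ = ≤-reflexive (trans (weigh-sector b e (peak e e) (suc j) j<r ≤-refl ≤-refl (m≤m+n (suc j * n) k) c≤e)
        (trans (cong₂ _+_ (cong (A (suc j) *_) (peak-left k c≤e (shape k (suc j * n)))) (clear free (peak e e y))) (+-identityʳ _)))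

    high-right : ∀ j → suc j < r → Clear (n₁ + j * n) (n + suc j * n) → suc (A (suc j)) ≡ 2 * (2 * d) →
      ¬ (1 ≤ →at (n + suc j * n) × ←at (n + suc j * n) + ↓hub (n₁ + j * n) (n + suc j * n) ≡ 0 × →at (n₁ + j * n) ≤ 1)
    high-right j j<r free A≡ = full-directed A≡ (≤-trans (≤-reflexive (sym (+-identityʳ _)))
        (directed-right b e n 0 (m≤n+m (suc j * n) n) (sector-end j<r) (+-comm n (suc j * n)) (λ _ _ _ → z≤n) W≤))
      where
      b e c : ℕ
      b = n₁ + j * n
      e = n + suc j * n
      c = suc j * n + k
      c≤e : c ≤ e
      c≤e = ≤-trans (≤-reflexive (+-comm (suc j * n) k)) (+-monoˡ-≤ (suc j * n) (m≤m+n k k))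
      W≤ : weigh (lift 0 (λ p → within b e p * peak (suc b) (suc b) p)) stacks ≤ A (suc j) * (2 * d)
      W≤ = ≤-reflexive (trans (weigh-sector b e (peak (suc b) (suc b)) (suc j) j<r ≤-refl ≤-refl (m≤m+n (suc j * n) k) c≤e)
        (trans (cong₂ _+_ (cong (A (suc j) *_) (peak-right k (m≤m+n (suc j * n) k) refl)) (clear free (peak (suc b) (suc b) y))) (+-identityʳ _)))

-- Balance along the chain

double : ℕ → ℕ
double zero    = 0
double (suc ρ) = suc (suc (double ρ))

-- The initial `s` sectors, a small and the big one, `ρ` alternating pairs, and finally a small, a
-- larger and a small sector.
chain-length : ℕ → ℕ → ℕ
chain-length ρ s = suc (suc (suc (double ρ + (2 + s))))

module Balance (k₁ r : ℕ) (A : ℕ → ℕ) (x y : ℕ) (y<N : y < JahangirLower.N k₁ r) where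
  open JahangirLower k₁ r
  open Stacks A x y y<N
  open Blocks k₁ r A x y y<N

  module _ {D′ : Distribution J} (σ : Star (Move J) stacks D′) where
    open Counts σ
    open Play σ

    -- The unit is a pebble on the hub. A pebble leaving at the left end lands on a spoke of the
    -- target's sector and counts 2; moves into the chain spend two pebbles, hence 4 and 2. At the
    -- moving boundary `p` a pebble counts 1 in both directions.
    Balanced : ℕ → ℕ → Set
    Balanced p V = 2 * ←at 0 + →at p + ↑hub 0 p ≤ 4 * →at 0 + ←at p + 2 * ↓hub 0 p + V

    -- What leaves the part up to `b` across `b` enters the block, and conversely, so these flows
    -- cancel when the inequalities are added.
    extend : ∀ {b e V V′} → b ≤ e → Balanced b V → Out b e ≤ In b e + V′ → Balanced e (V + V′)
    extend {b} {e} {V} {V′} b≤e B h = subst₂ (λ t s → 2 * ←at 0 + →at e + t ≤ 4 * →at 0 + ←at e + 2 * s + (V + V′))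
      (sym (↑hub-split b≤e)) (sym (↓hub-split b≤e))
      (linear (↓hub b e) (B ⊞ h) (identity (←at 0) (→at 0) (←at b) (→at b) (←at e) (→at e) (↑hub 0 b) (↓hub 0 b) (↑hub b e) (↓hub b e) V V′))
      where
      identity : ∀ l₀ r₀ lb rb le re t s t′ s′ V V′ →
        2 * l₀ + re + (t + t′) + (4 * r₀ + lb + 2 * s + V + (rb + le + s′ + V′)) + s′
        ≡ 4 * r₀ + le + 2 * (s + s′) + (V + V′) + (2 * l₀ + rb + t + (lb + re + t′))
      identity = solve-∀

    Low High : ℕ → Set
    Low  j = suc (A j) ≡ 2 * d
    High j = suc (A j) ≡ 2 * (2 * d)

    low : ∀ j → j < r → Clear (j * n) (n₁ + j * n) → Low j → 2 * Out (j * n) (n₁ + j * n) ≤ suc (In (j * n) (n₁ + j * n))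
    low j j<r free L = full-block d (Out (j * n) (n₁ + j * n)) (In (j * n) (n₁ + j * n)) L (low-block j j<r free)

    high : ∀ j → suc j < r → Clear (n₁ + j * n) (n + suc j * n) → High (suc j) →
      2 * Out (n₁ + j * n) (n + suc j * n) ≤ suc (In (n₁ + j * n) (n + suc j * n))
    high j j<r free H = full-block (2 * d) (Out (n₁ + j * n) (n + suc j * n)) (In (n₁ + j * n) (n + suc j * n)) H (high-block j j<r free)

    -- Passing these two sectors one by one would give the exit at the left end only the coefficient
    -- 1; `outer-group` gives the required 2.
    first-group : 1 < r → Low 0 → High 1 → Clear 0 (n₁ + 0) → Clear (n₁ + 0) (n + 1 * n) → Balanced (n + 1 * n) 0
    first-group 1<r L H free₀ free₁ =
      ≤-trans (subst₂ (λ t s → 2 * ←at 0 + →at e₂ + t ≤ 4 * →at 0 + ←at e₂ + 2 * s) (sym (↑hub-split e₁≤e₂)) (sym (↓hub-split e₁≤e₂))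
        (outer-group (←at 0) (→at 0) (→at e₁) (←at e₁) (→at e₂) (←at e₂) (↑hub 0 e₁) (↓hub 0 e₁) (↑hub e₁ e₂) (↓hub e₁ e₂)
          (low 0 (<⇒≤ 1<r) free₀ L) (high 0 1<r free₁ H) (high-left 0 1<r free₁ H)))
        (m≤m+n _ 0)
      where
      e₁ e₂ : ℕ
      e₁ = n₁ + 0
      e₂ = n + 1 * n
      e₁≤e₂ : e₁ ≤ e₂
      e₁≤e₂ = <⇒≤ (m≤n+m (1 * n) n)

    -- The group is the mirror image of `first-group`, with left and right exchanged in
    -- `outer-group`, and is added to the balance of everything before it.
    last-group : ∀ j → suc (suc j) < r → High (suc j) → Low (suc (suc j)) →
      Clear (n₁ + j * n) (n + suc j * n) → Clear (n + suc j * n) (n₁ + suc (suc j) * n) → ∀ {V} →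
      Balanced (n₁ + j * n) V → let z = n₁ + suc (suc j) * n in
      2 * ←at 0 + 2 * →at z + ↑hub 0 z ≤ 4 * →at 0 + 4 * ←at z + 2 * ↓hub 0 z + V
    last-group j j<r H L free₁ free₂ {V} B =
      subst₂ (λ t s → 2 * ←at 0 + 2 * →at z + t ≤ 4 * →at 0 + 4 * ←at z + 2 * s + V) (sym ↑split) (sym ↓split)
        (linear 0 (B ⊞ group) (identity (←at 0) (→at 0) (←at b) (→at b) (←at z) (→at z) (↑hub 0 b) (↓hub 0 b) (↑hub b e) (↓hub b e) (↑hub e z) (↓hub e z) V))
      where
      b e z : ℕ
      b = n₁ + j * n
      e = n + suc j * n
      z = n₁ + suc (suc j) * n
      b≤e : b ≤ e
      b≤e = <⇒≤ (m≤n+m (suc j * n) n)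
      e≤z : e ≤ z
      e≤z = m≤n+m e n₁
      ↑split : ↑hub 0 z ≡ ↑hub 0 b + ↑hub b e + ↑hub e z
      ↑split = trans (↑hub-split e≤z) (cong (_+ ↑hub e z) (↑hub-split b≤e))
      ↓split : ↓hub 0 z ≡ ↓hub 0 b + ↓hub b e + ↓hub e z
      ↓split = trans (↓hub-split e≤z) (cong (_+ ↓hub e z) (↓hub-split b≤e))
      swap : ∀ {p q t p′ q′ t′} → 2 * (p + q + t) ≤ suc (p′ + q′ + t′) → 2 * (q + p + t) ≤ suc (q′ + p′ + t′)
      swap {p} {q} {t} {p′} {q′} {t′} = subst₂ (λ a b → 2 * (a + t) ≤ suc (b + t′)) (+-comm p q) (+-comm p′ q′)
      group : 2 * →at z + ←at b + (↑hub e z + ↑hub b e) ≤ 4 * ←at z + →at b + 2 * (↓hub e z + ↓hub b e)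
      group = outer-group (→at z) (←at z) (←at e) (→at e) (←at b) (→at b) (↑hub e z) (↓hub e z) (↑hub b e) (↓hub b e)
        (swap {←at e} {→at z} {_} {→at e} {←at z} (low (suc (suc j)) j<r free₂ L))
        (swap {←at b} {→at e} {_} {→at b} {←at e} (high j (<⇒≤ j<r) free₁ H))
        (high-right j (<⇒≤ j<r) free₁ H)
      identity : ∀ l₀ r₀ lb rb lz rz t s t′ s′ t″ s″ V →
        2 * l₀ + 2 * rz + (t + t′ + t″) + (4 * r₀ + lb + 2 * s + V + (4 * lz + rb + 2 * (s″ + s′))) + 0
        ≡ 4 * r₀ + 4 * lz + 2 * (s + s′ + s″) + V + (2 * l₀ + rb + t + (2 * rz + lb + (t″ + t′)))
      identity = solve-∀

    -- The block contains the right end of the sector but not the left one: the neighbour on the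
    -- left is taken with its ends, that on the right without.
    middle : ∀ j → j < r → x ≡ A j → y ≡ suc (j * n + k) → 3 * A j < 4 * d → Out (j * n) (n + j * n) ≤ In (j * n) (n + j * n)
    middle j j<r x≡ refl μ< = ≤-trans (≤-reflexive (+-assoc (←at b) (→at e) (↑hub b e)))
        (middle-block d μ (←at b) (→at e + ↑hub b e) (In b e) (m^n>0 2 k₁) μ< both left right)
      where
      b e c μ : ℕ
      b = j * n
      e = n + j * n
      c = j * n + k
      μ = A j
      b<e : b < e
      b<e = m<n+m b z<s
      b<c : b < c
      b<c = m<m+n b z<s
      c<e : c < e
      c<e = ≤-trans (≤-reflexive (cong suc (+-comm (j * n) k))) (+-monoˡ-≤ (j * n) (≤-trans (s≤s (m≤n+m k k₁)) ≤-refl))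
      e≡ : e ≡ suc b + n₁
      e≡ = cong suc (+-comm n₁ (j * n))
      e-c : e ≡ c + k
      e-c = shape k (j * n)
        where
        shape : ∀ a c → a + a + c ≡ c + a + a
        shape = solve-∀
      e-y : e ≡ suc c + k₁
      e-y = trans e-c (+-suc c k₁)
      c-b : c ≡ suc b + k₁
      c-b = +-suc b k₁
      y-b : suc c ≡ suc b + k
      y-b = refl
      W : ∀ φ → weigh (lift 0 (λ p → within b e p * φ p)) stacks ≡ μ * φ c + μ * φ (suc c)
      W φ = trans (weigh-sector b e φ j j<r (n≤1+n b) ≤-refl b<c (<⇒≤ c<e))
        (cong (μ * φ c +_) (cong₂ _*_ x≡ (trans (cong (_* φ (suc c)) (within-in (m<n⇒m<1+n b<c) c<e)) (*-identityˡ (φ (suc c))))))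
      spoke-at-end : ∀ i → b < n * i → n * i ≤ e → n * i ≡ e
      spoke-at-end i = between {i} {j}
      Q : ℕ
      Q = 2 ^ n₁
      Q≡ : Q ≡ 2 * (d * d)
      Q≡ = trans (^-distribˡ-+-* 2 k₁ k) (shape d)
        where
        shape : ∀ d → d * (2 * d) ≡ 2 * (d * d)
        shape = solve-∀
      both : 2 * d * (←at b + (→at e + ↑hub b e)) ≤ 2 * μ + d * In b e
      both = ≤-trans (≤-reflexive (cong (2 * d *_) (sym (+-assoc (←at b) (→at e) (↑hub b e))))) (collect d b e (2 * μ) (subst₂ Shape p₁ p₂
          (block b e b<e (inner-end (sector-end j<r)) c (suc c) d (2 * d)
            (λ i lo hi → ≤-reflexive (trans (cong (peak c (suc c)) (spoke-at-end i lo hi)) p₂))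
            (λ i lo hi → ≤-reflexive (cong (2 *_) (sym (trans (cong (peak c (suc c)) (spoke-at-end i lo hi)) p₂))))
            (≤-reflexive (trans (W (peak c (suc c))) (trans (cong₂ (λ a b → μ * a + μ * b) (peak-left 0 (n≤1+n c) (sym (+-identityʳ c))) (peak-right 0 (n≤1+n c) (sym (+-identityʳ (suc c))))) (shape μ)))))))
        where
        Shape : ℕ → ℕ → Set
        Shape φ₁ φ₂ = 2 * φ₁ * ←at b + 2 * φ₂ * →at e + 2 * d * ↑hub b e ≤ 2 * μ + (φ₁ * →at b + φ₂ * ←at e + d * ↓hub b e)
        p₁ : peak c (suc c) (suc b) ≡ d
        p₁ = peak-left k₁ (m<n⇒m<1+n b<c) c-b
        p₂ : peak c (suc c) e ≡ d
        p₂ = peak-right k₁ (<⇒≤ c<e) e-y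
        shape : ∀ m → m * 1 + m * 1 ≡ 2 * m
        shape = solve-∀
      left : In b e ≡ 0 → 2 * (2 * (d * d)) * ←at b ≤ 3 * μ * d
      left none = subst (λ q → 2 * q * ←at b ≤ 3 * μ * d) Q≡ (≤-trans
        (directed-left b e n₁ b<e (sector-end j<r) e≡
          (≤-reflexive (trans (W (peak e e)) (trans (cong₂ (λ a b → μ * a + μ * b) (peak-left k (<⇒≤ c<e) e-c) (peak-left k₁ c<e e-y)) (shape μ d)))))
        (≤-reflexive (trans (cong₂ (λ a b → 3 * μ * d + (Q * a + b)) (cong₂ _+_ r₀ s₀) l₀) (vanish (3 * μ * d) Q))))
        where
        r₀ : →at b ≡ 0
        r₀ = m+n≡0⇒m≡0 (→at b) (m+n≡0⇒m≡0 (→at b + ←at e) none)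
        l₀ : ←at e ≡ 0
        l₀ = m+n≡0⇒n≡0 (→at b) (m+n≡0⇒m≡0 (→at b + ←at e) none)
        s₀ : ↓hub b e ≡ 0
        s₀ = m+n≡0⇒n≡0 (→at b + ←at e) none
        shape : ∀ m d → m * (2 * d) + m * d ≡ 3 * m * d
        shape = solve-∀
        vanish : ∀ a q → a + (q * 0 + 0) ≡ a
        vanish = solve-∀
      right : In b e ≡ 0 → 2 * (2 * (d * d)) * (→at e + ↑hub b e) ≤ 3 * μ * d
      right none = subst (λ q → 2 * q * (→at e + ↑hub b e) ≤ 3 * μ * d) Q≡ (≤-trans (≤-reflexive (*-distribˡ-+ (2 * Q) (→at e) (↑hub b e))) (≤-trans
        (directed-right b e n₁ (2 * Q) b<e (sector-end j<r) e≡
          (λ i lo hi → ≤-reflexive (cong (2 *_) (sym (trans (cong (peak (suc b) (suc b)) (spoke-at-end i lo hi)) (peak-right n₁ b<e e≡)))))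
          (≤-reflexive (trans (W (peak (suc b) (suc b))) (trans (cong₂ (λ a b → μ * a + μ * b) (peak-right k₁ b<c c-b) (peak-right k (m<n⇒m<1+n b<c) y-b)) (shape μ d)))))
        (≤-reflexive (trans (cong₂ (λ a b → 3 * μ * d + (Q * a + b)) (cong₂ _+_ l₀ s₀) r₀) (vanish (3 * μ * d) Q)))))
        where
        r₀ : →at b ≡ 0
        r₀ = m+n≡0⇒m≡0 (→at b) (m+n≡0⇒m≡0 (→at b + ←at e) none)
        l₀ : ←at e ≡ 0
        l₀ = m+n≡0⇒n≡0 (→at b) (m+n≡0⇒m≡0 (→at b + ←at e) none)
        s₀ : ↓hub b e ≡ 0
        s₀ = m+n≡0⇒n≡0 (→at b + ←at e) none
        shape : ∀ m d → m * d + m * (2 * d) ≡ 3 * m * d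
        shape = solve-∀
        vanish : ∀ a q → a + (q * 0 + 0) ≡ a
        vanish = solve-∀

-- The stacks are followed, from sector number s on, by one sector of (2ᵏ⁺¹)² − 1 pebbles and by
-- alternating sectors; the last sector contains the target.
module Unsolvable (k₁ ρ s : ℕ) (A : ℕ → ℕ) (x y : ℕ) (y<N : y < JahangirLower.N k₁ (chain-length ρ s)) where

  r : ℕ
  r = chain-length ρ s

  open JahangirLower k₁ r
  open Stacks A x y y<N
  open Blocks k₁ r A x y y<N
  open Balance k₁ r A x y y<N

  module _
    (V : ℕ) (V+1 : suc V ≡ 2 * (2 * d))
    (free : ∀ b e → s * n ≤ b → Clear b e)
    (x-away : x ≡ 0 ⊎ (0 < y × y < r * n))
    (low-s : suc (A s) ≡ 2 * d) (top : suc (A (suc s)) ≡ 2 * (2 * d) * suc V)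
    (lows : ∀ i → suc (A (double i + (2 + s))) ≡ 2 * d)
    (highs : ∀ i → suc (A (suc (double i + (2 + s)))) ≡ 2 * (2 * d)) where

    far : ∀ {j} → s ≤ j → s * n ≤ j * n
    far = *-monoˡ-≤ n

    module _ {D′ : Distribution J} (σ : Star (Move J) stacks D′) where
      open Counts σ
      open Play σ

      low-pass : ∀ {j V} → s ≤ j → j < r → suc (A j) ≡ 2 * d → Balanced σ (j * n) V → Balanced σ (n₁ + j * n) V
      low-pass {j} {V} s≤j j<r L B = subst (Balanced σ (n₁ + j * n)) (+-identityʳ V)
        (extend σ (m≤n+m (j * n) n₁) B (≤-trans (passes {Out b e} (low σ j j<r (free b e (far s≤j)) L)) (m≤m+n (In b e) 0)))
        where
        b e : ℕ
        b = j * n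
        e = n₁ + j * n

      high-pass : ∀ {j V} → s ≤ j → suc j < r → suc (A (suc j)) ≡ 2 * (2 * d) → Balanced σ (n₁ + j * n) V → Balanced σ (n + suc j * n) V
      high-pass {j} {V} s≤j j<r H B = subst (Balanced σ (n + suc j * n)) (+-identityʳ V)
        (extend σ (<⇒≤ (m≤n+m (suc j * n) n)) B (≤-trans (passes {Out b e} (high σ j j<r (free b e (≤-trans (far s≤j) (m≤n+m (j * n) n₁))) H)) (m≤m+n (In b e) 0)))
        where
        b e : ℕ
        b = n₁ + j * n
        e = n + suc j * n

      double-mono : ∀ {i} → i ≤ ρ → double i ≤ double ρ
      double-mono {zero} _ = z≤n
      double-mono {suc i} (s≤s h) = grow h
        where
        grow : ∀ {a b} → a ≤ b → double (suc a) ≤ double (suc b)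
        grow {zero} {_} _ = s≤s (s≤s z≤n)
        grow {suc a} (s≤s h) = s≤s (s≤s (grow h))

      s≤+ : ∀ i → s ≤ i + (2 + s)
      s≤+ i = ≤-trans (m≤n+m s 2) (m≤n+m (2 + s) i)

      alternating : Balanced σ (s * n) 0 → ∀ i → i ≤ ρ → Balanced σ ((double i + (2 + s)) * n) V
      alternating B zero _ = extend σ (<⇒≤ (m≤n+m (suc s * n) n)) (low-pass ≤-refl s<r low-s B)
          (big-block (2 * d) V (Out b e) (In b e) top (high-block s (≤-trans (s≤s (s≤s ≤-refl)) s+2≤r) (free b e (m≤n+m (s * n) n₁))))
        where
        b e : ℕ
        b = n₁ + s * n
        e = n + suc s * n
        s+2≤r : 2 + s ≤ r
        s+2≤r = ≤-trans (m≤n+m (2 + s) (double ρ)) (m≤n+m _ 3)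
        s<r : s < r
        s<r = ≤-trans (n≤1+n (suc s)) s+2≤r
      alternating B (suc i) i<ρ = high-pass (s≤+ (double i)) (bound 2 (s≤s (s≤s z≤n))) (highs i)
          (low-pass (s≤+ (double i)) (bound 1 (s≤s z≤n)) (lows i) (alternating B i (<⇒≤ i<ρ)))
        where
        bound : ∀ c → c ≤ 2 → c + (double i + (2 + s)) ≤ r
        bound c c≤2 = ≤-trans (+-monoˡ-≤ (double i + (2 + s)) c≤2) (≤-trans (+-monoˡ-≤ (2 + s) (double-mono i<ρ)) (m≤n+m _ 3))

      -- The chain and the target's region see the same boundary flows with opposite signs. Their
      -- inequalities add up to `2 * (2 * d) ≤ V`, against `suc V ≡ 2 * (2 * d)`.
      unreachable : Balanced σ (s * n) 0 → ¬ 1 ≤ lookup D′ (at (r * n + k))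
      unreachable B 1≤ = linear-⊥ 0 (home ⊞ sectors ⊞ ≤-reflexive V+1)
          (identity (2 * (2 * d)) (←at 0) (→at 0) (←at z) (→at z) (↑hub 0 z) (↓hub 0 z) V)
        where
        j z : ℕ
        j = double ρ + (2 + s)
        z = n₁ + suc (suc j) * n
        s≤j : s ≤ j
        s≤j = s≤+ (double ρ)
        sectors : 2 * ←at 0 + 2 * →at z + ↑hub 0 z ≤ 4 * →at 0 + 4 * ←at z + 2 * ↓hub 0 z + V
        sectors = last-group σ j ≤-refl (highs ρ) (lows (suc ρ))
          (free _ _ (≤-trans (far s≤j) (m≤n+m (j * n) n₁)))
          (free _ _ (≤-trans (far (≤-trans s≤j (n≤1+n j))) (m≤n+m (suc j * n) n)))
          (low-pass s≤j (s≤s (≤-trans (n≤1+n j) (n≤1+n (suc j)))) (lows ρ) (alternating B ρ ≤-refl))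
        1≤z : 1 ≤ z
        1≤z = ≤-trans (≤-trans (s≤s z≤n) (m≤n+m k k₁)) (m≤m+n n₁ _)
        target<N : r * n + k < N
        target<N = ≤-trans (+-monoʳ-< (r * n) (m<m+n k z<s)) (≤-reflexive (trans (+-comm (r * n) n) (*-comm m n)))
        empty : weigh (lift 1 (w₀ z 1≤z refl)) stacks ≡ 0
        empty = trans (weigh-stacks 1 (w₀ z 1≤z refl)) (cong₂ _+_
          (∑-zero r λ i i<r → trans (cong (A i *_) (w₀-in z 1≤z refl (≤-trans z<s (m≤n+m k (i * n))) (≤-pred (middle< i<r)))) (*-zeroʳ (A i)))
          ([ (λ x≡0 → cong (_* w₀ z 1≤z refl y) x≡0)
           , (λ (0<y , y<) → trans (cong (x *_) (w₀-in z 1≤z refl 0<y (≤-pred y<))) (*-zeroʳ x)) ]′ x-away))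
          where
          middle< : ∀ {i} → i < r → i * n + k < r * n
          middle< {i} i<r = ≤-trans (+-monoʳ-< (i * n) (m<m+n k z<s)) (≤-trans (≤-reflexive (+-comm (i * n) n)) (*-monoˡ-≤ n i<r))
        home : 2 * (2 * d) + (4 * →at 0 + 4 * ←at z + 2 * ↓hub 0 z) ≤ 2 * ←at 0 + 2 * →at z + 1 * ↑hub 0 z
        home = home-block z 1≤z refl (at (r * n + k)) (cong suc (trans (toℕ-mod (r * n + k) N) (m<n⇒m%n≡m target<N))) 1≤ empty
        identity : ∀ Y l₀ r₀ lz rz t s V →
          2 * l₀ + 2 * rz + 1 * t + (4 * r₀ + 4 * lz + 2 * s + V + Y) + 1 ≡ Y + (4 * r₀ + 4 * lz + 2 * s) + (2 * l₀ + 2 * rz + t + suc V)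
        identity = solve-∀

-- The two extremal distributions and the resulting values

module Values (k₁ : ℕ) where

  d L H P : ℕ
  d = 2 ^ k₁
  L = 2 * d ∸ 1
  H = 2 * (2 * d) ∸ 1
  P = 2 * (2 * d) * (2 * (2 * d)) ∸ 1

  suc-∸1 : ∀ {a} → 1 ≤ a → suc (a ∸ 1) ≡ a
  suc-∸1 = m+[n∸m]≡n

  1≤2d : 1 ≤ 2 * d
  1≤2d = m^n>0 2 (suc k₁)

  1≤4d : 1 ≤ 2 * (2 * d)
  1≤4d = m^n>0 2 (suc (suc k₁))

  L+1 : suc L ≡ 2 * d
  L+1 = suc-∸1 1≤2d

  H+1 : suc H ≡ 2 * (2 * d)
  H+1 = suc-∸1 1≤4d

  P+1 : suc P ≡ 2 * (2 * d) * (2 * (2 * d))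
  P+1 = suc-∸1 (*-mono-≤ 1≤4d 1≤4d)

  alternate : ℕ → ℕ
  alternate zero          = L
  alternate (suc zero)    = H
  alternate (suc (suc i)) = alternate i

  alternate-double : ∀ i → alternate (double i) ≡ L
  alternate-double zero    = refl
  alternate-double (suc i) = alternate-double i

  alternate-suc-double : ∀ i → alternate (suc (double i)) ≡ H
  alternate-suc-double zero    = refl
  alternate-suc-double (suc i) = alternate-suc-double i

  tail : ℕ → ℕ
  tail zero          = L
  tail (suc zero)    = P
  tail (suc (suc i)) = alternate i

  ∑-alternate : ∀ ρ → ∑ (3 + double ρ) alternate ≡ (2 + ρ) * L + (1 + ρ) * H
  ∑-alternate zero    = shape L H
    where
    shape : ∀ l h → l + (h + (l + 0)) ≡ 2 * l + 1 * h
    shape = solve-∀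
  ∑-alternate (suc ρ) = trans (cong (λ x → L + (H + x)) (∑-alternate ρ)) (shape L H ρ)
    where
    shape : ∀ l h r → l + (h + ((2 + r) * l + (1 + r) * h)) ≡ (2 + suc r) * l + (1 + suc r) * h
    shape = solve-∀

  -- The pebbling number of the Jahangir graph with 8 + 2ρ sectors (e = 0) or 9 + 2ρ sectors
  -- (e = 2⌊2ᵏ⁺¹/3⌋).
  number : ℕ → ℕ → ℕ
  number ρ e = suc (P + (4 + ρ) * L + (2 + ρ) * H + e)

  ∑-tail : ∀ ρ → L + (H + ∑ (5 + double ρ) tail) ≡ P + (4 + ρ) * L + (2 + ρ) * H
  ∑-tail ρ = trans (cong (λ x → L + (H + (L + (P + x)))) (∑-alternate ρ)) (shape L H P ρ)
    where
    shape : ∀ l h p r → l + (h + (l + (p + ((2 + r) * l + (1 + r) * h)))) ≡ p + (4 + r) * l + (2 + r) * h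
    shape = solve-∀

  k μ : ℕ
  k = suc k₁
  μ = third k

  A₀ : ℕ → ℕ
  A₀ zero          = L
  A₀ (suc zero)    = H
  A₀ (suc (suc i)) = tail i

  -- The intermediate sector follows the outer pair. Its second stack of `μ` pebbles, on the next
  -- vertex after the middle of sector 2, is the extra stack at `y`.
  A₁ : ℕ → ℕ
  A₁ zero                = L
  A₁ (suc zero)          = H
  A₁ (suc (suc zero))    = μ
  A₁ (suc (suc (suc i))) = tail i

  4≡ : 4 * d ≡ 2 * (2 * d)
  4≡ = *-assoc 2 2 d

  insufficient-even : ∀ ρ → ¬ Suffices (jahangir (k + k) (4 + (double ρ + 4))) 1 (P + (4 + ρ) * L + (2 + ρ) * H + 0)
  insufficient-even ρ S = impossible (S stacks total (at (r * n + k)))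
    where
    r : ℕ
    r = 3 + (double ρ + 4)
    open JahangirLower k₁ r hiding (k)
    open Stacks A₀ 0 0 z<s
    open Balance k₁ r A₀ 0 0 z<s
    total : sum stacks ≡ P + (4 + ρ) * L + (2 + ρ) * H + 0
    total = trans sum-stacks (cong (_+ 0) (trans (cong (λ x → ∑ x A₀) (cong (3 +_) (+-comm (double ρ) 4))) (∑-tail ρ)))
    impossible : ¬ Reachable J 1 stacks (at (r * n + k))
    impossible (D′ , σ , 1≤) = Unsolvable.unreachable k₁ ρ 2 A₀ 0 0 z<s H H+1 (λ _ _ _ → inj₁ refl) (inj₁ refl) L+1
      (trans P+1 (cong (2 * (2 * d) *_) (sym H+1)))
      (λ i → trans (cong (suc ∘ A₀) (+-comm (double i) 4)) (trans (cong suc (alternate-double i)) L+1))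
      (λ i → trans (cong (suc ∘ A₀ ∘ suc) (+-comm (double i) 4)) (trans (cong suc (alternate-suc-double i)) H+1))
      σ (first-group σ (s≤s (s≤s z≤n)) L+1 H+1 (inj₁ refl) (inj₁ refl)) 1≤

  insufficient-odd : ∀ ρ → ¬ Suffices (jahangir (k + k) (4 + (double ρ + 5))) 1 (P + (4 + ρ) * L + (2 + ρ) * H + 2 * μ)
  insufficient-odd ρ S = impossible (S stacks total (at (r * n + k)))
    where
    r y : ℕ
    r = 3 + (double ρ + 5)
    y = suc (2 * (k + k) + k)
    open JahangirLower k₁ r hiding (k)
    y<4n : y < 4 * n
    y<4n = ≤-trans (m≤m+n (suc y) (1 + 3 * k₁)) (≤-reflexive (shape k₁))
      where
      shape : ∀ k₁ → suc (suc (2 * (suc k₁ + suc k₁) + suc k₁)) + (1 + 3 * k₁) ≡ 4 * (suc k₁ + suc k₁)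
      shape = solve-∀
    y≤3n : y ≤ 3 * n
    y≤3n = ≤-trans (m≤m+n y k₁) (≤-reflexive (shape k₁))
      where
      shape : ∀ k₁ → suc (2 * (suc k₁ + suc k₁) + suc k₁) + k₁ ≡ 3 * (suc k₁ + suc k₁)
      shape = solve-∀
    4≤r : 4 ≤ r
    4≤r = s≤s (s≤s (s≤s (≤-trans (s≤s z≤n) (m≤n+m 5 (double ρ)))))
    y<rn : y < r * n
    y<rn = ≤-trans y<4n (*-monoˡ-≤ n 4≤r)
    y<N : y < N
    y<N = ≤-trans y<rn (≤-trans (*-monoˡ-≤ n (n≤1+n r)) (≤-reflexive (*-comm m n)))
    open Stacks A₁ μ y y<N
    open Balance k₁ r A₁ μ y y<N
    total : sum stacks ≡ P + (4 + ρ) * L + (2 + ρ) * H + 2 * μ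
    total = begin
      sum stacks                                          ≡⟨ sum-stacks ⟩
      ∑ r A₁ + μ                                          ≡⟨ cong (λ x → ∑ (3 + x) A₁ + μ) (+-comm (double ρ) 5) ⟩
      L + (H + (μ + ∑ (5 + double ρ) tail)) + μ           ≡⟨ shape L H μ (∑ (5 + double ρ) tail) ⟩
      L + (H + ∑ (5 + double ρ) tail) + 2 * μ             ≡⟨ cong (_+ 2 * μ) (∑-tail ρ) ⟩
      P + (4 + ρ) * L + (2 + ρ) * H + 2 * μ               ∎
      where
      open ≡-Reasoning
      shape : ∀ l h m t → l + (h + (m + t)) + m ≡ l + (h + t) + 2 * m
      shape = solve-∀
    impossible : ¬ Reachable J 1 stacks (at (r * n + k))
    impossible (D′ , σ , 1≤) = Unsolvable.unreachable k₁ ρ 3 A₁ μ y y<N H H+1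
      (λ _ _ h → inj₂ (inj₁ (≤-trans y≤3n h))) (inj₂ (z<s , y<rn)) L+1
      (trans P+1 (cong (2 * (2 * d) *_) (sym H+1)))
      (λ i → trans (cong (suc ∘ A₁) (+-comm (double i) 5)) (trans (cong suc (alternate-double i)) L+1))
      (λ i → trans (cong (suc ∘ A₁ ∘ suc) (+-comm (double i) 5)) (trans (cong suc (alternate-suc-double i)) H+1))
      σ start 1≤
      where
      past : n + 1 * n < y
      past = s≤s (m≤m+n (2 * n) k)
      start : Balanced σ (3 * n) 0
      start = extend σ (m≤n+m (2 * n) n)
        (first-group σ (s≤s (s≤s z≤n)) L+1 H+1 (inj₂ (inj₂ (<-trans (m≤n+m (1 * n) n) past))) (inj₂ (inj₂ past)))
        (≤-trans (middle σ 2 (s≤s (s≤s (s≤s z≤n))) refl refl (subst (3 * μ <_) (sym 4≡) (third< k))) (m≤m+n _ 0))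

  debt-double : ∀ gap i → debt gap (double i) false ≡ gap
  debt-double gap zero    = refl
  debt-double gap (suc i) = debt-double gap i

  double≡ : ∀ i → double i ≡ 2 * i
  double≡ zero    = refl
  double≡ (suc i) = trans (cong (2 +_) (double≡ i)) (sym (*-suc 2 i))

  -- The content of the largest blocked chain: the extremal distribution with the big sector reduced
  -- to `H` pebbles.
  bound : ℕ → ℕ → ℕ
  bound ρ e = (4 + ρ) * L + (3 + ρ) * H + e

  -- Here the two bounds meet: `P + 1` is the square of `4 * d`, and the added `4 * d` is `H + 1`,
  -- which accounts for the sector of `H` pebbles in place of the big one.
  number+4d : ∀ ρ e → number ρ e + 4 * d ≡ suc (bound ρ e) + 4 * d * (4 * d)
  number+4d ρ e = begin
    suc P + (4 + ρ) * L + (2 + ρ) * H + e + 4 * d                 ≡⟨ cong₂ (λ a b → a + (4 + ρ) * L + (2 + ρ) * H + e + b) (trans P+1 (sym (cong₂ _*_ 4≡ 4≡))) (trans 4≡ (sym H+1)) ⟩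
    4 * d * (4 * d) + (4 + ρ) * L + (2 + ρ) * H + e + suc H       ≡⟨ shape (4 * d * (4 * d)) L H ρ e ⟩
    suc (bound ρ e) + 4 * d * (4 * d)                             ∎
    where
    open ≡-Reasoning
    shape : ∀ t l h r e → t + (4 + r) * l + (2 + r) * h + e + suc h ≡ suc ((4 + r) * l + (3 + r) * h + e) + t
    shape = solve-∀

  bound+ : ∀ ρ e → bound ρ e + (7 + 2 * ρ) ≡ (20 + 6 * ρ) * d + e
  bound+ ρ e = trans (shape₁ L H ρ e) (trans (cong₂ (λ a b → (4 + ρ) * a + (3 + ρ) * b + e) L+1 H+1) (shape₂ d ρ e))
    where
    shape₁ : ∀ l h r e → (4 + r) * l + (3 + r) * h + e + (7 + 2 * r) ≡ (4 + r) * suc l + (3 + r) * suc h + e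
    shape₁ = solve-∀
    shape₂ : ∀ d r e → (4 + r) * (2 * d) + (3 + r) * (2 * (2 * d)) + e ≡ (20 + 6 * r) * d + e
    shape₂ = solve-∀

  sufficient-even : ∀ ρ → Suffices (jahangir (k + k) (8 + double ρ)) 1 (number ρ 0)
  sufficient-even ρ = JahangirUpper.suffices k₁ (6 + double ρ) (bound ρ 0) (number ρ 0)
    (≤-trans (m≤n+m (3 * d * (7 + double ρ)) (debt gap (7 + double ρ) false)) (≤-reflexive (equal (debt gap (7 + double ρ) false))))
    (≤-trans (m≤n+m (3 * d * (7 + double ρ)) (4 * d)) (≤-reflexive (trans (equal (4 * d)) (shape (bound ρ 0) (4 * d) (7 + double ρ) d))))
    (number+4d ρ 0)
    where
    gap : ℕ
    gap = JahangirUpper.gap k₁ (6 + double ρ)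
    shape : ∀ b x r d → b + r + x + d ≡ b + x + r + d
    shape = solve-∀
    equal : ∀ x → x + 3 * d * (7 + double ρ) ≡ bound ρ 0 + (7 + double ρ) + x + d
    equal x = trans (cong (λ w → x + 3 * d * (7 + w)) (double≡ ρ)) (trans (shape′ d ρ x)
      (cong (λ w → w + x + d) (trans (sym (bound+ ρ 0)) (cong (λ w → bound ρ 0 + (7 + w)) (sym (double≡ ρ))))))
      where
      shape′ : ∀ d r x → x + 3 * d * (7 + 2 * r) ≡ (20 + 6 * r) * d + 0 + x + d
      shape′ = solve-∀

  sufficient-odd : ∀ ρ → Suffices (jahangir (k + k) (9 + double ρ)) 1 (number ρ (2 * μ))
  sufficient-odd ρ = JahangirUpper.suffices k₁ (7 + double ρ) (bound ρ (2 * μ)) (number ρ (2 * μ))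
    -- An even number of sectors in the chain carries the debt `gap`, exactly what the intermediate
    -- sector of `2 * μ` pebbles is short of the average, so equality holds.
    (≤-reflexive (trans equal (cong (λ w → bound ρ (2 * μ) + (8 + double ρ) + w + d) (sym (debt-double gap ρ)))))
    (≤-trans (≤-reflexive equal) (≤-trans (+-monoˡ-≤ d (+-monoʳ-≤ (bound ρ (2 * μ) + (8 + double ρ)) gap≤4d)) (≤-reflexive (shape (bound ρ (2 * μ)) (4 * d) (8 + double ρ) d))))
    (number+4d ρ (2 * μ))
    where
    open JahangirUpper k₁ (7 + double ρ) using (gap; gap+; gap≤d)
    gap≤4d : gap ≤ 4 * d
    gap≤4d = ≤-trans gap≤d (m≤m+n d _)
    shape : ∀ b x r d → b + r + x + d ≡ b + x + r + d
    shape = solve-∀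
    equal : 3 * d * (8 + double ρ) ≡ bound ρ (2 * μ) + (8 + double ρ) + gap + d
    equal = begin
      3 * d * (8 + double ρ)                              ≡⟨ cong (λ w → 3 * d * (8 + w)) (double≡ ρ) ⟩
      3 * d * (8 + 2 * ρ)                                 ≡⟨ shape₁ d ρ ⟩
      (20 + 6 * ρ) * d + 3 * d + d                        ≡⟨ cong (λ w → (20 + 6 * ρ) * d + w + d) (sym gap+) ⟩
      (20 + 6 * ρ) * d + (suc (2 * μ) + gap) + d            ≡⟨ shape₂ ((20 + 6 * ρ) * d) (2 * μ) gap d ⟩
      suc ((20 + 6 * ρ) * d + 2 * μ) + gap + d              ≡⟨ cong (λ w → suc w + gap + d) (sym (bound+ ρ (2 * μ))) ⟩
      suc (bound ρ (2 * μ) + (7 + 2 * ρ)) + gap + d         ≡⟨ cong (λ w → w + gap + d) (sym (+-suc (bound ρ (2 * μ)) (7 + 2 * ρ))) ⟩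
      bound ρ (2 * μ) + (8 + 2 * ρ) + gap + d               ≡⟨ cong (λ w → bound ρ (2 * μ) + (8 + w) + gap + d) (sym (double≡ ρ)) ⟩
      bound ρ (2 * μ) + (8 + double ρ) + gap + d            ∎
      where
      open ≡-Reasoning
      shape₁ : ∀ d r → 3 * d * (8 + 2 * r) ≡ (20 + 6 * r) * d + 3 * d + d
      shape₁ = solve-∀
      shape₂ : ∀ a m e d → a + (suc m + e) + d ≡ suc (a + m) + e + d
      shape₂ = solve-∀

  jahangir-even : ∀ ρ → IsPebblingNumber (jahangir (k + k) (8 + double ρ)) 1 (number ρ 0)
  jahangir-even ρ = sufficient-even ρ , Calculus.minimal (jahangir (k + k) (8 + double ρ))
    (subst (λ m → ¬ Suffices (jahangir (k + k) (4 + m)) 1 (P + (4 + ρ) * L + (2 + ρ) * H + 0)) (+-comm (double ρ) 4) (insufficient-even ρ))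

  jahangir-odd : ∀ ρ → IsPebblingNumber (jahangir (k + k) (9 + double ρ)) 1 (number ρ (2 * μ))
  jahangir-odd ρ = sufficient-odd ρ , Calculus.minimal (jahangir (k + k) (9 + double ρ))
    (subst (λ m → ¬ Suffices (jahangir (k + k) (4 + m)) 1 (P + (4 + ρ) * L + (2 + ρ) * H + 2 * μ)) (+-comm (double ρ) 5) (insufficient-odd ρ))

-- The formula over the integers

open import Data.Integer as ℤ using (+_)
import Data.Integer.Properties as ℤ
import Data.Integer.Tactic.RingSolver as ℤ-Solver

α-even : ∀ {m} q f₀ f₁ f₂ → m ≡ q * 2 →
  α m f₀ f₁ f₂ ≡ + q ℤ.* (+ f₀ ℤ.+ + f₂ ℤ.- + 2) ℤ.- + f₂ ℤ.+ + 1
α-even q f₀ f₁ f₂ refl rewrite dec-true (2 ∣? (q * 2)) (divides q refl) =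
  cong (λ x → + x ℤ.* (+ f₀ ℤ.+ + f₂ ℤ.- + 2) ℤ.- + f₂ ℤ.+ + 1) (m*n/n≡m q 2)

α-odd : ∀ {m} q f₀ f₁ f₂ → m ≡ suc (q * 2) →
  α m f₀ f₁ f₂ ≡ + q ℤ.* (+ f₀ ℤ.+ + f₂ ℤ.- + 2) ℤ.+ + f₁ ℤ.- + f₂
α-odd q f₀ f₁ f₂ refl
  rewrite dec-false (2 ∣? suc (q * 2)) (λ h → contradiction (∣1⇒≡1 (∣m+n∣m⇒∣n (subst (2 ∣_) (sym (+-comm (q * 2) 1)) h) (divides q refl))) λ ()) =
  cong (λ x → + x ℤ.* (+ f₀ ℤ.+ + f₂ ℤ.- + 2) ℤ.+ + f₁ ℤ.- + f₂) (m*n/n≡m q 2)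

-- `P` enters as `h + h * suc h`: the product is the `h`-fold pebbling number of the cycle on
-- `n + 2` vertices, the first term of the formula.
number-ℤ : ∀ l h r e → + suc (h + h * suc h + (4 + r) * l + (2 + r) * h + e) ≡
  + 1 ℤ.+ (+ h ℤ.+ + (h * suc h) ℤ.+ (+ 4 ℤ.+ + r) ℤ.* + l ℤ.+ (+ 2 ℤ.+ + r) ℤ.* + h ℤ.+ + e)
number-ℤ l h r e = cong₂ (λ a b → + 1 ℤ.+ (+ h ℤ.+ + (h * suc h) ℤ.+ a ℤ.+ b ℤ.+ + e)) (ℤ.pos-* (4 + r) l) (ℤ.pos-* (2 + r) h)

even-identity : ∀ l h t r e → + 1 ℤ.+ (h ℤ.+ t ℤ.+ (+ 4 ℤ.+ r) ℤ.* l ℤ.+ (+ 2 ℤ.+ r) ℤ.* h ℤ.+ e) ≡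
  t ℤ.+ ((+ 4 ℤ.+ r) ℤ.* ((+ 1 ℤ.+ l) ℤ.+ (+ 1 ℤ.+ h) ℤ.- + 2) ℤ.- (+ 1 ℤ.+ h) ℤ.+ (+ 1 ℤ.+ e)) ℤ.+ + 1
even-identity = ℤ-Solver.solve-∀

odd-identity : ∀ l h t r e → + 1 ℤ.+ (h ℤ.+ t ℤ.+ (+ 4 ℤ.+ r) ℤ.* l ℤ.+ (+ 2 ℤ.+ r) ℤ.* h ℤ.+ e) ≡
  t ℤ.+ ((+ 4 ℤ.+ r) ℤ.* ((+ 1 ℤ.+ l) ℤ.+ (+ 1 ℤ.+ h) ℤ.- + 2) ℤ.+ (+ 1 ℤ.+ e) ℤ.- (+ 1 ℤ.+ h)) ℤ.+ + 1
odd-identity = ℤ-Solver.solve-∀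

data Parity : ℕ → Set where
  even : ∀ ρ → Parity (double ρ)
  odd  : ∀ ρ → Parity (suc (double ρ))

parity : ∀ m → Parity m
parity zero    = even 0
parity (suc m) with parity m
... | even ρ = odd ρ
... | odd ρ  = even (suc ρ)

module _ (k₁ : ℕ) where
  open Values k₁

  P≡ : P ≡ H + H * suc H
  P≡ = suc-injective (trans P+1 (sym (cong₂ _*_ H+1 H+1)))

  f₀≡ : 1 * 2 ^ k ≡ suc L
  f₀≡ = trans (*-identityˡ (2 ^ k)) (sym L+1)

  f₂≡ : 1 * 2 ^ suc k ≡ suc H
  f₂≡ = trans (*-identityˡ (2 ^ suc k)) (sym H+1)

  fₜ≡ : H * 2 ^ suc k ≡ H * suc H
  fₜ≡ = cong (H *_) (sym H+1)

  half≡ : ∀ ρ → double ρ ≡ ρ * 2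
  half≡ ρ = trans (double≡ ρ) (*-comm 2 ρ)

  number≡ : ∀ ρ e → + number ρ e ≡
    + 1 ℤ.+ (+ H ℤ.+ + (H * suc H) ℤ.+ (+ 4 ℤ.+ + ρ) ℤ.* + L ℤ.+ (+ 2 ℤ.+ + ρ) ℤ.* + H ℤ.+ + e)
  number≡ ρ e = trans (cong (λ p → + suc (p + (4 + ρ) * L + (2 + ρ) * H + e)) P≡) (number-ℤ L H ρ e)

  formula-even : ∀ ρ → + number ρ 0 ≡
    + (H * 2 ^ suc k) ℤ.+ α (8 + double ρ) (1 * 2 ^ k) (suc (2 * μ)) (1 * 2 ^ suc k) ℤ.+ + 1
  formula-even ρ = trans (number≡ ρ 0) (trans (even-identity (+ L) (+ H) (+ (H * suc H)) (+ ρ) (+ 0))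
    (cong₂ (λ x y → x ℤ.+ y ℤ.+ + 1) (cong +_ (sym fₜ≡))
      (sym (trans (cong₂ (λ a b → α (8 + double ρ) a (suc (2 * μ)) b) f₀≡ f₂≡)
        (α-even (4 + ρ) (suc L) (suc (2 * μ)) (suc H) (cong (λ x → 8 + x) (half≡ ρ)))))))

  formula-odd : ∀ ρ → + number ρ (2 * μ) ≡
    + (H * 2 ^ suc k) ℤ.+ α (9 + double ρ) (1 * 2 ^ k) (suc (2 * μ)) (1 * 2 ^ suc k) ℤ.+ + 1
  formula-odd ρ = trans (number≡ ρ (2 * μ)) (trans (odd-identity (+ L) (+ H) (+ (H * suc H)) (+ ρ) (+ (2 * μ)))
    (cong₂ (λ x y → x ℤ.+ y ℤ.+ + 1) (cong +_ (sym fₜ≡))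
      (sym (trans (cong₂ (λ a b → α (9 + double ρ) a (suc (2 * μ)) b) f₀≡ f₂≡)
        (α-odd (4 + ρ) (suc L) (suc (2 * μ)) (suc H) (cong (λ x → 9 + x) (half≡ ρ)))))))

JahangirFormula : ℕ → ℕ → Set
JahangirFormula n m = ∃[ fJ ] ∃[ fₜ ] ∃[ f₀ ] ∃[ f₁ ] ∃[ f₂ ]
    IsPebblingNumber (jahangir n m) 1 fJ
    × IsPebblingNumber (cycle (n + 2)) (2 ^ (n / 2 + 1) ∸ 1) fₜ
    × IsPebblingNumber (cycle n) 1 f₀
    × IsPebblingNumber (cycle (n + 1)) 1 f₁
    × IsPebblingNumber (cycle (n + 2)) 1 f₂
    × + fJ ≡ + fₜ ℤ.+ α m f₀ f₁ f₂ ℤ.+ + 1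

assemble : ∀ k₁ m fJ → let open Values k₁ in IsPebblingNumber (jahangir (k + k) m) 1 fJ →
  + fJ ≡ + (H * 2 ^ suc k) ℤ.+ α m (1 * 2 ^ k) (suc (2 * μ)) (1 * 2 ^ suc k) ℤ.+ + 1 → JahangirFormula (k + k) m
assemble k₁ m fJ fJ-number formula = fJ , H * 2 ^ suc k , 1 * 2 ^ k , suc (2 * μ) , 1 * 2 ^ suc k ,
  fJ-number ,
  subst₂ (λ K t → IsPebblingNumber (cycle K) t (H * 2 ^ suc k)) K≡ t≡ (evenCycle k H 1≤H) ,
  evenCycle k₁ 1 ≤-refl ,
  subst (λ K → IsPebblingNumber (cycle K) 1 (suc (2 * μ))) (trans (+-suc k k) (+-comm 1 (k + k))) (oddCycle k₁) ,
  subst (λ K → IsPebblingNumber (cycle K) 1 (1 * 2 ^ suc k)) K≡ (evenCycle k 1 ≤-refl) ,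
  formula
  where
  open Values k₁
  K≡ : suc k + suc k ≡ k + k + 2
  K≡ = shape k
    where
    shape : ∀ k → suc k + suc k ≡ k + k + 2
    shape = solve-∀
  t≡ : H ≡ 2 ^ ((k + k) / 2 + 1) ∸ 1
  t≡ = cong (λ x → 2 ^ x ∸ 1) (sym (trans (cong (λ x → x + 1) (trans (cong (_/ 2) (twice k)) (m*n/n≡m k 2))) (+-comm k 1)))
    where
    twice : ∀ k → k + k ≡ k * 2
    twice = solve-∀
  1≤H : 1 ≤ H
  1≤H = ≤-pred (≤-trans (≤-trans (s≤s (s≤s z≤n)) (*-monoʳ-≤ 2 1≤2d)) (≤-reflexive (sym H+1)))

jahangir-formula : ∀ k₁ m → 8 ≤ m → JahangirFormula (suc k₁ + suc k₁) m
jahangir-formula k₁ m 8≤m = subst (JahangirFormula _) (m+[n∸m]≡n 8≤m) (by-parity (parity (m ∸ 8)))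
  where
  open Values k₁
  by-parity : ∀ {o} → Parity o → JahangirFormula (k + k) (8 + o)
  by-parity (even ρ) = assemble k₁ (8 + double ρ) (number ρ 0) (jahangir-even ρ) (formula-even k₁ ρ)
  by-parity (odd ρ)  = assemble k₁ (9 + double ρ) (number ρ (2 * μ)) (jahangir-odd ρ) (formula-odd k₁ ρ)

-- For `k₁ = 0` the values are `d = 1`, `L = 1`, `H = 3`, `P = 15` and `μ = 1`, so both parities
-- evaluate directly.
jahangir-2 : ∀ m → 8 ≤ m → IsPebblingNumber (jahangir 2 m) 1 (2 * m + 10)
jahangir-2 m 8≤m = subst (λ x → IsPebblingNumber (jahangir 2 x) 1 (2 * x + 10)) (m+[n∸m]≡n 8≤m) (by-parity (parity (m ∸ 8)))
  where
  open Values 0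
  by-parity : ∀ {o} → Parity o → IsPebblingNumber (jahangir 2 (8 + o)) 1 (2 * (8 + o) + 10)
  by-parity (even ρ) = subst (IsPebblingNumber (jahangir 2 (8 + double ρ)) 1)
    (trans (shape ρ) (cong (λ x → 2 * (8 + x) + 10) (sym (double≡ ρ)))) (jahangir-even ρ)
    where
    shape : ∀ ρ → suc (15 + (4 + ρ) * 1 + (2 + ρ) * 3 + 0) ≡ 2 * (8 + 2 * ρ) + 10
    shape = solve-∀
  by-parity (odd ρ) = subst (IsPebblingNumber (jahangir 2 (9 + double ρ)) 1)
    (trans (shape ρ) (cong (λ x → 2 * (9 + x) + 10) (sym (double≡ ρ)))) (jahangir-odd ρ)
    where
    shape : ∀ ρ → suc (15 + (4 + ρ) * 1 + (2 + ρ) * 3 + 2) ≡ 2 * (9 + 2 * ρ) + 10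
    shape = solve-∀

theorem2p10 : (∀ (n m : ℕ) → 2 ≤ n → 2 ∣ n → 8 ≤ m →
    ∃[ fJ ] ∃[ fₜ ] ∃[ f₀ ] ∃[ f₁ ] ∃[ f₂ ]
    IsPebblingNumber (jahangir n m) 1 fJ
    × IsPebblingNumber (cycle (n + 2)) (2 ^ (n / 2 + 1) ∸ 1) fₜ
    × IsPebblingNumber (cycle n) 1 f₀
    × IsPebblingNumber (cycle (n + 1)) 1 f₁
    × IsPebblingNumber (cycle (n + 2)) 1 f₂
    × + fJ ≡ + fₜ ℤ.+ α m f₀ f₁ f₂ ℤ.+ + 1)
    × (∀ (m : ℕ) → 8 ≤ m → IsPebblingNumber (jahangir 2 m) 1 (2 * m + 10))
theorem2p10 = general , jahangir-2
  where
  general : ∀ n m → 2 ≤ n → 2 ∣ n → 8 ≤ m → JahangirFormula n m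
  general n m 2≤n (divides zero refl) 8≤m = contradiction 2≤n λ ()
  general n m 2≤n (divides (suc k₁) refl) 8≤m = subst (λ x → JahangirFormula x m) (shape k₁) (jahangir-formula k₁ m 8≤m)
    where
    shape : ∀ k₁ → suc k₁ + suc k₁ ≡ suc k₁ * 2
    shape = solve-∀
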